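{- Let $G$ be a graph of order $n$. Then $\lambda^-(G)=0$ if and only if $G$ is one of the following graphs: 1. $K_n$; 2. $\overline{K_n}$; 3. a doubly extended bouquet-dipole graph; 4. a collection of one or more odd cycles that intersect in exactly one vertex; 5. a two-set perfectly orderable graph.
   Context: Graphs are finite, simple (no loops or multiple edges), undirected; $n=|V(G)|$ is the order of $G$ (at least 1). $K_n$ is the complete graph and $\overline{K_n}$ the edgeless graph on $n$ vertices. Skew zero forcing: a subset $S\subseteq V(G)$ (possibly empty) is colored blue and all other vertices white. Skew color change rule: if any vertex (blue or white) has exactly one white neighbor, then that white neighbor becomes blue. $S$ is a skew zero forcing set if repeated application of the rule eventually turns all vertices blue. The skew zero forcing span $\lambda^-(G)$ is the number of distinct cardinalities $k$ for which there exist $Z,F\subseteq V(G)$ with $|Z|=|F|=k$ such that $Z$ is a skew zero forcing set and $F$ is not a skew zero forcing set. A graph $G$ is a doubly extended bouquet-dipole if it consists of vertices $u$ and $v$ that are each on a nonempty set of odd cycles, where all other vertices on the cycles have degree two, and $u,v$ are joined by a path of even order that alternates between single even order paths whose internal vertices all have degree two, and multiple even order paths whose internal vertices all have degree two. (The order of a path is its number of vertices.) The paper's illustration: $u$ lies on a 5-cycle and two 3-cycles, $v$ lies on a 7-cycle; $u$ is joined to a vertex $a$ by a single path of order 4; $a$ is joined to a vertex $b$ by three internally disjoint paths, of orders 4, 6 and 4; and $b$ is joined to $v$ by a single path of order 4. A graph $G$ is two-set perfectly orderable if (1) $V(G)$ can be partitioned into ordered sets $U=\{u_1,\ldots,u_m\}$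 and $W=\{w_1,\ldots,w_m\}$ such that $u_i v\in E(G)$ only if $v=w_j$ for some $j\le i$, and (2) $u_iw_i\in E(G)$ for all $i\in\{1,\ldots,m\}$. In item 4, a collection consisting of a single odd cycle is just an odd cycle; with two or more cycles, all of them share one common vertex and are otherwise disjoint. -}

module Defs where

open import Data.Bool.Properties using () renaming (_≟_ to _≟ᵇ_)
open import Data.Fin using (Fin; _≟_) renaming (_≤_ to _≤ᶠ_)
open import Data.Fin.Properties using (any?; all?)
open import Data.Fin.Subset using (Subset; _∈_; _∉_; _⊆_; _∪_; ⁅_⁆; ⊤; ∣_∣)
open import Data.Fin.Subset.Properties
  using (_∈?_; anySubset?; x∈p∪q⁺; x∈p∪q⁻; p⊆p∪q; x∈⁅x⁆; x∈⁅y⁆⇒x≡y;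
         p⊂q⇒∣p∣<∣q∣; ∣p∣≤n; ⊆-antisym; ⊆⊤)
open import Data.List
  using (List; []; _∷_; [_]; _∷ʳ_; _++_; length; map; concatMap; filter; upTo; allFin)
open import Data.List.Relation.Binary.Infix.Heterogeneous using (Infix)
open import Data.List.Relation.Binary.Permutation.Propositional using (_↭_)
open import Data.List.Relation.Unary.All using (All)
open import Data.List.Relation.Unary.Any using (Any)
open import Data.List.Relation.Unary.Linked using (Linked)
open import Data.List.Relation.Unary.Unique.Propositional using (Unique)
open import Data.Nat using (ℕ; zero; suc; _+_; _≤_; _<_; s≤s)
open import Data.Nat.Divisibility using (_∣_)
open import Data.Nat.Properties
  using (≤-trans; ≤-reflexive; +-monoʳ-≤; +-suc; m≤m+n; <-irrefl; <-≤-trans)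
  renaming (_≟_ to _≟ⁿ_)
open import Data.Product using (∃-syntax; _×_; _,_)
open import Data.Sum using (_⊎_; inj₁; inj₂; [_,_]′)
open import Data.Vec.Properties using (≡-dec)
open import Function using (_∘_)
open import Function.Definitions using (Bijective)
open import Relation.Binary.Construct.Closure.ReflexiveTransitive using (Star; ε; _◅_)
open import Relation.Binary.PropositionalEquality
  using (_≡_; _≢_; refl; sym; subst)
open import Relation.Nullary using (¬_; Dec; yes; no; contradiction)
open import Relation.Nullary.Decidable using (_×-dec_; _→-dec_; ¬?)

record Graph (n : ℕ) : Set where
  field
    N           : Fin n → Subset n
    symmetric   : ∀ {u v} → v ∈ N u → u ∈ N v
    irreflexive : ∀ {u} → u ∉ N u

  infix 4 _~_
  _~_ : Fin n → Fin n → Set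
  u ~ v = v ∈ N u

  degree : Fin n → ℕ
  degree v = ∣ N v ∣

module _ {n : ℕ} (G : Graph n) where
  open Graph G

  -- A colouring is represented by the set S of its blue vertices; w may have
  -- either colour.
  OnlyWhiteNeighbour : Subset n → Fin n → Fin n → Set
  OnlyWhiteNeighbour S w v = w ~ v × v ∉ S × (∀ x → w ~ x → x ∉ S → x ≡ v)

  data Step (S : Subset n) : Subset n → Set where
    force : ∀ {w v} → OnlyWhiteNeighbour S w v → Step S (S ∪ ⁅ v ⁆)

  SkewForcing : Subset n → Set
  SkewForcing S = Star Step S ⊤

  private
    grow : ∀ {S : Subset n} {v} → v ∉ S → ∣ S ∣ < ∣ S ∪ ⁅ v ⁆ ∣
    grow {S} {v} v∉S =
      p⊂q⇒∣p∣<∣q∣ (p⊆p∪q ⁅ v ⁆ , v , x∈p∪q⁺ (inj₂ (x∈⁅x⁆ v)) , v∉S)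

    ∪⁅⁆-⊆ : ∀ {S T : Subset n} {v} → S ⊆ T → v ∈ T → S ∪ ⁅ v ⁆ ⊆ T
    ∪⁅⁆-⊆ {S} {T} {v} S⊆T v∈T x∈ with x∈p∪q⁻ S ⁅ v ⁆ x∈
    ... | inj₁ x∈S = S⊆T x∈S
    ... | inj₂ x∈v = subst (_∈ T) (sym (x∈⁅y⁆⇒x≡y v x∈v)) v∈T

    ∪⁅⁆-mono : ∀ {S T : Subset n} {v} → S ⊆ T → S ∪ ⁅ v ⁆ ⊆ T ∪ ⁅ v ⁆
    ∪⁅⁆-mono {v = v} S⊆T =
      ∪⁅⁆-⊆ (λ x∈S → x∈p∪q⁺ (inj₁ (S⊆T x∈S))) (x∈p∪q⁺ (inj₂ (x∈⁅x⁆ v)))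

  SkewForcing-mono : ∀ {S T} → S ⊆ T → SkewForcing S → SkewForcing T
  SkewForcing-mono S⊆T ε = subst SkewForcing (⊆-antisym S⊆T ⊆⊤) ε
  SkewForcing-mono {T = T} S⊆T (force {v = v} (w~v , v∉S , only) ◅ rest)
    with v ∈? T
  ... | yes v∈T = SkewForcing-mono (∪⁅⁆-⊆ S⊆T v∈T) rest
  ... | no  v∉T =
    force (w~v , v∉T , λ x w~x x∉T → only x w~x (x∉T ∘ S⊆T))
    ◅ SkewForcing-mono (∪⁅⁆-mono S⊆T) rest

  onlyWhiteNeighbour? : ∀ S w v → Dec (OnlyWhiteNeighbour S w v)
  onlyWhiteNeighbour? S w v =
    (v ∈? N w) ×-dec ¬? (v ∈? S) ×-dec
    all? (λ x → (x ∈? N w) →-dec ¬? (x ∈? S) →-dec (x ≟ v))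

  private
    decide : ∀ fuel S → n < fuel + ∣ S ∣ → Dec (SkewForcing S)
    decide zero S n<∣S∣ = contradiction (<-≤-trans n<∣S∣ (∣p∣≤n S)) (<-irrefl refl)
    decide (suc fuel) S bound
      with any? (λ w → any? (λ v → onlyWhiteNeighbour? S w v))
    ... | yes (w , v , owv@(_ , v∉S , _)) with decide fuel (S ∪ ⁅ v ⁆)
            (≤-trans bound (≤-trans (≤-reflexive (sym (+-suc fuel ∣ S ∣)))
                                    (+-monoʳ-≤ fuel (grow v∉S))))
    ...   | yes f = yes (force owv ◅ f)
    ...   | no ¬f = no (¬f ∘ SkewForcing-mono (p⊆p∪q ⁅ v ⁆))
    decide (suc fuel) S bound | no stuck with ≡-dec _≟ᵇ_ S ⊤
    ...   | yes refl = yes ε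
    ...   | no S≢⊤ = no λ { ε → S≢⊤ refl ; (force owv ◅ _) → stuck (_ , _ , owv) }

  skewForcing? : ∀ S → Dec (SkewForcing S)
  skewForcing? S = decide (suc n) S (s≤s (m≤m+n n ∣ S ∣))

  Mixed : ℕ → Set
  Mixed k = (∃[ Z ] ∣ Z ∣ ≡ k × SkewForcing Z) × (∃[ F ] ∣ F ∣ ≡ k × ¬ SkewForcing F)

  mixed? : ∀ k → Dec (Mixed k)
  mixed? k =
    anySubset? (λ Z → (∣ Z ∣ ≟ⁿ k) ×-dec skewForcing? Z) ×-dec
    anySubset? (λ F → (∣ F ∣ ≟ⁿ k) ×-dec ¬? (skewForcing? F))

  λ⁻ : ℕ
  λ⁻ = length (filter mixed? (upTo (suc n)))

  -- `inner` lists, in order, the vertices other than the ends (of a path) or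
  -- the base point (of a cycle).
  record Path (a b : Fin n) : Set where
    field
      inner  : List (Fin n)
      linked : Linked _~_ (a ∷ inner ∷ʳ b)
      simple : Unique (a ∷ inner ∷ʳ b)

    trace : List (Fin n)
    trace = a ∷ inner ∷ʳ b

    order : ℕ
    order = length trace

  record Cycle (c : Fin n) : Set where
    field
      inner  : List (Fin n)
      linked : Linked _~_ (c ∷ inner ∷ʳ c)
      simple : Unique (c ∷ inner)
      long   : 3 ≤ length (c ∷ inner)

    trace : List (Fin n)
    trace = c ∷ inner ∷ʳ c

    order : ℕ
    order = length (c ∷ inner)

  _LiesOn_ : Fin n × Fin n → List (Fin n) → Set
  (x , y) LiesOn t = Infix _≡_ (x ∷ y ∷ []) t ⊎ Infix _≡_ (y ∷ x ∷ []) t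

  -- G is made up of the paths and cycles traced by ts, where vs collects their
  -- vertices, a common end or base point being entered only once.  That no
  -- vertex is listed twice makes them disjoint apart from those points.
  ConsistsOf : List (Fin n) → List (List (Fin n)) → Set
  ConsistsOf vs ts = vs ↭ allFin n × (∀ x y → x ~ y → Any ((x , y) LiesOn_) ts)

  IsComplete : Set
  IsComplete = ∀ u v → u ≢ v → u ~ v

  IsEdgeless : Set
  IsEdgeless = ∀ u v → ¬ (u ~ v)

  record OddCycle (c : Fin n) : Set where
    field
      cycle : Cycle c
      odd   : ¬ 2 ∣ Cycle.order cycle
    open Cycle cycle public

  record OddCycleBouquet : Set where
    field
      centre   : Fin n
      cycles   : List (OddCycle centre)
      nonempty : 1 ≤ length cycles
      whole    : ConsistsOf (centre ∷ concatMap OddCycle.inner cycles)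
                            (map OddCycle.trace cycles)

  InnerDegreeTwo : List (Fin n) → Set
  InnerDegreeTwo = All (λ x → degree x ≡ 2)

  record Bouquet (c : Fin n) : Set where
    field
      cycles    : List (OddCycle c)
      nonempty  : 1 ≤ length cycles
      degreeTwo : All (InnerDegreeTwo ∘ OddCycle.inner) cycles

    inners : List (Fin n)
    inners = concatMap OddCycle.inner cycles

    traces : List (List (Fin n))
    traces = map OddCycle.trace cycles

  record EvenPath (a b : Fin n) : Set where
    field
      path      : Path a b
      even      : 2 ∣ Path.order path
      degreeTwo : InnerDegreeTwo (Path.inner path)
    open Path path public

  record MultiPath (a b : Fin n) : Set where
    field
      paths    : List (EvenPath a b)
      multiple : 2 ≤ length paths
      -- Two paths of order 2 would be one and the same edge.
      distinct : Unique (map EvenPath.inner paths)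

    inners : List (Fin n)
    inners = concatMap EvenPath.inner paths

    traces : List (List (Fin n))
    traces = map EvenPath.trace paths

  -- A path through all the segments has even order exactly when the number of
  -- segments is odd, so the first and the last are of the same kind.  They are
  -- taken to be single paths: starting and ending with multiple paths does not
  -- give span 0.  With no multiple paths at all, the link is one even path.
  data Alternating : Fin n → Fin n → Set where
    single : ∀ {a b} → EvenPath a b → Alternating a b
    _▸_▸_  : ∀ {a b c d} → EvenPath a b → MultiPath b c → Alternating c d →
             Alternating a d

  vertices : ∀ {a b} → Alternating a b → List (Fin n)
  vertices (single P)     = EvenPath.trace P
  vertices (P ▸ M ▸ rest) = EvenPath.trace P ++ MultiPath.inners M ++ vertices rest

  segments : ∀ {a b} → Alternating a b → List (List (Fin n))
  segments (single P)     = [ EvenPath.trace P ]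
  segments (P ▸ M ▸ rest) = EvenPath.trace P ∷ MultiPath.traces M ++ segments rest

  record DoublyExtendedBouquetDipole : Set where
    field
      u v      : Fin n
      bouquetᵘ : Bouquet u
      bouquetᵛ : Bouquet v
      link     : Alternating u v
      whole    : ConsistsOf
        (Bouquet.inners bouquetᵘ ++ vertices link ++ Bouquet.inners bouquetᵛ)
        (Bouquet.traces bouquetᵘ ++ segments link ++ Bouquet.traces bouquetᵛ)

  record TwoSetPerfectlyOrderable : Set where
    field
      m         : ℕ
      u w       : Fin m → Fin n
      partition : Bijective _≡_ _≡_ [ u , w ]′
      ordered   : ∀ i v → u i ~ v → ∃[ j ] j ≤ᶠ i × v ≡ w j
      matched   : ∀ i → u i ~ w i

{-# OPTIONS --safe #-}

-- Call a predicate closed if no vertex has exactly one neighbour outside it: a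
-- set forces iff every closed predicate containing it is everything.  If
-- λ⁻ G ≡ 0, then for some κ all sets of κ vertices fail (hence are closed) and
-- all larger sets force.  If even ∅ forces, removing a leaf with its neighbour
-- repeatedly gives the perfect order.  If κ + 1 = n, G is edgeless.  If
-- 1 ≤ κ < n - 1, every (κ + 1)-set C is the neighbourhood of a vertex minus one
-- point, and comparing these vertices for sets C that differ in two points
-- leaves only complete graphs.
--
-- There remains κ = 0: ∅ is closed and every vertex forces.  Cut G into threads,
-- paths between vertices of degree ≥ 3 through vertices of degree 2 (with at
-- most one vertex of degree ≥ 3, G is a bouquet based at any such vertex).  A
-- thread with an odd number of inner vertices would give a closed proper subset.
-- So a vertex can be anchored at the one end of its thread at even distance, and
-- the vertices anchored at g, not being closed, have a hub h all of whose threads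
-- but one lead to g.  As g ↦ h is injective, every vertex of degree ≥ 3 is such a
-- hub; "all threads but one" and "the remaining thread" define involutions mate
-- and across, and following them alternately from a vertex that is its own mate
-- spells out the dipole.
--
-- Conversely, let the single paths of a dipole run from xᵢ to yᵢ and its multiple
-- paths from yᵢ to xᵢ₊₁, for i ≤ k: a closed predicate propagates along
-- x₀ → y₀ → y₁ → ⋯ → yₖ → xₖ → ⋯ → x₁ → x₀, hence holds nowhere or everywhere.

module Submission where

open import Defs
open import Data.Empty using (⊥; ⊥-elim)
open import Data.Fin
  using (Fin; zero; suc; fromℕ<; _≟_; _<?_)
  renaming (_≤_ to _≤ᶠ_; _<_ to _<ᶠ_)
open import Data.Fin.Induction using (<-wellFounded; >-wellFounded)
open import Data.Fin.Properties
  using (any?; all?; suc-injective)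
  renaming (<-cmp to <ᶠ-cmp; <-irrefl to <ᶠ-irrefl; <-trans to <ᶠ-trans; ≤∧≢⇒< to ≤∧≢⇒<ᶠ)
open import Data.Fin.Subset
  using (Subset; inside; outside; ⊤; ∣_∣; _∪_; ⁅_⁆; _-_; _─_; ∁)
  renaming (_∈_ to _∈ˢ_; _∉_ to _∉ˢ_; _⊆_ to _⊆ˢ_; ⊥ to ∅)
open import Data.Fin.Subset.Properties
  using (_∈?_; ∈⊤; ∉⊥; ⊆⊤; ⊆-antisym; x∈⁅x⁆; x∈⁅y⁆⇒x≡y; x∈p∪q⁺; x∈p∪q⁻; p⊆p∪q; p⊆q⇒∣p∣≤∣q∣;
         p⊂q⇒∣p∣<∣q∣; x∈p⇒∣p-x∣<∣p∣; x∈p∧x≢y⇒x∈p-y; p─q⊆p; ∣p∣≤n; ∣⊤∣≡n; ∣p∣≡n⇒p≡⊤; ∣⊥∣≡0;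
         nonempty?; Empty-unique; x∈∁p⇒x∉p; x∉p⇒x∈∁p; ∣∁p∣≡n∸∣p∣)
open import Data.List
  using (List; []; _∷_; _∷ʳ_; _++_; length; map; concat; concatMap; filter; take; upTo;
         applyUpTo; allFin; lookup; foldr)
open import Data.List.Membership.Propositional using (_∈_; _∉_; lose; find)
open import Data.List.Membership.Propositional.Properties
  using (∈-∃++; ∈-++⁺ˡ; ∈-++⁺ʳ; ∈-++⁻; ∈-map⁺; ∈-map⁻; ∈-concat⁺′; ∈-concat⁻′; ∈-upTo⁺;
         ∈-allFin; ∈-filter⁺; ∈-filter⁻; ∈-applyUpTo⁻; ∈-length)
open import Data.List.Membership.Propositional.Properties.WithK using (unique∧set⇒bag)
open import Data.List.Properties
  using (length-++; length-map; length-take; length-tabulate; length-applyUpTo; applyUpTo-∷ʳ;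
         ∷-injective; filter-none; ++-assoc)
open import Data.List.Relation.Binary.BagAndSetEquality using (∼bag⇒↭)
open import Data.List.Relation.Binary.Disjoint.Propositional using (Disjoint)
open import Data.List.Relation.Binary.Infix.Heterogeneous using (Infix; here; there)
open import Data.List.Relation.Binary.Permutation.Propositional
  using (_↭_; ↭⇒↭ₛ; ↭-sym; ↭-refl; ↭-trans; prep; swap)
open import Data.List.Relation.Binary.Permutation.Propositional.Properties
  using (∈-resp-↭; shift; ↭-length)
import Data.List.Relation.Binary.Permutation.Setoid.Properties as Permutation
open import Data.List.Relation.Binary.Prefix.Heterogeneous using ([]; _∷_)
open import Data.List.Relation.Unary.All as All using (All; []; _∷_)
open import Data.List.Relation.Unary.All.Properties using (¬Any⇒All¬)
open import Data.List.Relation.Unary.AllPairs as AllPairs using (AllPairs; []; _∷_)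
open import Data.List.Relation.Unary.Any as Any using (Any; here; there)
open import Data.List.Relation.Unary.Any.Properties
  using ()
  renaming (++⁺ˡ to Any-++⁺ˡ; ++⁺ʳ to Any-++⁺ʳ; ++⁻ to Any-++⁻)
open import Data.List.Relation.Unary.Linked using (Linked; []; _∷_)
import Data.List.Relation.Unary.Linked.Properties as Linked
open import Data.List.Relation.Unary.Unique.Propositional using (Unique)
import Data.List.Relation.Unary.Unique.Propositional.Properties as Unique
open import Data.Nat
  using (ℕ; zero; suc; NonZero; _+_; _∸_; _⊓_; _≤_; _<_; _≤?_; z≤n; s≤s; z<s; s<s; s≤s⁻¹;
         ≢-nonZero⁻¹)
open import Data.Nat.Divisibility using (_∣_; divides; ∣m+n∣m⇒∣n; ∣-refl; ∣m∣n⇒∣m+n)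
import Data.Nat.Properties as ℕ
open import Data.Product using (∃₂; ∃-syntax; _×_; _,_; proj₁; proj₂)
open import Data.Sum using (_⊎_; inj₁; inj₂; [_,_]′)
open import Data.Vec using ([]; _∷_; here; there)
open import Function using (_∘_; id; case_of_)
open import Function.Bundles using (_⇔_; mk⇔)
open import Induction.WellFounded using (Acc; acc)
open import Relation.Binary.Construct.Closure.ReflexiveTransitive using (ε; _◅_)
open import Relation.Binary.Definitions using (tri<; tri≈; tri>)
open import Relation.Binary.PropositionalEquality
  using (_≡_; _≢_; refl; sym; trans; cong; cong₂; subst; subst₂; ≢-sym; setoid)
open import Relation.Nullary using (¬_; Dec; yes; no; contradiction)
open import Relation.Nullary.Decidable using (_×-dec_; _→-dec_; ¬?; decidable-stable)

-- At a vertex of degree 2, closedness says exactly that its two neighbours agree, so membership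
-- travels in steps of two. On a thread with an even number of inner vertices each parity class
-- contains just one end, hence every vertex follows the end at even distance. With an odd number,
-- one class contains neither end and can be coloured independently of both. After this reduction
-- only special vertices matter: the first vertex of a thread leaving `h` has the colour of the far
-- end, so `h` forces as if adjacent to the far ends of its threads. Degree at least 3 makes hubs
-- rigid. A hub of `g` has at least two threads to `g`, hence determines `g`; and at most one of the
-- threads from `h` to `mate h` is the exceptional thread of `mate h`, so another one leads back and
-- `mate` is an involution. Predicates are maps to `Set` rather than subsets, so that existential
-- ones such as `Odds`, `Anchored` and `Reached` enter the induction without being decided.

private
  variable
    A : Set
    n : ℕ

-- Lists without repetition and subsets of `Fin n`

unique-⊆⇒length≤ : {xs ys : List A} → Unique xs → (∀ {x} → x ∈ xs → x ∈ ys) →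
                   length xs ≤ length ys
unique-⊆⇒length≤ {xs = []}     _          _     = z≤n
unique-⊆⇒length≤ {xs = x ∷ xs} (x∉ ∷ uxs) xs⊆ys
  with as , bs , refl ← ∈-∃++ (xs⊆ys (here refl)) =
  ℕ.≤-trans (s≤s (unique-⊆⇒length≤ uxs shrink))
            (ℕ.≤-reflexive (↭-length (↭-sym (shift x as bs))))
  where
  shrink : ∀ {y} → y ∈ xs → y ∈ as ++ bs
  shrink y∈xs with ∈-resp-↭ (shift x as bs) (xs⊆ys (there y∈xs))
  ... | here refl = contradiction refl (All.lookup x∉ y∈xs)
  ... | there y∈  = y∈

unique-resp-↭ : {xs ys : List A} → xs ↭ ys → Unique xs → Unique ys
unique-resp-↭ p = Permutation.Unique-resp-↭ (setoid _) (↭⇒↭ₛ p)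

∈⇒↭∷ : {x : A} {xs : List A} → x ∈ xs → ∃[ ys ] xs ↭ x ∷ ys
∈⇒↭∷ {x = x} x∈xs with as , bs , refl ← ∈-∃++ x∈xs = as ++ bs , shift x as bs

unique∧same⇒↭ : {xs ys : List A} → Unique xs → Unique ys →
                (∀ {x} → x ∈ xs → x ∈ ys) → (∀ {x} → x ∈ ys → x ∈ xs) → xs ↭ ys
unique∧same⇒↭ uxs uys f g = ∼bag⇒↭ (unique∧set⇒bag uxs uys (mk⇔ f g))

unique⇒length≤n : {l : List (Fin n)} → Unique l → length l ≤ n
unique⇒length≤n {n = n} ul =
  ℕ.≤-trans (unique-⊆⇒length≤ ul (λ {x} _ → ∈-allFin x)) (ℕ.≤-reflexive (length-tabulate id))

unique-∷⇒∉ : {x : A} {xs : List A} → Unique (x ∷ xs) → x ∉ xs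
unique-∷⇒∉ = Unique.Unique[x∷xs]⇒x∉xs

∉∧unique⇒unique-∷ : {x : A} {xs : List A} → x ∉ xs → Unique xs → Unique (x ∷ xs)
∉∧unique⇒unique-∷ x∉ u = ¬Any⇒All¬ _ x∉ ∷ u

elements : Subset n → List (Fin n)
elements []            = []
elements (outside ∷ S) = map suc (elements S)
elements (inside  ∷ S) = zero ∷ map suc (elements S)

∈-elements⁺ : ∀ {S : Subset n} {x} → x ∈ˢ S → x ∈ elements S
∈-elements⁺ here                           = here refl
∈-elements⁺ {S = outside ∷ S} (there x∈S) = ∈-map⁺ suc (∈-elements⁺ x∈S)
∈-elements⁺ {S = inside  ∷ S} (there x∈S) = there (∈-map⁺ suc (∈-elements⁺ x∈S))

∈-elements⁻ : ∀ (S : Subset n) {x} → x ∈ elements S → x ∈ˢ S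
∈-elements⁻ (outside ∷ S) x∈ with _ , y∈ , refl ← ∈-map⁻ suc x∈ = there (∈-elements⁻ S y∈)
∈-elements⁻ (inside  ∷ S) (here refl) = here
∈-elements⁻ (inside  ∷ S) (there x∈) with _ , y∈ , refl ← ∈-map⁻ suc x∈ = there (∈-elements⁻ S y∈)

elements-unique : ∀ (S : Subset n) → Unique (elements S)
elements-unique []            = []
elements-unique (outside ∷ S) = Unique.map⁺ suc-injective (elements-unique S)
elements-unique (inside  ∷ S) =
  ∉∧unique⇒unique-∷ (λ 0∈ → case ∈-map⁻ suc 0∈ of λ { (_ , _ , ()) })
                    (Unique.map⁺ suc-injective (elements-unique S))

length-elements : ∀ (S : Subset n) → length (elements S) ≡ ∣ S ∣
length-elements []            = refl
length-elements (outside ∷ S) = trans (length-map suc (elements S)) (length-elements S)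
length-elements (inside  ∷ S) = cong suc (trans (length-map suc (elements S)) (length-elements S))

fromList : List (Fin n) → Subset n
fromList = foldr (λ x S → ⁅ x ⁆ ∪ S) ∅

∈-fromList⁺ : ∀ {l : List (Fin n)} {x} → x ∈ l → x ∈ˢ fromList l
∈-fromList⁺ (here refl) = x∈p∪q⁺ (inj₁ (x∈⁅x⁆ _))
∈-fromList⁺ (there x∈) = x∈p∪q⁺ (inj₂ (∈-fromList⁺ x∈))

∈-fromList⁻ : ∀ (l : List (Fin n)) {x} → x ∈ˢ fromList l → x ∈ l
∈-fromList⁻ []      x∈ = contradiction x∈ ∉⊥
∈-fromList⁻ (y ∷ l) x∈ with x∈p∪q⁻ ⁅ y ⁆ (fromList l) x∈
... | inj₁ x∈y = here (x∈⁅y⁆⇒x≡y y x∈y)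
... | inj₂ x∈l = there (∈-fromList⁻ l x∈l)

∣fromList∣ : ∀ {l : List (Fin n)} → Unique l → ∣ fromList l ∣ ≡ length l
∣fromList∣ {l = l} ul = trans (sym (length-elements (fromList l))) (ℕ.≤-antisym
  (unique-⊆⇒length≤ (elements-unique (fromList l))
                    (λ x∈ → ∈-fromList⁻ l (∈-elements⁻ (fromList l) x∈)))
  (unique-⊆⇒length≤ ul (λ x∈ → ∈-elements⁺ (∈-fromList⁺ x∈))))

-- Forcing sets and closed predicates

module Forcing (G : Graph n) where
  open Graph G

  Closed : (Fin n → Set) → Set
  Closed B = ∀ {w v} → w ~ v → (∀ x → w ~ x → x ≢ v → B x) → B v

  -- The blue set never leaves `B`: when `w` forces `v`, all other neighbours of `w` are already
  -- blue, so closedness puts `v` into `B`.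
  forcing-ind : ∀ {B S} → SkewForcing G S → Closed B → (∀ {x} → x ∈ˢ S → B x) → ∀ v → B v
  forcing-ind ε closed base v = base ∈⊤
  forcing-ind {B} {S} (force {v = v} (w~v , v∉S , only) ◅ rest) closed base =
    forcing-ind rest closed base′
    where
    others : ∀ x → _ ~ x → x ≢ v → B x
    others x w~x x≢v with x ∈? S
    ... | yes x∈S = base x∈S
    ... | no  x∉S = contradiction (only x w~x x∉S) x≢v
    base′ : ∀ {x} → x ∈ˢ S ∪ ⁅ v ⁆ → B x
    base′ x∈ with x∈p∪q⁻ S ⁅ v ⁆ x∈
    ... | inj₁ x∈S = base x∈S
    ... | inj₂ x∈v with refl ← x∈⁅y⁆⇒x≡y v x∈v = closed w~v others

  -- The final colouring of a failed run is the witness: it admits no force, so membership in it is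
  -- closed, and it is not everything. Each force adds a vertex, so the bound on `fuel + ∣ S ∣`
  -- survives and fuel cannot run out.
  stalled : ∀ fuel S → n < fuel + ∣ S ∣ → ¬ SkewForcing G S →
            ∃[ T ] S ⊆ˢ T × Closed (_∈ˢ T) × ∃[ v ] v ∉ˢ T
  stalled zero S n<∣S∣ _ = contradiction (ℕ.<-≤-trans n<∣S∣ (∣p∣≤n S)) (ℕ.<-irrefl refl)
  stalled (suc fuel) S bound ¬f
    with any? (λ w → any? (λ v → onlyWhiteNeighbour? G S w v))
  ... | yes (w , v , owv@(_ , v∉S , _)) =
    let T , S⊆T , rest = stalled fuel (S ∪ ⁅ v ⁆)
          (ℕ.≤-trans bound (ℕ.≤-trans (ℕ.≤-reflexive (sym (ℕ.+-suc fuel ∣ S ∣)))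
            (ℕ.+-monoʳ-≤ fuel (p⊂q⇒∣p∣<∣q∣
              (p⊆p∪q ⁅ v ⁆ , v , x∈p∪q⁺ (inj₂ (x∈⁅x⁆ v)) , v∉S)))))
          (λ f → ¬f (force owv ◅ f))
    in T , (λ x∈ → S⊆T (p⊆p∪q ⁅ v ⁆ x∈)) , rest
  ... | no stuck = S , id , closed , proper
    where
    closed : Closed (_∈ˢ S)
    closed {w} {v} w~v others with v ∈? S
    ... | yes v∈S = v∈S
    ... | no  v∉S = contradiction
      (w , v , w~v , v∉S , λ x w~x x∉S → decidable-stable (x ≟ v) (λ x≢v → x∉S (others x w~x x≢v)))
      stuck
    proper : ∃[ v ] v ∉ˢ S
    proper with any? (λ v → ¬? (v ∈? S))
    ... | yes p = p
    ... | no ¬p = contradiction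
      (subst (SkewForcing G)
        (⊆-antisym (λ {x} _ → decidable-stable (x ∈? S) (λ x∉ → ¬p (x , x∉))) ⊆⊤) ε)
      ¬f

  ¬forcing⇒stalled : ∀ {S} → ¬ SkewForcing G S →
                     ∃[ T ] S ⊆ˢ T × Closed (_∈ˢ T) × ∃[ v ] v ∉ˢ T
  ¬forcing⇒stalled {S} = stalled (suc n) S (s≤s (ℕ.m≤m+n n ∣ S ∣))

  closed⇒forcing : ∀ {S} → (∀ {B} → Closed B → (∀ {x} → x ∈ˢ S → B x) → ∀ v → B v) →
                   SkewForcing G S
  closed⇒forcing {S} all with skewForcing? G S
  ... | yes f = f
  ... | no ¬f with T , S⊆T , closed , v , v∉T ← ¬forcing⇒stalled ¬f =
    contradiction (all closed S⊆T v) v∉T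

  Uniform : Set
  Uniform = ∀ {Z F} → ∣ Z ∣ ≡ ∣ F ∣ → SkewForcing G Z → SkewForcing G F

  λ⁻≡0⇒uniform : λ⁻ G ≡ 0 → Uniform
  λ⁻≡0⇒uniform eq {Z} {F} ∣Z∣≡∣F∣ fZ with skewForcing? G F
  ... | yes fF = fF
  ... | no ¬fF = contradiction (∈-length k∈) (ℕ.<-irrefl (sym eq))
    where
    k∈ : ∣ Z ∣ ∈ filter (mixed? G) (upTo (suc n))
    k∈ = ∈-filter⁺ (mixed? G) (∈-upTo⁺ (s≤s (∣p∣≤n Z)))
           ((Z , refl , fZ) , (F , sym ∣Z∣≡∣F∣ , ¬fF))

  uniform⇒λ⁻≡0 : Uniform → λ⁻ G ≡ 0
  uniform⇒λ⁻≡0 uniform = cong length (filter-none (mixed? G)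
    (All.universal (λ { k ((Z , ∣Z∣≡k , fZ) , (F , ∣F∣≡k , ¬fF)) →
      ¬fF (uniform (trans ∣Z∣≡k (sym ∣F∣≡k)) fZ) }) (upTo (suc n))))

-- Leaf removal

module Orderable {n : ℕ} (G : Graph n) where
  open Graph G
  open Forcing G

  EmptyForces : Set₁
  EmptyForces = ∀ {B} → Closed B → ∀ v → B v

  module _ (O : TwoSetPerfectlyOrderable G) where
    open TwoSetPerfectlyOrderable O

    module _ {B : Fin n → Set} (closed : Closed B) where
      -- Upward induction: all neighbours of `u i` other than `w i` are `w j` with smaller `j`, so
      -- `u i` forces `w i`.
      all-w : ∀ i → Acc _<ᶠ_ i → B (w i)
      all-w i (acc rec) = closed (matched i) λ x uᵢ~x x≢wᵢ → case ordered i x uᵢ~x of λ where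
        (j , j≤i , refl) → all-w j (rec (≤∧≢⇒<ᶠ j≤i λ { refl → x≢wᵢ refl }))

      -- Downward induction: a neighbour of `w i` is some `w k`, done already, or some `u j` with
      -- `i ≤ j`. Hence `w i` forces `u i`.
      all-u : ∀ i → Acc (λ j k → k <ᶠ j) i → B (u i)
      all-u i (acc rec) = closed (symmetric (matched i)) others
        where
        others : ∀ x → w i ~ x → x ≢ u i → B x
        others x wᵢ~x x≢uᵢ with proj₂ partition x
        ... | inj₂ j , eq = subst B (eq refl) (all-w j (<-wellFounded j))
        ... | inj₁ j , eq with refl ← eq refl with ordered j (w i) (symmetric wᵢ~x)
        ...   | k , k≤j , wᵢ≡wₖ with refl ← proj₁ partition {inj₂ i} {inj₂ k} wᵢ≡wₖ =
          all-u j (rec (≤∧≢⇒<ᶠ k≤j λ { refl → x≢uᵢ refl }))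

    orderable⇒emptyForces : EmptyForces
    orderable⇒emptyForces {B} closed v with proj₂ partition v
    ... | inj₁ i , eq = subst B (eq refl) (all-u closed i (>-wellFounded i))
    ... | inj₂ i , eq = subst B (eq refl) (all-w closed i (<-wellFounded i))

  -- The first member x of each pair has no neighbours but its partner v and the
  -- partners of the pairs before it, which make up ws.
  data Peeling (ws : List (Fin n)) : List (Fin n × Fin n) → Set where
    []  : Peeling ws []
    _∷_ : ∀ {x v ps} → x ~ v × (∀ y → x ~ y → y ∈ ws ⊎ y ≡ v) →
          Peeling (v ∷ ws) ps → Peeling ws ((x , v) ∷ ps)

  flat : List (Fin n × Fin n) → List (Fin n)
  flat []             = []
  flat ((x , v) ∷ ps) = x ∷ v ∷ flat ps

  record Peeled (R : Subset n) (ws : List (Fin n)) : Set where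
    field
      pairs   : List (Fin n × Fin n)
      peeling : Peeling ws pairs
      unique  : Unique (flat pairs)
      sound   : ∀ {x} → x ∈ flat pairs → x ∈ˢ R
      full    : ∀ {x} → x ∈ˢ R → x ∈ flat pairs

  ClosedIn : Subset n → (Fin n → Set) → Set
  ClosedIn R B = ∀ {w v} → w ∈ˢ R → w ~ v → (∀ x → w ~ x → x ≢ v → B x) → B v

  -- The residual process after peeling: everything outside `R` counts as blue, and only vertices of
  -- `R` force.
  Exhausts : Subset n → Set₁
  Exhausts R = ∀ {B} → (∀ {x} → x ∉ˢ R → B x) → ClosedIn R B → ∀ v → B v

  -- If no vertex of `R` had exactly one neighbour in `R`, the complement of `R` would be stuck, so
  -- `Exhausts` makes `R` empty. Otherwise such an `a` and its neighbour `b` are removed. The last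
  -- hypothesis survives because `a` has no neighbour in `R` but `b`: what remains of `R` sees only
  -- partners among the removed vertices.
  peel : ∀ fuel R ws → ∣ R ∣ < fuel → Exhausts R →
         (∀ {x y} → x ∈ˢ R → y ∉ˢ R → x ~ y → y ∈ ws) → Peeled R ws
  peel (suc fuel) R ws bound exhausts outer
    with any? (λ x → any? (λ v → (x ∈? R) ×-dec (v ∈? R) ×-dec (v ∈? N x) ×-dec
                all? (λ y → (y ∈? N x) →-dec (y ∈? R) →-dec (y ≟ v))))
  ... | no noLeaf = record
    { pairs = [] ; peeling = [] ; unique = [] ; sound = λ ()
    ; full = λ {x} x∈R → contradiction x∈R (exhausts {_∉ˢ R} id stuck x) }
    where
    stuck : ClosedIn R (_∉ˢ R)
    stuck {w} {v} w∈R w~v others v∈R = noLeaf (w , v , w∈R , v∈R , w~v ,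
      λ y w~y y∈R → decidable-stable (y ≟ v) (λ y≢v → others y w~y y≢v y∈R))
  ... | yes (a , b , a∈R , b∈R , a~b , only) = record
    { pairs = (a , b) ∷ pairs
    ; peeling = (a~b , nbrs) ∷ peeling
    ; unique = ∉∧unique⇒unique-∷
                 (λ { (here a≡b) → a≢b a≡b ; (there a∈) → proj₁ (proj₂ (R′⁻ (sound a∈))) refl })
                 (∉∧unique⇒unique-∷ (λ b∈ → proj₂ (proj₂ (R′⁻ (sound b∈))) refl) unique)
    ; sound = λ { (here refl) → a∈R ; (there (here refl)) → b∈R
                ; (there (there x∈)) → proj₁ (R′⁻ (sound x∈)) }
    ; full = full′ }
    where
    R′ : Subset n
    R′ = R - a - b
    a≢b : a ≢ b
    a≢b refl = irreflexive a~b
    R′⁺ : ∀ {x} → x ∈ˢ R → x ≢ a → x ≢ b → x ∈ˢ R′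
    R′⁺ x∈R x≢a x≢b = x∈p∧x≢y⇒x∈p-y (x∈p∧x≢y⇒x∈p-y x∈R x≢a) x≢b
    minus⁻ : ∀ {p : Subset n} {x y} → x ∈ˢ p - y → x ∈ˢ p × x ≢ y
    minus⁻ {p} {x} {y} x∈ = p─q⊆p p ⁅ y ⁆ x∈ , x≢y p ⁅ y ⁆ x∈ (x∈⁅x⁆ y)
      where
      x≢y : ∀ {n} (p q : Subset n) {x y} → x ∈ˢ p ─ q → y ∈ˢ q → x ≢ y
      x≢y (_ ∷ p) (inside  ∷ q) (there x∈) (there y∈) refl = x≢y p q x∈ y∈ refl
      x≢y (_ ∷ p) (outside ∷ q) (there x∈) (there y∈) refl = x≢y p q x∈ y∈ refl
    R′⁻ : ∀ {x} → x ∈ˢ R′ → x ∈ˢ R × x ≢ a × x ≢ b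
    R′⁻ x∈ = let x∈R-a , x≢b = minus⁻ x∈ ; x∈R , x≢a = minus⁻ x∈R-a in x∈R , x≢a , x≢b
    outside⁻ : ∀ {x} → x ∉ˢ R′ → x ∉ˢ R ⊎ x ≡ a ⊎ x ≡ b
    outside⁻ {x} x∉ with x ∈? R | x ≟ a | x ≟ b
    ... | no x∉R  | _       | _       = inj₁ x∉R
    ... | yes _   | yes x≡a | _       = inj₂ (inj₁ x≡a)
    ... | yes _   | no _    | yes x≡b = inj₂ (inj₂ x≡b)
    ... | yes x∈R | no x≢a  | no x≢b  = contradiction (R′⁺ x∈R x≢a x≢b) x∉
    nbrs : ∀ y → a ~ y → y ∈ ws ⊎ y ≡ b
    nbrs y a~y with y ∈? R
    ... | yes y∈R = inj₂ (only y a~y y∈R)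
    ... | no  y∉R = inj₁ (outer a∈R y∉R a~y)
    outer′ : ∀ {x y} → x ∈ˢ R′ → y ∉ˢ R′ → x ~ y → y ∈ b ∷ ws
    outer′ x∈ y∉ x~y with outside⁻ y∉
    ... | inj₁ y∉R         = there (outer (proj₁ (R′⁻ x∈)) y∉R x~y)
    ... | inj₂ (inj₂ refl) = here refl
    ... | inj₂ (inj₁ refl) =
      let x∈R , _ , x≢b = R′⁻ x∈ in contradiction (only _ (symmetric x~y) x∈R) x≢b
    exhausts′ : Exhausts R′
    exhausts′ {B} base closed v = proj₁ (exhausts {B⁺} base⁺ closed⁺ v)
      where
      -- a is decreed white unless all other neighbours of b are blue.
      B⁺ : Fin n → Set
      B⁺ x = B x × (x ≡ a → ∀ y → b ~ y → y ≢ a → B y)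
      Bb : B b
      Bb = base (λ b∈ → proj₂ (proj₂ (R′⁻ b∈)) refl)
      base⁺ : ∀ {x} → x ∉ˢ R → B⁺ x
      base⁺ x∉R = base (λ x∈ → x∉R (proj₁ (R′⁻ x∈))) , λ { refl → contradiction a∈R x∉R }
      plain : ∀ {x} → x ≢ a → B x → B⁺ x
      plain x≢a Bx = Bx , λ x≡a → contradiction x≡a x≢a
      closed⁺ : ClosedIn R B⁺
      closed⁺ {w} {v} w∈R w~v others with w ≟ a
      ... | yes refl = case v ∈? R of λ where
        (yes v∈R) → case only v w~v v∈R of λ { refl → plain (≢-sym a≢b) Bb }
        (no v∉R) → base⁺ v∉R
      ... | no w≢a with w ≟ b | v ≟ a
      ...   | yes refl | yes refl =
        base (λ a∈ → proj₁ (proj₂ (R′⁻ a∈)) refl) , λ _ y b~y y≢a → proj₁ (others y b~y y≢a)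
      ...   | yes refl | no v≢a = case v ≟ b of λ where
        (yes refl) → contradiction w~v irreflexive
        -- Among the other neighbours of `b` is `a`, and membership of `a` in `B⁺` already grants
        -- all remaining neighbours of `b`, in particular `v`.
        (no v≢b) → plain v≢a (proj₂ (others a (symmetric a~b) (≢-sym v≢a)) refl v w~v v≢a)
      ...   | no w≢b | yes refl = contradiction (only w (symmetric w~v) w∈R) w≢b
      ...   | no w≢b | no v≢a =
        plain v≢a (closed (R′⁺ w∈R w≢a w≢b) w~v (λ x w~x x≢v → proj₁ (others x w~x x≢v)))
    open Peeled (peel fuel R′ (b ∷ ws)
      (ℕ.≤-trans (ℕ.≤-<-trans (p⊆q⇒∣p∣≤∣q∣ (p─q⊆p (R - a) ⁅ b ⁆)) (x∈p⇒∣p-x∣<∣p∣ a∈R))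
                 (s≤s⁻¹ bound))
      exhausts′ outer′)
    full′ : ∀ {x} → x ∈ˢ R → x ∈ a ∷ b ∷ flat pairs
    full′ {x} x∈R with x ≟ a | x ≟ b
    ... | yes refl | _        = here refl
    ... | no _     | yes refl = there (here refl)
    ... | no x≢a   | no x≢b   = there (there (full (R′⁺ x∈R x≢a x≢b)))

  emptyForces⇒orderable : EmptyForces → TwoSetPerfectlyOrderable G
  emptyForces⇒orderable emptyForces = record
    { m = length pairs
    ; u = fst pairs
    ; w = snd pairs
    ; partition = (λ {i} {j} → injective pairs unique i j)
                , λ y → let i , eq = surjective pairs (full (∈⊤ {x = y})) in i , λ { refl → eq }
    ; ordered = λ i v uᵢ~v → case ordered peeling i v uᵢ~v of λ { (inj₂ r) → r }
    ; matched = matched peeling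
    }
    where
    open Peeled (peel (suc n) ⊤ [] (s≤s (∣p∣≤n (⊤ {n})))
      (λ base closed → emptyForces (closed ∈⊤))
      (λ _ y∉⊤ _ → contradiction ∈⊤ y∉⊤))
    fst snd : ∀ ps → Fin (length ps) → Fin n
    fst ps i = proj₁ (lookup ps i)
    snd ps i = proj₂ (lookup ps i)
    fst∈ : ∀ ps i → fst ps i ∈ flat ps
    fst∈ (_ ∷ ps) zero    = here refl
    fst∈ (_ ∷ ps) (suc i) = there (there (fst∈ ps i))
    snd∈ : ∀ ps i → snd ps i ∈ flat ps
    snd∈ (_ ∷ ps) zero    = there (here refl)
    snd∈ (_ ∷ ps) (suc i) = there (there (snd∈ ps i))
    choose : ∀ ps → Fin (length ps) ⊎ Fin (length ps) → Fin n
    choose ps = [ fst ps , snd ps ]′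
    shift⊎ : ∀ {k} → Fin k ⊎ Fin k → Fin (suc k) ⊎ Fin (suc k)
    shift⊎ (inj₁ i) = inj₁ (suc i)
    shift⊎ (inj₂ i) = inj₂ (suc i)
    choose-shift : ∀ p ps i → choose (p ∷ ps) (shift⊎ i) ≡ choose ps i
    choose-shift p ps (inj₁ i) = refl
    choose-shift p ps (inj₂ i) = refl
    choose∈ : ∀ ps i → choose ps i ∈ flat ps
    choose∈ ps (inj₁ i) = fst∈ ps i
    choose∈ ps (inj₂ i) = snd∈ ps i
    data View {k} : Fin (suc k) ⊎ Fin (suc k) → Set where
      first  : View (inj₁ zero)
      second : View (inj₂ zero)
      later  : ∀ i → View (shift⊎ i)
    view : ∀ {k} (i : Fin (suc k) ⊎ Fin (suc k)) → View i
    view (inj₁ zero)    = first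
    view (inj₂ zero)    = second
    view (inj₁ (suc i)) = later (inj₁ i)
    view (inj₂ (suc i)) = later (inj₂ i)
    injective : ∀ ps → Unique (flat ps) → ∀ i j → choose ps i ≡ choose ps j → i ≡ j
    injective [] _ (inj₁ ()) _
    injective [] _ (inj₂ ()) _
    injective (p ∷ ps) (x∉ ∷ v∉ ∷ uq) i j eq with view i | view j
    ... | first   | first   = refl
    ... | second  | second  = refl
    ... | first   | second  = contradiction eq (All.head x∉)
    ... | second  | first   = contradiction (sym eq) (All.head x∉)
    ... | first   | later j = contradiction (trans eq (choose-shift p ps j))
                                (All.lookup (All.tail x∉) (choose∈ ps j))
    ... | later i | first   = contradiction (trans (sym eq) (choose-shift p ps i))
                                (All.lookup (All.tail x∉) (choose∈ ps i))
    ... | second  | later j = contradiction (trans eq (choose-shift p ps j))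
                                (All.lookup v∉ (choose∈ ps j))
    ... | later i | second  = contradiction (trans (sym eq) (choose-shift p ps i))
                                (All.lookup v∉ (choose∈ ps i))
    ... | later i | later j = cong shift⊎ (injective ps uq i j
                                (trans (sym (choose-shift p ps i)) (trans eq (choose-shift p ps j))))
    surjective : ∀ ps {y} → y ∈ flat ps → ∃[ i ] choose ps i ≡ y
    surjective (p ∷ ps) (here refl)         = inj₁ zero , refl
    surjective (p ∷ ps) (there (here refl)) = inj₂ zero , refl
    surjective (p ∷ ps) (there (there y∈))  =
      let i , eq = surjective ps y∈ in shift⊎ i , trans (choose-shift p ps i) eq
    ordered : ∀ {ws ps} → Peeling ws ps → ∀ i v → fst ps i ~ v →
              v ∈ ws ⊎ ∃[ j ] j ≤ᶠ i × v ≡ snd ps j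
    ordered ((_ , nbrs) ∷ _) zero v x~v with nbrs v x~v
    ... | inj₁ v∈ws = inj₁ v∈ws
    ... | inj₂ v≡    = inj₂ (zero , z≤n , v≡)
    ordered (_ ∷ peeling) (suc i) v x~v with ordered peeling i v x~v
    ... | inj₁ (here v≡)         = inj₂ (zero , z≤n , v≡)
    ... | inj₁ (there v∈ws)     = inj₁ v∈ws
    ... | inj₂ (j , j≤i , v≡)    = inj₂ (suc j , s≤s j≤i , v≡)
    matched : ∀ {ws ps} → Peeling ws ps → ∀ i → fst ps i ~ snd ps i
    matched ((x~v , _) ∷ _) zero    = x~v
    matched (_ ∷ peeling)   (suc i) = matched peeling i

-- Neighbourhoods of intermediate size

module Middle {n : ℕ} (G : Graph n) where
  open Graph G
  open Forcing G

  -- Each `k`-set is the neighbourhood of a vertex with one point removed. It is used with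
  -- `k = κ + 1`, hence from 2 on.
  Key : ℕ → Set
  Key k = ∀ C → Unique C → length C ≡ k →
    ∃₂ λ w e → All (w ~_) C × e ∉ C × w ~ e × (∀ x → w ~ x → x ∈ C ⊎ x ≡ e)

  module _ {j} (key : Key (2 + j)) where

    -- Q = v₀ ∷ R lists the closed neighbourhood of a vertex of degree k + 1.
    module _ {v₀ R} (uniqueQ : Unique (v₀ ∷ R)) (∣R∣ : length R ≡ 3 + j)
             (nbr : ∀ {x} → v₀ ~ x → x ∈ R) where

      private
        v₀∉R : v₀ ∉ R
        v₀∉R = unique-∷⇒∉ uniqueQ
        uniqueR : Unique R
        uniqueR = AllPairs.tail uniqueQ

      -- The set of all vertices but `a` and `b` has the right size for `key`. The vertex found has
      -- no loop and its extra neighbour is new, so these two are `a` and `b`.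
      Q-covers⇒adjacent : (∀ x → x ∈ v₀ ∷ R) → ∀ {a b} → a ≢ b → a ~ b
      Q-covers⇒adjacent covers {a} {b} a≢b = adjacent
        where
        split₁ = ∈⇒↭∷ (covers a)
        split₂ = ∈⇒↭∷ (Any.tail (≢-sym a≢b) (∈-resp-↭ (proj₂ split₁) (covers b)))
        rest = proj₁ split₂
        Q↭ : v₀ ∷ R ↭ a ∷ b ∷ rest
        Q↭ = ↭-trans (proj₂ split₁) (prep a (proj₂ split₂))
        rest-covers : ∀ {x} → x ∉ rest → x ≡ a ⊎ x ≡ b
        rest-covers {x} x∉ with ∈-resp-↭ Q↭ (covers x)
        ... | here x≡a          = inj₁ x≡a
        ... | there (here x≡b)  = inj₂ x≡b
        ... | there (there x∈)  = contradiction x∈ x∉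
        adjacent : a ~ b
        adjacent with key rest (AllPairs.tail (AllPairs.tail (unique-resp-↭ Q↭ uniqueQ)))
                        (ℕ.suc-injective (ℕ.suc-injective (trans (sym (↭-length Q↭)) (cong suc ∣R∣))))
        ... | w , e , w~C , e∉C , w~e , _
          with rest-covers {w} (λ w∈ → irreflexive (All.lookup w~C w∈)) | rest-covers e∉C
        ...   | inj₁ refl | inj₁ refl = contradiction w~e irreflexive
        ...   | inj₁ refl | inj₂ refl = w~e
        ...   | inj₂ refl | inj₁ refl = symmetric w~e
        ...   | inj₂ refl | inj₂ refl = contradiction w~e irreflexive

      Beats : Fin n → List (Fin n) → Set
      Beats x rest = All (x ~_) rest × ∃[ e ] (∀ z → x ~ z → z ∈ v₀ ∷ rest ⊎ z ≡ e)

      -- Trading `x` and `y` for `v₀` gives a set of size `k`. The vertex that `key` finds for it is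
      -- adjacent to `v₀`, so it lies in `R`, and it is not in `rest`: only `x` and `y` are left.
      game : ∀ {x y rest} → R ↭ x ∷ y ∷ rest → Beats x rest ⊎ Beats y rest
      game {x} {y} {rest} R↭
        with key (v₀ ∷ rest)
               (∉∧unique⇒unique-∷ (λ v₀∈ → v₀∉R (∈-resp-↭ (↭-sym R↭) (there (there v₀∈))))
                 (AllPairs.tail (AllPairs.tail (unique-resp-↭ R↭ uniqueR))))
               (ℕ.suc-injective (trans (sym (↭-length R↭)) ∣R∣))
      ... | p , e , (p~v₀ ∷ p~rest) , _ , _ , only
        with ∈-resp-↭ R↭ (nbr (symmetric p~v₀))
      ...   | here refl         = inj₁ (p~rest , e , only)
      ...   | there (here refl) = inj₂ (p~rest , e , only)
      ...   | there (there p∈)  = contradiction (All.lookup p~rest p∈) irreflexive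

      module _ {w} (w∉Q : w ∉ v₀ ∷ R) where

        private
          w∉R : w ∉ R
          w∉R = w∉Q ∘ there

        Triple : Fin n → Fin n → Fin n → List (Fin n) → Set
        Triple p y z rest =
          R ↭ p ∷ y ∷ z ∷ rest × All (p ~_) (v₀ ∷ w ∷ rest) ×
          ∃[ e ] (∀ x → p ~ x → x ∈ v₀ ∷ w ∷ rest ⊎ x ≡ e)

        -- As in `game`, but three vertices of `R` are traded for `v₀` and a vertex `w` outside; the
        -- vertex found must be one of the three.
        triple : ∃[ p ] ∃[ y ] ∃[ z ] ∃[ rest ] Triple p y z rest
        triple = go R ↭-refl ∣R∣
          where
          go : ∀ xs → R ↭ xs → length xs ≡ 3 + j →
               ∃[ p ] ∃[ y ] ∃[ z ] ∃[ rest ] Triple p y z rest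
          go (x ∷ y ∷ z ∷ rest) R↭ len
            with key (v₀ ∷ w ∷ rest)
                   (∉∧unique⇒unique-∷
                     (λ { (here refl) → w∉Q (here refl)
                        ; (there v₀∈) → v₀∉R (∈-resp-↭ (↭-sym R↭) (there (there (there v₀∈)))) })
                     (∉∧unique⇒unique-∷
                       (λ w∈ → w∉R (∈-resp-↭ (↭-sym R↭) (there (there (there w∈)))))
                       (AllPairs.tail (AllPairs.tail (AllPairs.tail (unique-resp-↭ R↭ uniqueR))))))
                   (ℕ.suc-injective len)
          ... | p , e , p~C@(p~v₀ ∷ _ ∷ p~rest) , _ , _ , only
            with ∈-resp-↭ R↭ (nbr (symmetric p~v₀))
          ...   | here refl = x , y , z , rest , R↭ , p~C , e , only
          ...   | there (here refl) =
            y , x , z , rest , ↭-trans R↭ (swap x y ↭-refl) , p~C , e , only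
          ...   | there (there (here refl)) =
            z , x , y , rest , ↭-trans R↭ (↭-trans (prep x (swap y z ↭-refl)) (swap x z ↭-refl)) ,
            p~C , e , only
          ...   | there (there (there p∈)) = contradiction (All.lookup p~rest p∈) irreflexive

        -- Since `p` and `q` are not adjacent, neither can win a game that requires it to see the
        -- other, so `a` wins against `q` and is adjacent to `p`. This makes `a` the extra neighbour
        -- of `p`, so the neighbours of `p` are `v₀`, `w`, `a` and `rest`. Now `key` for
        -- `w ∷ p ∷ rest` asks for one of these that sees both `w` and `p`, and there is none.
        triple-refuted : ∀ {p q a rest} → Triple p q a rest → ¬ (p ~ q) → ⊥
        triple-refuted {p} {q} {a} {rest} (R↭ , p~C@(_ ∷ p~w ∷ p~rest) , e , only) p≁q =
          conclude (key (w ∷ p ∷ rest)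
            (∉∧unique⇒unique-∷ (λ { (here refl) → w∉R (R∋ (here refl))
                                  ; (there w∈) → w∉R (R∋ (there (there (there w∈)))) })
              (∉∧unique⇒unique-∷ (λ p∈ → unique-∷⇒∉ uniqueP (there (there p∈)))
                (AllPairs.tail (AllPairs.tail (AllPairs.tail uniqueP)))))
            (ℕ.suc-injective (trans (sym (↭-length R↭)) ∣R∣)))
          where
          uniqueP : Unique (p ∷ q ∷ a ∷ rest)
          uniqueP = unique-resp-↭ R↭ uniqueR
          R∋ : ∀ {x} → x ∈ p ∷ q ∷ a ∷ rest → x ∈ R
          R∋ = ∈-resp-↭ (↭-sym R↭)
          a~p : a ~ p
          a~p with game (↭-trans R↭ (prep p (swap q a ↭-refl)))
          ... | inj₁ (p~q ∷ _ , _) = contradiction p~q p≁q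
          ... | inj₂ _
            with game (↭-trans R↭ (↭-trans (swap p q ↭-refl) (prep q (swap p a ↭-refl))))
          ...   | inj₁ (q~p ∷ _ , _) = contradiction (symmetric q~p) p≁q
          ...   | inj₂ (a~p ∷ _ , _) = a~p
          a∉C : a ∉ v₀ ∷ w ∷ rest
          a∉C (here refl)          = v₀∉R (R∋ (there (there (here refl))))
          a∉C (there (here refl))  = w∉R (R∋ (there (there (here refl))))
          a∉C (there (there a∈))   = unique-∷⇒∉ (AllPairs.tail (AllPairs.tail uniqueP)) a∈
          a≡e : a ≡ e
          a≡e with only a (symmetric a~p)
          ... | inj₁ a∈C = contradiction a∈C a∉C
          ... | inj₂ eq  = eq
          N-p : ∀ {x} → p ~ x → x ≡ v₀ ⊎ x ≡ w ⊎ x ∈ a ∷ rest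
          N-p {x} p~x with only x p~x
          ... | inj₁ (here eq)           = inj₁ eq
          ... | inj₁ (there (here eq))   = inj₂ (inj₁ eq)
          ... | inj₁ (there (there x∈))  = inj₂ (inj₂ (there x∈))
          ... | inj₂ refl                = inj₂ (inj₂ (here (sym a≡e)))
          -- In the game between `c` and `p` the other vertices include `q`, so `p` loses. The
          -- winner `c` has only one neighbour besides `v₀` and the rest of `R`, which cannot be
          -- both `p` and `w`.
          a∷rest≁w : ∀ {c} → c ∈ a ∷ rest → c ~ w → c ~ p → ⊥
          a∷rest≁w {c} c∈ c~w c~p with ∈⇒↭∷ c∈
          ... | r , ar↭ = refute (game R↭cp)
            where
            R↭cp : R ↭ c ∷ p ∷ q ∷ r
            R↭cp = ↭-trans R↭ (↭-trans (prep p (↭-trans (prep q ar↭) (swap q c ↭-refl)))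
                                         (swap p c ↭-refl))
            R∋′ : ∀ {x} → x ∈ c ∷ p ∷ q ∷ r → x ∈ R
            R∋′ = ∈-resp-↭ (↭-sym R↭cp)
            refute : Beats c (q ∷ r) ⊎ Beats p (q ∷ r) → ⊥
            refute (inj₂ (p~q ∷ _ , _)) = p≁q p~q
            refute (inj₁ (_ , e′ , only′)) with only′ p c~p | only′ w c~w
            ... | inj₁ (here refl) | _ = v₀∉R (R∋′ (there (here refl)))
            ... | inj₁ (there p∈) | _ = unique-∷⇒∉ (AllPairs.tail (unique-resp-↭ R↭cp uniqueR)) p∈
            ... | inj₂ _ | inj₁ (here refl) = w∉Q (here refl)
            ... | inj₂ _ | inj₁ (there w∈) = w∉R (R∋′ (there (there w∈)))
            ... | inj₂ refl | inj₂ refl = w∉R (R∋′ (there (here refl)))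
          conclude : (∃₂ λ c e → All (c ~_) (w ∷ p ∷ rest) × e ∉ w ∷ p ∷ rest × c ~ e ×
                        (∀ x → c ~ x → x ∈ w ∷ p ∷ rest ⊎ x ≡ e)) → ⊥
          conclude (c , _ , (c~w ∷ c~p ∷ _) , _) with N-p (symmetric c~p)
          ... | inj₁ refl        = w∉R (nbr c~w)
          ... | inj₂ (inj₁ refl) = irreflexive c~w
          ... | inj₂ (inj₂ c∈)   = a∷rest≁w c∈ c~w c~p

        -- By `triple-refuted` the vertex `p` sees both `y` and `z`, but only one neighbour of `p`
        -- lies outside `v₀ ∷ w ∷ rest`.
        outside-absurd : ⊥
        outside-absurd with triple
        ... | p , y , z , rest , t@(R↭ , p~C , e , only) with y ∈? N p
        ...   | no p≁y = triple-refuted t p≁y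
        ...   | yes p~y with z ∈? N p
        ...     | no p≁z = triple-refuted
                    (↭-trans R↭ (prep p (swap y z ↭-refl)) , p~C , e , only) p≁z
        ...     | yes p~z = y≢z (trans (is-e p~y (there (here refl))
                                           (λ y∈ → unique-∷⇒∉ uniqueY (there y∈)))
                                       (sym (is-e p~z (there (there (here refl)))
                                           (unique-∷⇒∉ (AllPairs.tail uniqueY)))))
          where
          uniqueY = AllPairs.tail (unique-resp-↭ R↭ uniqueR)
          y≢z : y ≢ z
          y≢z refl = unique-∷⇒∉ uniqueY (here refl)
          is-e : ∀ {x} → p ~ x → x ∈ p ∷ y ∷ z ∷ rest → x ∉ rest → x ≡ e
          is-e {x} p~x x∈ x∉ with only x p~x
          ... | inj₁ (here refl)         = contradiction (∈-resp-↭ (↭-sym R↭) x∈) v₀∉R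
          ... | inj₁ (there (here refl)) = contradiction (∈-resp-↭ (↭-sym R↭) x∈) w∉R
          ... | inj₁ (there (there x∈r)) = contradiction x∈r x∉
          ... | inj₂ eq                  = eq

    -- Any `k`-set will do as `C₀`: it supplies a vertex `v₀` of degree `k + 1`, whose closed
    -- neighbourhood `Q` must then be the whole graph.
    key⇒complete : 2 + j ≤ n → IsComplete G
    key⇒complete k≤n a b a≢b = around (key C₀ uniqueC₀ ∣C₀∣)
      where
      C₀ : List (Fin n)
      C₀ = take (2 + j) (allFin n)
      uniqueC₀ : Unique C₀
      uniqueC₀ = Unique.take⁺ (2 + j) (Unique.allFin⁺ n)
      ∣C₀∣ : length C₀ ≡ 2 + j
      ∣C₀∣ = trans (length-take (2 + j) (allFin n))
                   (trans (cong ((2 + j) ⊓_) (length-tabulate id)) (ℕ.m≤n⇒m⊓n≡m k≤n))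
      around : (∃₂ λ v₀ e → All (v₀ ~_) C₀ × e ∉ C₀ × v₀ ~ e × (∀ x → v₀ ~ x → x ∈ C₀ ⊎ x ≡ e)) →
               a ~ b
      around (v₀ , e , v₀~C , e∉C , v₀~e , only) =
        decidable-stable (b ∈? N a) λ a≁b → case any? (λ w → ¬? (Any.any? (w ≟_) Q)) of λ where
          (yes (w , w∉Q)) → outside-absurd uniqueQ (cong suc ∣C₀∣) nbr w∉Q
          (no ¬out) → a≁b (Q-covers⇒adjacent uniqueQ (cong suc ∣C₀∣) nbr
            (λ x → decidable-stable (Any.any? (x ≟_) Q) (λ x∉ → ¬out (x , x∉))) a≢b)
        where
        Q : List (Fin n)
        Q = v₀ ∷ e ∷ C₀
        nbr : ∀ {x} → v₀ ~ x → x ∈ e ∷ C₀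
        nbr {x} v₀~x = [ there , here ]′ (only x v₀~x)
        uniqueQ : Unique Q
        uniqueQ = ∉∧unique⇒unique-∷ (λ v₀∈ → irreflexive (All.lookup (v₀~e ∷ v₀~C) v₀∈))
                                    (∉∧unique⇒unique-∷ e∉C uniqueC₀)

-- The threshold cardinality and the case distinction

module Threshold {n : ℕ} (G : Graph n) where
  open Graph G
  open Forcing G
  open Orderable G using (EmptyForces)
  open Middle G

  ThresholdOne : Set₁
  ThresholdOne = Closed (λ _ → ⊥) × (∀ {B} → Closed B → ∀ x → B x → ∀ v → B v)

  module _ (uniform : Uniform) where

    -- A representative of each cardinality; uniformity makes the choice immaterial.
    sample : ℕ → Subset n
    sample k = fromList (take k (allFin n))

    ∣sample∣ : ∀ {k} → k ≤ n → ∣ sample k ∣ ≡ k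
    ∣sample∣ {k} k≤n = trans (∣fromList∣ (Unique.take⁺ k (Unique.allFin⁺ n)))
      (trans (length-take k (allFin n))
        (trans (cong (k ⊓_) (length-tabulate id)) (ℕ.m≤n⇒m⊓n≡m k≤n)))

    Jump : ℕ → Set
    Jump κ = ¬ SkewForcing G (sample κ) × SkewForcing G (sample (suc κ))

    findJump : ∀ k → ¬ SkewForcing G (sample 0) → SkewForcing G (sample k) → ∃[ κ ] κ < k × Jump κ
    findJump zero    ¬f f = contradiction f ¬f
    findJump (suc k) ¬f f with skewForcing? G (sample k)
    ... | no ¬fk = k , ℕ.≤-refl , ¬fk , f
    ... | yes fk = let κ , κ<k , jump = findJump k ¬f fk in κ , ℕ.m<n⇒m<1+n κ<k , jump

    module _ {κ} (κ<n : κ < n) (jump : Jump κ) where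

      large-forces : ∀ {C} → Unique C → length C ≡ suc κ →
                     ∀ {B} → Closed B → (∀ {x} → x ∈ C → B x) → ∀ v → B v
      large-forces {C} uC ∣C∣ closed C⊆B = forcing-ind
        (uniform (trans (∣sample∣ κ<n) (sym (trans (∣fromList∣ uC) ∣C∣))) (proj₂ jump))
        closed (C⊆B ∘ ∈-fromList⁻ C)

      -- `C` fails, so it lies in a closed proper set `T`. A further vertex in `T` would give
      -- `κ + 1` vertices inside `T`, and these force everything; hence `T` is `C`.
      small-closed : ∀ {C} → Unique C → length C ≡ κ → Closed (_∈ C)
      small-closed {C} uC ∣C∣
        with T , C⊆T , closed , v , v∉T ← ¬forcing⇒stalled {fromList C} (λ f → proj₁ jump
               (uniform (trans (∣fromList∣ uC) (trans ∣C∣ (sym (∣sample∣ (ℕ.<⇒≤ κ<n))))) f)) =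
        λ w~v others → T⊆C (closed w~v (λ x w~x x≢v → C⊆T (∈-fromList⁺ (others x w~x x≢v))))
        where
        T⊆C : ∀ {x} → x ∈ˢ T → x ∈ C
        T⊆C {x} x∈T = decidable-stable (Any.any? (x ≟_) C) λ x∉C →
          v∉T (large-forces (∉∧unique⇒unique-∷ x∉C uC) (cong suc ∣C∣) closed
            (λ { (here refl) → x∈T ; (there y∈) → C⊆T (∈-fromList⁺ y∈) }) v)

      -- The vertices other than `v` form a set of size `κ`, which is closed, so no vertex may have
      -- `v` as its only neighbour outside it; any neighbour of `v` would.
      edgeless : suc κ ≡ n → IsEdgeless G
      edgeless refl u v u~v with C , all↭ ← ∈⇒↭∷ (∈-allFin v) =
        unique-∷⇒∉ uvC (small-closed (AllPairs.tail uvC) ∣C∣ u~v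
          (λ x _ x≢v → Any.tail x≢v (∈-resp-↭ all↭ (∈-allFin x))))
        where
        uvC = unique-resp-↭ all↭ (Unique.allFin⁺ n)
        ∣C∣ = ℕ.suc-injective (trans (sym (↭-length all↭)) (length-tabulate id))

      -- `C` forces and is not everything, so it is not closed: some `w` has all its neighbours but
      -- `v` in `C`. If `w` missed a point of `C`, the remaining `κ` points would be a closed set
      -- from which `w` still forces `v`.
      key : suc κ ≢ n → Key (suc κ)
      key suc-κ≢n C uC ∣C∣
        with any? (λ w → any? (λ v → (v ∈? N w) ×-dec ¬? (Any.any? (v ≟_) C) ×-dec
               all? (λ x → (x ∈? N w) →-dec ¬? (x ≟ v) →-dec Any.any? (x ≟_) C)))
      ... | yes (w , v , w~v , v∉C , others) =
        w , v , All.tabulate w~C , v∉C , w~v , λ x w~x → nearly x w~x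
        where
        nearly : ∀ x → w ~ x → x ∈ C ⊎ x ≡ v
        nearly x w~x with x ≟ v
        ... | yes x≡v = inj₂ x≡v
        ... | no  x≢v = inj₁ (others x w~x x≢v)
        w~C : ∀ {c} → c ∈ C → w ~ c
        w~C {c} c∈C with C′ , C↭ ← ∈⇒↭∷ c∈C = decidable-stable (c ∈? N w) λ w≁c →
          v∉C (∈-resp-↭ (↭-sym C↭) (there (small-closed (AllPairs.tail (unique-resp-↭ C↭ uC))
            (ℕ.suc-injective (trans (sym (↭-length C↭)) ∣C∣)) w~v
            (λ x w~x x≢v → Any.tail (λ { refl → w≁c w~x }) (∈-resp-↭ C↭ (others x w~x x≢v))))))
      ... | no none = contradiction (ℕ.≤-antisym κ<n
        (ℕ.≤-trans (ℕ.≤-reflexive (sym (length-tabulate id)))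
          (ℕ.≤-trans (unique-⊆⇒length≤ (Unique.allFin⁺ n) (λ {x} _ → full x)) (ℕ.≤-reflexive ∣C∣))))
        suc-κ≢n
        where
        full : ∀ x → x ∈ C
        full = large-forces uC ∣C∣ (λ {w} {v} w~v others →
          decidable-stable (Any.any? (v ≟_) C) (λ v∉C → none (w , v , w~v , v∉C , others))) id

    trichotomy : EmptyForces ⊎ IsEdgeless G ⊎ IsComplete G ⊎ (2 ≤ n × ThresholdOne)
    trichotomy with skewForcing? G (sample 0)
    ... | yes f = inj₁ (λ closed → forcing-ind f closed (λ x∈ → contradiction x∈ ∉⊥))
    ... | no ¬f with findJump n ¬f
          (subst (SkewForcing G) (sym (∣p∣≡n⇒p≡⊤ (∣sample∣ ℕ.≤-refl))) ε)
    ...   | κ , κ<n , jump with suc κ ℕ.≟ n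
    ...     | yes eq = inj₂ (inj₁ (edgeless κ<n jump eq))
    ...     | no neq = inj₂ (inj₂ (byThreshold κ κ<n jump neq))
      where
      byThreshold : ∀ κ → κ < n → Jump κ → suc κ ≢ n → IsComplete G ⊎ (2 ≤ n × ThresholdOne)
      byThreshold zero κ<n jump neq = inj₂ (ℕ.≤∧≢⇒< κ<n neq ,
        (λ w~v others → case small-closed κ<n jump [] refl w~v
          (λ x w~x x≢v → ⊥-elim (others x w~x x≢v)) of λ ()) ,
        λ closed x Bx → large-forces κ<n jump ([] ∷ []) refl closed (λ { (here refl) → Bx }))
      byThreshold (suc j) κ<n jump neq = inj₁ (key⇒complete (key κ<n jump neq) κ<n)

-- Concatenation, injections and parity

unique-concatMap : {A B : Set} (f : A → List B) {ys : List A} → Unique ys →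
  (∀ {y} → y ∈ ys → Unique (f y)) →
  (∀ {y y′} → y ∈ ys → y′ ∈ ys → y ≢ y′ → Disjoint (f y) (f y′)) →
  Unique (concat (map f ys))
unique-concatMap f []        each disj = []
unique-concatMap f {y ∷ ys} (y∉ ∷ u) each disj = Unique.++⁺ (each (here refl))
  (unique-concatMap f u (each ∘ there) (λ y∈ y′∈ → disj (there y∈) (there y′∈)))
  λ (x∈ , x∈′) → let xs , x∈xs , xs∈ = ∈-concat⁻′ _ x∈′ ; y′ , y′∈ , eq = ∈-map⁻ f xs∈ in
    disj (here refl) (there y′∈) (All.lookup y∉ y′∈) (x∈ , subst (_ ∈_) eq x∈xs)

∈-concatMap⇒ : {A B : Set} (f : A → List B) (ys : List A) {x : B} →
               x ∈ concat (map f ys) → ∃[ y ] y ∈ ys × x ∈ f y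
∈-concatMap⇒ f ys x∈ =
  let xs , x∈xs , xs∈ = ∈-concat⁻′ _ x∈ ; y , y∈ , eq = ∈-map⁻ f xs∈ in y , y∈ , subst (_ ∈_) eq x∈xs

-- Turns a list of starting vertices into a list of cycles or paths. Only the inner lists and the
-- traces of the results matter later, so just these two projections are tracked.
gather : {A B : Set} {C D : Set} {f : A → C} {g : A → D} (f′ : B → C) (g′ : B → D) (ys : List A) →
  (∀ {y} → y ∈ ys → ∃[ b ] f′ b ≡ f y × g′ b ≡ g y) →
  ∃[ bs ] map f′ bs ≡ map f ys × map g′ bs ≡ map g ys
gather f′ g′ []       make = [] , refl , refl
gather f′ g′ (y ∷ ys) make =
  let b , eq₁ , eq₂ = make (here refl)
      bs , eqs₁ , eqs₂ = gather f′ g′ ys (make ∘ there)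
  in b ∷ bs , cong₂ _∷_ eq₁ eqs₁ , cong₂ _∷_ eq₂ eqs₂

infix-applyUpTo : {A : Set} (f : ℕ → A) → ∀ i k → i ≤ k →
                  Infix _≡_ (f i ∷ f (1 + i) ∷ []) (applyUpTo f (2 + k))
infix-applyUpTo f zero    k       _         = here (refl ∷ refl ∷ [])
infix-applyUpTo f (suc i) (suc k) (s≤s i≤k) = there (infix-applyUpTo (f ∘ suc) i k i≤k)

infix⇒∈ : {A : Set} {x y : A} {t : List A} → Infix _≡_ (x ∷ y ∷ []) t → x ∈ t × y ∈ t
infix⇒∈ (here (refl ∷ refl ∷ [])) = here refl , there (here refl)
infix⇒∈ (there i) = let x∈ , y∈ = infix⇒∈ i in there x∈ , there y∈

∈-∷ʳ⁻ : {A : Set} (xs : List A) {x y : A} → x ∈ xs ∷ʳ y → x ∈ xs ⊎ x ≡ y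
∈-∷ʳ⁻ xs x∈ with ∈-++⁻ xs x∈
... | inj₁ x∈xs        = inj₁ x∈xs
... | inj₂ (here x≡y)  = inj₂ x≡y

unique-∷ʳ : {A : Set} {xs : List A} {y : A} → Unique xs → y ∉ xs → Unique (xs ∷ʳ y)
unique-∷ʳ u y∉ = Unique.++⁺ u ([] ∷ []) λ { (x∈ , here refl) → y∉ x∈ }

∷ʳ-empty : {A : Set} (xs : List A) {x y : A} {r : List A} →
           0 ≡ length xs → xs ∷ʳ x ≡ y ∷ r → x ≡ y
∷ʳ-empty [] _ refl = refl

injective⇒surjective : {n : ℕ} {f : Fin n → Fin n} → (∀ {x y} → f x ≡ f y → x ≡ y) →
                       ∀ y → ∃[ x ] f x ≡ y
injective⇒surjective {n} {f} inj y with any? (λ x → f x ≟ y)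
... | yes found = found
... | no none = contradiction
  (unique⇒length≤n (∉∧unique⇒unique-∷ y∉ (Unique.map⁺ inj (Unique.allFin⁺ n))))
  (ℕ.<⇒≱ (s≤s (ℕ.≤-reflexive (sym (trans (length-map f (allFin n)) (length-tabulate id))))))
  where
  y∉ : y ∉ map f (allFin n)
  y∉ y∈ = let x , _ , eq = ∈-map⁻ f y∈ in none (x , sym eq)

unique-map-on : {A B : Set} (f : A → B) {xs : List A} → Unique xs →
  (∀ {x y} → x ∈ xs → y ∈ xs → f x ≡ f y → x ≡ y) → Unique (map f xs)
unique-map-on f []       inj = []
unique-map-on f (x∉ ∷ u) inj = ∉∧unique⇒unique-∷
  (λ fx∈ → let y , y∈ , eq = ∈-map⁻ f fx∈ in
    All.lookup x∉ y∈ (inj (here refl) (there y∈) eq))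
  (unique-map-on f u (λ x∈ y∈ → inj (there x∈) (there y∈)))

lengths-agree : {A B C : Set} {f : A → C} {g : B → C} {xs : List A} {ys : List B} →
                map f xs ≡ map g ys → length xs ≡ length ys
lengths-agree {f = f} {g} {xs} {ys} eq =
  trans (sym (length-map f xs)) (trans (cong length eq) (length-map g ys))

applyUpTo-cong : (f g : ℕ → A) → ∀ k → (∀ {i} → i < k → f i ≡ g i) → applyUpTo f k ≡ applyUpTo g k
applyUpTo-cong f g zero    eq = refl
applyUpTo-cong f g (suc k) eq = cong₂ _∷_ (eq z<s) (applyUpTo-cong (f ∘ suc) (g ∘ suc) k (eq ∘ s<s))

∸-step : ∀ {i s} → i < s → s ∸ i ≡ suc (s ∸ suc i)
∸-step {i} {suc s} i<s = ℕ.+-∸-assoc 1 (s≤s⁻¹ i<s)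


-- Structural parity, since arguments along threads advance two vertices at a time.
data Even : ℕ → Set where
  zero : Even 0
  2+_  : ∀ {k} → Even k → Even (2 + k)

even-or-odd : ∀ k → Even k ⊎ Even (suc k)
even-or-odd zero = inj₁ zero
even-or-odd (suc k) with even-or-odd k
... | inj₁ e = inj₂ (2+ e)
... | inj₂ e = inj₁ e

¬even-suc : ∀ {k} → Even k → ¬ Even (suc k)
¬even-suc (2+ e) (2+ o) = ¬even-suc e o

even⇒2∣ : ∀ {k} → Even k → 2 ∣ k
even⇒2∣ zero   = divides 0 refl
even⇒2∣ (2+ e) = ∣m∣n⇒∣m+n ∣-refl (even⇒2∣ e)

odd⇒pred : ∀ {k} → Even (1 + k) → ∃[ i ] Even i × k ≡ 1 + i
odd⇒pred {suc i} (2+ e) = i , e , refl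

2∣⇒even : ∀ k → 2 ∣ k → Even k
2∣⇒even zero          _                = zero
2∣⇒even (suc zero)    (divides zero ())
2∣⇒even (suc zero)    (divides (suc q) ())
2∣⇒even (suc (suc k)) 2∣2+k            = 2+ 2∣⇒even k (∣m+n∣m⇒∣n 2∣2+k ∣-refl)


-- Threads, anchors and hubs

module ThreadTheory {n : ℕ} (G : Graph n) where
  open Graph G
  open Forcing G

  -- The form in which degree at least 3 is used: whichever vertex is excluded, two neighbours
  -- remain.
  High : Fin n → Set
  High w = ∀ v → ∃₂ λ a b → a ≢ b × (w ~ a × a ≢ v) × (w ~ b × b ≢ v)

  -- `Special` is abstract because there are two instances: the vertices of degree at least 3 for
  -- dipoles, and a single base point for bouquets, which on a bare cycle has degree 2 itself.
  module Threads
    (Special : Fin n → Set) (special? : ∀ x → Dec (Special x))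
    (lowNbrs : ∀ {y a b c} → ¬ Special y → y ~ a → y ~ b → y ~ c → a ≢ b → c ≡ a ⊎ c ≡ b)
    (other : ∀ {w v} → w ~ v → ∃[ x ] w ~ x × x ≢ v)
    where

    -- The vertices are `p 0` to `p (1 + s)`, of which `s` are inner; later values of `p` are
    -- arbitrary. Nothing is said about the last vertex, so that unfinished walks are covered.
    record IsWalk (p : ℕ → Fin n) (s : ℕ) : Set where
      field
        special₀ : Special (p 0)
        low      : ∀ {i} → i < s → ¬ Special (p (1 + i))
        adj      : ∀ {i} → i ≤ s → p i ~ p (1 + i)
        turn     : ∀ {i} → i < s → p i ≢ p (2 + i)

      nbr : ∀ {i w} → i < s → p (1 + i) ~ w → w ≡ p i ⊎ w ≡ p (2 + i)
      nbr i<s ~w = lowNbrs (low i<s) (symmetric (adj (ℕ.<⇒≤ i<s))) (adj i<s) ~w (turn i<s)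

      -- A coincidence of two inner vertices passes to their neighbours. If the walk runs in
      -- opposite directions there, the two indices approach each other until they are one or two
      -- apart, against `irreflexive` or `turn`. If it runs in the same direction, both indices
      -- decrease until the special start equals a low vertex.
      injective : ∀ i j → i < j → j < s → p (1 + i) ≢ p (1 + j)
      injective i (suc j) (s≤s i≤j) j<s eq
        with nbr {w = p (2 + i)} j<s (subst (_~ p (2 + i)) eq (adj (ℕ.≤-<-trans i≤j (ℕ.<⇒≤ j<s))))
      ... | inj₁ inward with ℕ.m≤n⇒m<n∨m≡n i≤j
      ...   | inj₂ refl = irreflexive (subst (p (1 + i) ~_) (sym eq) (adj (ℕ.<⇒≤ j<s)))
      ...   | inj₁ i<j with ℕ.m≤n⇒m<n∨m≡n i<j
      ...     | inj₂ refl  = turn (ℕ.<⇒≤ j<s) eq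
      ...     | inj₁ 1+i<j = injective (suc i) j 1+i<j (ℕ.<⇒≤ j<s) inward
      injective i (suc j) (s≤s i≤j) j<s eq | inj₂ outward
        with nbr {w = p i} j<s
               (subst (_~ p i) eq (symmetric (adj (ℕ.≤-trans i≤j (ℕ.<⇒≤ (ℕ.<⇒≤ j<s))))))
      ... | inj₂ eq′ = turn (ℕ.≤-<-trans i≤j (ℕ.<⇒≤ j<s)) (trans eq′ (sym outward))
      injective zero    (suc j) i≤j j<s eq | inj₂ _ | inj₁ eq′ =
        low (ℕ.<⇒≤ j<s) (subst Special eq′ special₀)
      injective (suc i) (suc j) (s≤s i<j) j<s eq | inj₂ _ | inj₁ eq′ =
        injective i j i<j (ℕ.<⇒≤ j<s) eq′

    record Thread : Set where
      field
        p        : ℕ → Fin n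
        s        : ℕ
        isWalk   : IsWalk p s
        special₁ : Special (p (1 + s))
      open IsWalk isWalk public

      inner : List (Fin n)
      inner = applyUpTo (p ∘ suc) s

    open Thread

    reverse : Thread → Thread
    reverse T = record
      { p        = λ i → p T (suc (s T) ∸ i)
      ; s        = s T
      ; isWalk   = record
        { special₀ = special₁ T
        ; low      = λ i<s → subst (λ k → ¬ Special (p T k)) (sym (∸-step i<s)) (low T (back i<s))
        ; adj      = λ {i} i≤s → subst (λ k → p T k ~ p T (s T ∸ i)) (sym (∸-step (s≤s i≤s)))
                             (symmetric (adj T (ℕ.m∸n≤m (s T) i)))
        ; turn     = λ {i} i<s eq → turn T (back i<s) (sym
            (subst (λ k → p T k ≡ p T (s T ∸ suc i))
                   (trans (∸-step (ℕ.m<n⇒m<1+n i<s)) (cong suc (∸-step i<s))) eq))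
        }
      ; special₁ = subst (Special ∘ p T) (sym (ℕ.n∸n≡0 (s T))) (special₀ T)
      }
      where
      back : ∀ {i} → i < s T → s T ∸ suc i < s T
      back {i} i<s = ℕ.<-≤-trans (ℕ.≤-reflexive (sym (∸-step i<s))) (ℕ.m∸n≤m (s T) i)

    reverse-end : ∀ T → p (reverse T) (1 + s T) ≡ p T 0
    reverse-end T = cong (p T) (ℕ.n∸n≡0 (s T))

    reverse-last : ∀ T → p (reverse T) (s T) ≡ p T 1
    reverse-last T = cong (p T) (trans (∸-step {s T} (ℕ.n<1+n (s T))) (cong suc (ℕ.n∸n≡0 (s T))))

    module _ (T T′ : Thread) (eq₀ : p T 0 ≡ p T′ 0) (eq₁ : p T 1 ≡ p T′ 1) where

      -- The first edge determines a thread: at a low vertex the only continuation is the neighbour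
      -- one did not come from.
      agree : ∀ i → i ≤ s T → i ≤ s T′ → p T i ≡ p T′ i × p T (1 + i) ≡ p T′ (1 + i)
      agree zero    _   _    = eq₀ , eq₁
      agree (suc i) i<s i<s′ with agree i (ℕ.<⇒≤ i<s) (ℕ.<⇒≤ i<s′)
      ... | eqᵢ , eqₛᵢ with nbr T′ {w = p T (2 + i)} i<s′ (subst (_~ p T (2 + i)) eqₛᵢ (adj T i<s))
      ...   | inj₁ eq = contradiction (trans eqᵢ (sym eq)) (turn T i<s)
      ...   | inj₂ eq = eqₛᵢ , eq

      same-s : s T ≡ s T′
      same-s with ℕ.<-cmp (s T) (s T′)
      ... | tri≈ _ eq _ = eq
      ... | tri< lt _ _ = contradiction
        (subst Special (proj₂ (agree (s T) ℕ.≤-refl (ℕ.<⇒≤ lt))) (special₁ T)) (low T′ lt)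
      ... | tri> _ _ gt = contradiction
        (subst Special (sym (proj₂ (agree (s T′) (ℕ.<⇒≤ gt) ℕ.≤-refl))) (special₁ T′)) (low T gt)

      same-end : p T (1 + s T) ≡ p T′ (1 + s T′)
      same-end = trans (proj₂ (agree (s T) ℕ.≤-refl (ℕ.≤-reflexive same-s))) (cong (p T′ ∘ suc) same-s)

      same-last : p T (s T) ≡ p T′ (s T′)
      same-last = trans (proj₁ (agree (s T) ℕ.≤-refl (ℕ.≤-reflexive same-s))) (cong (p T′) same-s)

      same-inner : inner T ≡ inner T′
      same-inner = trans
        (applyUpTo-cong _ _ (s T) (λ i<s →
          proj₂ (agree _ (ℕ.<⇒≤ i<s) (ℕ.≤-trans (ℕ.<⇒≤ i<s) (ℕ.≤-reflexive same-s)))))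
        (cong (applyUpTo (p T′ ∘ suc)) same-s)

    SameEnds : Thread → Thread → Set
    SameEnds T T′ = (p T 0 ≡ p T′ 0 × p T 1 ≡ p T′ 1) ⊎ (p T 0 ≡ p T′ (1 + s T′) × p T 1 ≡ p T′ (s T′))

    -- Walk back along `T` from the common vertex. Each step stays on `T′`, in either direction,
    -- until the special start of `T` is met, and this can only be an end of `T′`.
    crossing : ∀ T T′ i j → i < s T → j < s T′ → p T (1 + i) ≡ p T′ (1 + j) → SameEnds T T′
    crossing T T′ zero j i<s j<s eq
      with nbr T′ j<s (subst (_~ p T 0) eq (symmetric (adj T z≤n)))
    crossing T T′ zero zero    i<s j<s eq | inj₁ eq₀ = inj₁ (eq₀ , eq)
    crossing T T′ zero (suc j) i<s j<s eq | inj₁ eq₀ =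
      contradiction (subst Special eq₀ (special₀ T)) (low T′ (ℕ.<⇒≤ j<s))
    crossing T T′ zero j       i<s j<s eq | inj₂ eq₀ with ℕ.m≤n⇒m<n∨m≡n j<s
    ... | inj₁ 1+j<s = contradiction (subst Special eq₀ (special₀ T)) (low T′ 1+j<s)
    ... | inj₂ refl  = inj₂ (eq₀ , eq)
    crossing T T′ (suc i) j i<s j<s eq
      with nbr T′ j<s (subst (_~ p T (1 + i)) eq (symmetric (adj T (ℕ.<⇒≤ i<s))))
    crossing T T′ (suc i) zero    i<s j<s eq | inj₁ eq′ =
      contradiction (subst Special (sym eq′) (special₀ T′)) (low T (ℕ.<⇒≤ i<s))
    crossing T T′ (suc i) (suc j) i<s j<s eq | inj₁ eq′ =
      crossing T T′ i j (ℕ.<⇒≤ i<s) (ℕ.<⇒≤ j<s) eq′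
    crossing T T′ (suc i) j       i<s j<s eq | inj₂ eq′ with ℕ.m≤n⇒m<n∨m≡n j<s
    ... | inj₁ 1+j<s = crossing T T′ i (suc j) (ℕ.<⇒≤ i<s) 1+j<s eq′
    ... | inj₂ refl  = contradiction (subst Special (sym eq′) (special₁ T′)) (low T (ℕ.<⇒≤ i<s))

    private
      record Dart : Set where
        constructor _↝_by_
        field
          src tgt : Fin n
          joined  : src ~ tgt
      open Dart

      next : Dart → Dart
      next (x ↝ y by x~y) = let z , y~z , _ = other (symmetric x~y) in y ↝ z by y~z

      at : Dart → ℕ → Fin n
      at d zero    = src d
      at d (suc i) = at (next d) i

      at-adj : ∀ d i → at d i ~ at d (1 + i)
      at-adj d zero    = joined d
      at-adj d (suc i) = at-adj (next d) i

      at-turn : ∀ d i → at d i ≢ at d (2 + i)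
      at-turn (x ↝ y by x~y) zero    eq = proj₂ (proj₂ (other (symmetric x~y))) (sym eq)
      at-turn d              (suc i) eq = at-turn (next d) i eq

      search : (q : ℕ → Fin n) → ∀ k → (∃[ s ] Special (q s) × (∀ {i} → i < s → ¬ Special (q i)))
                                       ⊎ (∀ {i} → i < k → ¬ Special (q i))
      search q zero = inj₂ λ ()
      search q (suc k) with search q k
      ... | inj₁ found = inj₁ found
      ... | inj₂ none with special? (q k)
      ...   | yes sp = inj₁ (k , sp , none)
      ...   | no ¬sp = inj₂ λ i<1+k → case ℕ.m≤n⇒m<n∨m≡n (s≤s⁻¹ i<1+k) of λ where
        (inj₁ i<k)  → none i<k
        (inj₂ refl) → ¬sp

    -- If none of the first `suc n` vertices after `h` were special, `IsWalk.injective` would make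
    -- them all distinct, which is one too many.
    follow : ∀ {h y} → Special h → h ~ y → ∃[ T ] p T 0 ≡ h × p T 1 ≡ y
    follow {h} {y} sp h~y with search (at d ∘ suc) (suc n)
      where
      d : Dart
      d = h ↝ y by h~y
    ... | inj₁ (s , sp₁ , low) = record
      { p = at d ; s = s
      ; isWalk = record { special₀ = sp ; low = low ; adj = λ {i} _ → at-adj d i ; turn = λ {i} _ → at-turn d i }
      ; special₁ = sp₁ } , refl , refl
      where
      d : Dart
      d = h ↝ y by h~y
    ... | inj₂ low = contradiction
      (unique⇒length≤n (Unique.applyUpTo⁺₁ (at d ∘ suc) (suc n) (IsWalk.injective walk _ _)))
      (ℕ.<⇒≱ (ℕ.≤-reflexive (sym (length-applyUpTo (at d ∘ suc) (suc n)))))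
      where
      d : Dart
      d = h ↝ y by h~y
      walk : IsWalk (at d) (suc n)
      walk = record { special₀ = sp ; low = low ; adj = λ {i} _ → at-adj d i ; turn = λ {i} _ → at-turn d i }

    start? : ∀ h y → Dec (Special h × h ~ y)
    start? h y = special? h ×-dec (y ∈? N h)

    opaque
      -- The end, the last vertex before it and the inner vertices of the thread
      -- that leaves h through y; junk unless h is special and adjacent to y.
      end last : Fin n → Fin n → Fin n
      trail    : Fin n → Fin n → List (Fin n)
      end h y with start? h y
      ... | yes (sp , h~y) = let T , _ = follow sp h~y in p T (1 + s T)
      ... | no _           = h
      last h y with start? h y
      ... | yes (sp , h~y) = let T , _ = follow sp h~y in p T (s T)
      ... | no _           = h
      trail h y with start? h y
      ... | yes (sp , h~y) = inner (proj₁ (follow sp h~y))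
      ... | no _           = []

      end-thread : ∀ T → end (p T 0) (p T 1) ≡ p T (1 + s T)
      end-thread T with start? (p T 0) (p T 1)
      ... | yes (sp , h~y) = let T′ , eq₀ , eq₁ = follow sp h~y in same-end T′ T eq₀ eq₁
      ... | no ¬start      = contradiction (special₀ T , adj T z≤n) ¬start

      last-thread : ∀ T → last (p T 0) (p T 1) ≡ p T (s T)
      last-thread T with start? (p T 0) (p T 1)
      ... | yes (sp , h~y) = let T′ , eq₀ , eq₁ = follow sp h~y in same-last T′ T eq₀ eq₁
      ... | no ¬start      = contradiction (special₀ T , adj T z≤n) ¬start

      trail-thread : ∀ T → trail (p T 0) (p T 1) ≡ inner T
      trail-thread T with start? (p T 0) (p T 1)
      ... | yes (sp , h~y) = let T′ , eq₀ , eq₁ = follow sp h~y in same-inner T′ T eq₀ eq₁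
      ... | no ¬start      = contradiction (special₀ T , adj T z≤n) ¬start

  module Classes
    (Special : Fin n → Set) (special? : ∀ x → Dec (Special x))
    (lowNbrs : ∀ {y a b c} → ¬ Special y → y ~ a → y ~ b → y ~ c → a ≢ b → c ≡ a ⊎ c ≡ b)
    (other : ∀ {w v} → w ~ v → ∃[ x ] w ~ x × x ≢ v)
    (ind : ∀ {B} → Closed B → ∀ x → B x → ∀ v → B v)
    (neighbour : ∀ x → ∃[ y ] x ~ y)
    (wide : ∀ {w} → Special w → High w ⊎ (∀ {x} → Special x → x ≡ w))
    where

    open Threads Special special? lowNbrs other public
    open Thread

    module _ (T : Thread) (s-odd : Even (1 + s T)) where

      private
        -- The positions `1`, `3`, ..., `s`: the parity class of the thread that contains neither
        -- end.
        Odds : Fin n → Set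
        Odds v = ∃[ i ] Even i × i < s T × v ≡ p T (1 + i)

        odds-low : ∀ {v} → Odds v → ¬ Special v
        odds-low (i , _ , i<s , refl) = low T i<s

        odds-step : ∀ {a w v} → Odds a → a ~ w → ¬ Special w → w ~ v → Odds v
        odds-step {w = w} (i , ei , i<s , refl) a~w ¬sp w~v with nbr T i<s a~w
        odds-step (zero , ei , i<s , refl) a~w ¬sp w~v | inj₁ refl = contradiction (special₀ T) ¬sp
        odds-step (suc (suc i) , (2+ ei) , i<s , refl) a~w ¬sp w~v | inj₁ refl
          with nbr T (ℕ.<⇒≤ i<s) w~v
        ... | inj₁ refl = i , ei , ℕ.<⇒≤ (ℕ.<⇒≤ i<s) , refl
        ... | inj₂ refl = 2 + i , 2+ ei , i<s , refl
        odds-step (i , ei , i<s , refl) a~w ¬sp w~v | inj₂ refl with ℕ.m≤n⇒m<n∨m≡n i<s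
        ... | inj₂ refl = contradiction (special₁ T) ¬sp
        ... | inj₁ 1+i<s with nbr T 1+i<s w~v
        ...   | inj₁ refl = i , ei , i<s , refl
        ...   | inj₂ refl with ℕ.m≤n⇒m<n∨m≡n 1+i<s
        ...     | inj₁ 2+i<s = 2 + i , 2+ ei , 2+i<s , refl
        ...     | inj₂ refl  = contradiction s-odd (¬even-suc (2+ ei))

        odds-special : ∀ {a w} → Odds a → a ~ w → Special w →
                       (a ≡ p T 1 × w ≡ p T 0) ⊎ (a ≡ p T (s T) × w ≡ p T (1 + s T))
        odds-special (i , ei , i<s , refl) a~w sp with nbr T i<s a~w
        odds-special (zero  , ei , i<s , refl) a~w sp | inj₁ refl = inj₁ (refl , refl)
        odds-special (suc i , ei , i<s , refl) a~w sp | inj₁ refl =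
          contradiction sp (low T (ℕ.<⇒≤ i<s))
        odds-special (i , ei , i<s , refl) a~w sp | inj₂ refl with ℕ.m≤n⇒m<n∨m≡n i<s
        ... | inj₁ 1+i<s = contradiction sp (low T 1+i<s)
        ... | inj₂ refl  = inj₂ (refl , refl)

        pred-s : ∃[ k ] Even k × s T ≡ 1 + k
        pred-s = odd⇒pred s-odd

        odds-first : Odds (p T 1)
        odds-first with k , _ , eq ← pred-s = 0 , zero , subst (0 <_) (sym eq) z<s , refl

        odds-last : Odds (p T (s T))
        odds-last with k , e , eq ← pred-s = k , e , ℕ.≤-reflexive (sym eq) , cong (p T) eq

        -- The complement of `Odds` is closed. The base point has two neighbours in `Odds`, the
        -- first and the last inner vertex, so it forces neither of them; a low vertex with one
        -- neighbour in `Odds` has both there.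
        loop-absurd : p T 0 ≡ p T (1 + s T) → ⊥
        loop-absurd h≡k = ind closed (p T 0) (λ o → odds-low o (special₀ T)) (p T 1) odds-first
          where
          first≢last : p T 1 ≢ p T (s T)
          first≢last eq with pred-s
          ... | zero  , _ , s≡ = turn T (subst (0 <_) (sym s≡) z<s) (trans h≡k (cong (p T ∘ suc) s≡))
          ... | suc k , _ , s≡ = injective T 0 (1 + k) z<s (ℕ.≤-reflexive (sym s≡))
                                   (trans eq (cong (p T) s≡))
          closed : Closed (¬_ ∘ Odds)
          closed {w} {v} w~v others odd with special? w
          ... | no ¬sp = let x , w~x , x≢v = other w~v in
            others x w~x x≢v (odds-step odd (symmetric w~v) ¬sp w~x)
          ... | yes sp with odds-special odd (symmetric w~v) sp
          ...   | inj₁ (refl , refl) = others (p T (s T))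
            (subst (_~ p T (s T)) (sym h≡k) (symmetric (adj T ℕ.≤-refl))) (≢-sym first≢last) odds-last
          ...   | inj₂ (refl , refl) = others (p T 1)
            (subst (_~ p T 1) h≡k (adj T z≤n)) first≢last odds-first

        -- Now `Odds` itself is closed: each end has just one neighbour in it, while a vertex of
        -- degree at least 3 needs two to force a third. For the same reason the complement would
        -- not do, as an end has only one neighbour outside it.
        bridge-absurd : p T 0 ≢ p T (1 + s T) → (∀ {w} → Special w → High w) → ⊥
        bridge-absurd h≢k high = odds-low (ind closed (p T 1) odds-first (p T 0)) (special₀ T)
          where
          closed : Closed Odds
          closed {w} {v} w~v others with special? w
          ... | no ¬sp = let x , w~x , x≢v = other w~v in
            odds-step (others x w~x x≢v) (symmetric w~x) ¬sp w~v
          ... | yes sp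
            with a , b , a≢b , (w~a , a≢v) , (w~b , b≢v) ← high sp v
            with odds-special (others a w~a a≢v) (symmetric w~a) sp
               | odds-special (others b w~b b≢v) (symmetric w~b) sp
          ...   | inj₁ (refl , _)    | inj₁ (refl , _)    = contradiction refl a≢b
          ...   | inj₂ (refl , _)    | inj₂ (refl , _)    = contradiction refl a≢b
          ...   | inj₁ (refl , refl) | inj₂ (refl , h≡k)  = contradiction h≡k h≢k
          ...   | inj₂ (refl , refl) | inj₁ (refl , k≡h)  = contradiction (sym k≡h) h≢k

      odd-absurd : ⊥
      odd-absurd with p T 0 ≟ p T (1 + s T)
      ... | yes h≡k = loop-absurd h≡k
      ... | no h≢k  = bridge-absurd h≢k λ {w} sp → case wide sp of λ where
        (inj₁ high) → high
        (inj₂ only) → contradiction (trans (only (special₀ T)) (sym (only (special₁ T)))) h≢k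

    s-even : ∀ T → Even (s T)
    s-even T with even-or-odd (s T)
    ... | inj₁ e = e
    ... | inj₂ o = ⊥-elim (odd-absurd T o)

    Anchored : Fin n → Fin n → Set
    Anchored g v = ∃[ T ] p T 0 ≡ g × ∃[ i ] Even i × i ≤ s T × v ≡ p T i

    anchored-self : ∀ {g} → Special g → Anchored g g
    anchored-self {g} sp with y , g~y ← neighbour g with T , eq , _ ← follow sp g~y =
      T , eq , 0 , zero , z≤n , sym eq

    anchored-special : ∀ {g h} → Anchored g h → Special h → h ≡ g
    anchored-special (T , refl , zero , _ , _ , eq) _ = eq
    anchored-special (T , refl , suc (suc i) , _ , i≤s , refl) sp = contradiction sp (low T i≤s)

    end-special : ∀ {w y} → Special w → w ~ y → Special y → end w y ≡ y
    end-special sp w~y spy with follow sp w~y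
    ... | T , refl , refl = trans (end-thread T) (stop (s T) refl)
      where
      stop : ∀ k → k ≡ s T → p T (1 + s T) ≡ p T 1
      stop zero    refl = refl
      stop (suc k) eq   = contradiction spy (low T (ℕ.<-≤-trans z<s (ℕ.≤-reflexive eq)))

    end-reverse : ∀ T → end (p T (1 + s T)) (p T (s T)) ≡ p T 0
    end-reverse T = trans (end-thread (reverse T)) (reverse-end T)

    -- Together with `end⇒anchored` this is the reduction to special vertices: seen from a special
    -- `w`, the neighbour `y` belongs to the far end of the thread through `y`.
    anchored⇒end : ∀ {g w y} → Anchored g y → Special w → w ~ y → end w y ≡ g
    anchored⇒end (T , refl , zero , _ , _ , refl) sp w~y = end-special sp w~y (special₀ T)
    anchored⇒end (T , refl , suc (suc i) , _ , i≤s , refl) sp w~y with nbr T i≤s (symmetric w~y)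
    ... | inj₁ refl = contradiction sp (low T (ℕ.<⇒≤ i≤s))
    ... | inj₂ refl with ℕ.m≤n⇒m<n∨m≡n i≤s
    ...   | inj₁ lt   = contradiction sp (low T lt)
    ...   | inj₂ refl = end-reverse T

    end⇒anchored : ∀ {w y} → Special w → w ~ y → Anchored (end w y) y
    end⇒anchored sp w~y with T , refl , refl ← follow sp w~y =
      reverse T , sym (end-thread T) , s T , s-even T , ℕ.≤-refl , sym (reverse-last T)

    anchored-spread : ∀ {g w a b} → ¬ Special w → w ~ a → w ~ b → Anchored g a → Anchored g b
    anchored-spread {a = a} {b} ¬sp w~a w~b A with a ≟ b
    ... | yes refl = A
    -- Here `a` is `g` itself. `T₀` may leave `g` elsewhere, so the thread of `g` through `w` is
    -- taken instead; its even number of inner vertices leaves room for position 2.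
    anchored-spread ¬sp w~a w~b (T₀ , refl , zero , _ , _ , refl) | no a≢b
      with T , eq , refl ← follow (special₀ T₀) (symmetric w~a) = T , eq , 2 , 2+ zero , 2≤s , b≡
      where
      0<s : 0 < s T
      0<s with s T | special₁ T
      ... | zero  | sp = contradiction sp ¬sp
      ... | suc _ | _  = z<s
      2≤s : 2 ≤ s T
      2≤s with s T | s-even T | 0<s
      ... | suc (suc _) | _ | _ = s≤s (s≤s z≤n)
      b≡ : _ ≡ p T 2
      b≡ with nbr T 0<s w~b
      ... | inj₁ eq′ = contradiction (sym (trans eq′ eq)) a≢b
      ... | inj₂ eq′ = eq′
    anchored-spread ¬sp w~a w~b (T , refl , suc (suc i) , 2+ e , i≤s , refl) | no a≢b
      with nbr T i≤s (symmetric w~a)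
    ... | inj₁ refl with nbr T (ℕ.<⇒≤ i≤s) w~b
    ...   | inj₁ refl = T , refl , i , e , ℕ.<⇒≤ (ℕ.<⇒≤ i≤s) , refl
    ...   | inj₂ refl = contradiction refl a≢b
    anchored-spread ¬sp w~a w~b (T , refl , suc (suc i) , 2+ e , i≤s , refl) | no a≢b | inj₂ refl
      with ℕ.m≤n⇒m<n∨m≡n i≤s
    ... | inj₂ refl = contradiction (special₁ T) ¬sp
    ... | inj₁ lt with nbr T lt w~b
    ...   | inj₁ refl = contradiction refl a≢b
    ...   | inj₂ refl with ℕ.m≤n⇒m<n∨m≡n lt
    ...     | inj₁ lt′ = T , refl , 4 + i , 2+ (2+ e) , lt′ , refl
    ...     | inj₂ eq  = contradiction (subst Even (sym eq) (s-even T)) (¬even-suc (2+ e))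

    Start : Fin n → Fin n → Set
    Start h y = Special h × h ~ y

    route : Fin n → Fin n → List (Fin n)
    route h y = h ∷ trail h y ∷ʳ end h y

    route-thread : ∀ T → route (p T 0) (p T 1) ≡ applyUpTo (p T) (2 + s T)
    route-thread T rewrite trail-thread T | end-thread T =
      cong (p T 0 ∷_) (applyUpTo-∷ʳ (p T ∘ suc) (s T))

    on-route : ∀ T {i} → i ≤ s T →
               Infix _≡_ (p T i ∷ p T (1 + i) ∷ []) (route (p T 0) (p T 1))
    on-route T {i} i≤s = subst (Infix _≡_ _) (sym (route-thread T)) (infix-applyUpTo (p T) i (s T) i≤s)

    module _ {h y} (start : Start h y) where

      route-linked : Linked _~_ (route h y)
      route-linked with T , refl , refl ← follow (proj₁ start) (proj₂ start) =
        subst (Linked _~_) (sym (route-thread T))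
          (Linked.applyUpTo⁺₁ (p T) (2 + s T) (λ 1+i<2+s → adj T (s≤s⁻¹ (s≤s⁻¹ 1+i<2+s))))

      trail-unique : Unique (trail h y)
      trail-unique with T , refl , refl ← follow (proj₁ start) (proj₂ start) =
        subst Unique (sym (trail-thread T))
          (Unique.applyUpTo⁺₁ (p T ∘ suc) (s T) (injective T _ _))

      ∈-trail : ∀ {x} → x ∈ trail h y →
                ∃[ T ] p T 0 ≡ h × p T 1 ≡ y × ∃[ i ] i < s T × x ≡ p T (1 + i)
      ∈-trail x∈ with T , refl , refl ← follow (proj₁ start) (proj₂ start) =
        T , refl , refl , ∈-applyUpTo⁻ (p T ∘ suc) (subst (_ ∈_) (trail-thread T) x∈)

      trail-low : ∀ {x} → x ∈ trail h y → ¬ Special x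
      trail-low x∈ with T , _ , _ , i , i<s , refl ← ∈-trail x∈ = low T i<s

      trail-covered : ∀ {x z} → x ∈ trail h y → x ~ z → _LiesOn_ G (x , z) (route h y)
      trail-covered x∈ x~z with T , refl , refl , i , i<s , refl ← ∈-trail x∈ with nbr T i<s x~z
      ... | inj₁ refl = inj₂ (on-route T (ℕ.<⇒≤ i<s))
      ... | inj₂ refl = inj₁ (on-route T i<s)

      first-on-route : _LiesOn_ G (h , y) (route h y)
      first-on-route with T , refl , refl ← follow (proj₁ start) (proj₂ start) =
        inj₁ (on-route T z≤n)

      last-on-route : _LiesOn_ G (end h y , last h y) (route h y)
      last-on-route with T , refl , refl ← follow (proj₁ start) (proj₂ start)
        rewrite end-thread T | last-thread T = inj₂ (subst (Infix _≡_ _)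
          (cong (λ e → p T 0 ∷ trail (p T 0) (p T 1) ∷ʳ e) (end-thread T)) (on-route T ℕ.≤-refl))

      trail-even : Even (length (trail h y))
      trail-even with T , refl , refl ← follow (proj₁ start) (proj₂ start) = subst Even
        (sym (trans (cong length (trail-thread T)) (length-applyUpTo (p T ∘ suc) (s T)))) (s-even T)

      end-start : Start (end h y) (last h y)
      end-start with T , refl , refl ← follow (proj₁ start) (proj₂ start)
        rewrite end-thread T | last-thread T = special₁ T , symmetric (adj T ℕ.≤-refl)

      end-end : end (end h y) (last h y) ≡ h
      end-end with T , refl , refl ← follow (proj₁ start) (proj₂ start)
        rewrite end-thread T | last-thread T = end-reverse T

      last-end : last (end h y) (last h y) ≡ y
      last-end with T , refl , refl ← follow (proj₁ start) (proj₂ start)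
        rewrite end-thread T | last-thread T = trans (last-thread (reverse T)) (reverse-last T)

      trail-first : ∃[ r ] trail h y ∷ʳ end h y ≡ y ∷ r
      trail-first with T , refl , refl ← follow (proj₁ start) (proj₂ start) =
        _ , proj₂ (∷-injective (route-thread T))

    trail-crossing : ∀ {h y h′ y′ x} → Start h y → Start h′ y′ → x ∈ trail h y → x ∈ trail h′ y′ →
                     (h ≡ h′ × y ≡ y′) ⊎ (h ≡ end h′ y′ × y ≡ last h′ y′)
    trail-crossing st st′ x∈ x∈′
      with T , refl , refl , i , i<s , refl ← ∈-trail st x∈
      with T′ , refl , refl , j , j<s , eq ← ∈-trail st′ x∈′
      with crossing T T′ i j i<s j<s eq
    ... | inj₁ same = inj₁ same
    ... | inj₂ (eq₀ , eq₁) = inj₂ (trans eq₀ (sym (end-thread T′)) , trans eq₁ (sym (last-thread T′)))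

    crossing-ends : ∀ {h y h′ y′ x} → Start h y → Start h′ y′ → x ∈ trail h y → x ∈ trail h′ y′ →
                    (h ≡ h′ × end h y ≡ end h′ y′) ⊎ (h ≡ end h′ y′ × end h y ≡ h′)
    crossing-ends st st′ x∈ x∈′ with trail-crossing st st′ x∈ x∈′
    ... | inj₁ (refl , refl) = inj₁ (refl , refl)
    ... | inj₂ (refl , refl) = inj₂ (refl , end-end st′)

    loop-first≢last : ∀ {h y} → Start h y → end h y ≡ h → y ≢ last h y
    loop-first≢last (sp , h~y) loop eq with T , refl , refl ← follow sp h~y =
      apart (s T) refl (s-even T)
      where
      apart : ∀ k → k ≡ s T → Even k → ⊥
      apart zero eqₖ _ = irreflexive (subst (p T 0 ~_)
        (trans (trans (cong (p T ∘ suc) eqₖ) (sym (end-thread T))) loop) (adj T z≤n))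
      apart (suc (suc k)) eqₖ _ = injective T 0 (1 + k) z<s (ℕ.≤-reflexive eqₖ)
        (trans eq (trans (last-thread T) (cong (p T) (sym eqₖ))))

    trail-injective : ∀ {h y y′} → Start h y → Start h y′ → end h y ≡ end h y′ →
                      trail h y ≡ trail h y′ → y ≡ y′
    trail-injective st st′ eqₑ eqₜ with _ , eq ← trail-first st | _ , eq′ ← trail-first st′ =
      proj₁ (∷-injective (trans (sym eq) (trans (cong₂ _∷ʳ_ eqₜ eqₑ) eq′)))

    loop⇒oddCycle : ∀ {c y} → Start c y → end c y ≡ c →
                    ∃[ C ] OddCycle.inner {G = G} {c} C ≡ trail c y × OddCycle.trace C ≡ route c y
    loop⇒oddCycle {c} {y} st loop = record
      { cycle = record
        { inner = trail c y
        ; linked = subst (λ e → Linked _~_ (c ∷ trail c y ∷ʳ e)) loop (route-linked st)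
        ; simple = ∉∧unique⇒unique-∷ (λ c∈ → trail-low st c∈ (proj₁ st)) (trail-unique st)
        ; long = long (length (trail c y)) refl (trail-even st)
        }
      ; odd = λ 2∣ → ¬even-suc (trail-even st) (2∣⇒even _ 2∣)
      } , refl , cong (λ e → c ∷ trail c y ∷ʳ e) (sym loop)
      where
      long : ∀ k → k ≡ length (trail c y) → Even k → 3 ≤ suc (length (trail c y))
      long zero eq _ = contradiction
        (subst (c ~_) (trans (sym (∷ʳ-empty (trail c y) eq (proj₂ (trail-first st)))) loop) (proj₂ st))
        irreflexive
      long (suc (suc k)) eq _ = s≤s (subst (2 ≤_) eq (s≤s (s≤s z≤n)))

    -- A closed thread at `c` leaves `c` through two neighbours; comparing them selects one
    -- orientation.
    loops : Fin n → List (Fin n)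
    loops c = filter (λ y → start? c y ×-dec (end c y ≟ c) ×-dec (y <? last c y)) (allFin n)

    ∈-loops : ∀ {c y} → y ∈ loops c → Start c y × end c y ≡ c × y <ᶠ last c y
    ∈-loops {c} y∈ =
      proj₂ (∈-filter⁻ (λ y → start? c y ×-dec (end c y ≟ c) ×-dec (y <? last c y)) {xs = allFin n} y∈)

    loops-cover : ∀ {c z} → Start c z → end c z ≡ c → ∃[ y ] y ∈ loops c × _LiesOn_ G (c , z) (route c y)
    loops-cover {c} {z} st loop with <ᶠ-cmp z (last c z)
    ... | tri≈ _ eq _ = contradiction eq (loop-first≢last st loop)
    ... | tri< lt _ _ = z , ∈-filter⁺ _ (∈-allFin z) (st , loop , lt) , first-on-route st
    ... | tri> _ _ gt =
      y , ∈-filter⁺ _ (∈-allFin y) (st′ , loop′ , subst (y <ᶠ_) (sym last′) gt) ,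
      subst (λ e → _LiesOn_ G e (route c y)) (cong₂ _,_ loop′ last′) (last-on-route st′)
      where
      y : Fin n
      y = last c z
      st′ : Start c y
      st′ = subst (λ e → Start e y) loop (end-start st)
      loop′ : end c y ≡ c
      loop′ = trans (cong (λ e → end e y) (sym loop)) (end-end st)
      last′ : last c y ≡ z
      last′ = trans (cong (λ e → last e y) (sym loop)) (last-end st)

    loopInners : Fin n → List (Fin n)
    loopInners c = concat (map (trail c) (loops c))

    loopInners-unique : ∀ c → Unique (loopInners c)
    loopInners-unique c = unique-concatMap (trail c)
      (Unique.filter⁺ (λ y → start? c y ×-dec (end c y ≟ c) ×-dec (y <? last c y)) (Unique.allFin⁺ n))
      (λ y∈ → trail-unique (proj₁ (∈-loops y∈)))
      disjoint
      where
      disjoint : ∀ {y y′} → y ∈ loops c → y′ ∈ loops c → y ≢ y′ → Disjoint (trail c y) (trail c y′)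
      disjoint {y} {y′} y∈ y′∈ y≢y′ (x∈ , x∈′)
        with st , loop , y<l ← ∈-loops y∈ | st′ , loop′ , y′<l′ ← ∈-loops y′∈
        with trail-crossing st st′ x∈ x∈′
      ... | inj₁ (_ , eq) = y≢y′ eq
      ... | inj₂ (_ , y≡l′) = <ᶠ-irrefl refl (<ᶠ-trans (subst (y′ <ᶠ_) (sym y≡l′) y′<l′)
        (subst (y <ᶠ_) (trans (cong₂ last (sym loop′) y≡l′) (last-end st′)) y<l))

    loopCycles : ∀ c → ∃[ Cs ] map (OddCycle.inner {G = G} {c}) Cs ≡ map (trail c) (loops c) ×
                               map OddCycle.trace Cs ≡ map (route c) (loops c)
    loopCycles c = gather OddCycle.inner OddCycle.trace (loops c)
      (λ y∈ → let st , loop , _ = ∈-loops y∈ in loop⇒oddCycle st loop)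

    loopInners-low : ∀ {c x} → x ∈ loopInners c → ¬ Special x
    loopInners-low {c} x∈ = let y , y∈ , x∈y = ∈-concatMap⇒ (trail c) (loops c) x∈ in
      trail-low (proj₁ (∈-loops y∈)) x∈y

    -- A predicate preserved along edges is closed: go from the second neighbour supplied by `other`
    -- back to `w` and on to `v`. So threshold one implies connectedness.
    connected : ∀ {B : Fin n → Set} {x} → B x → (∀ {x y} → x ~ y → B x → B y) → ∀ v → B v
    connected {B} Bx spread = ind closed _ Bx
      where
      closed : Closed B
      closed w~v others = let x , w~x , x≢v = other w~v in
        spread w~v (spread (symmetric w~x) (others x w~x x≢v))

    -- Only edges at listed vertices need checking: such an edge lies on a trace and traces stay
    -- within `vs`, so `vs` is closed under adjacency and by connectedness contains every vertex.
    consistsOf : ∀ {vs ts x₀} → Unique vs → x₀ ∈ vs →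
      (∀ {x z} → x ∈ vs → x ~ z → Any (_LiesOn_ G (x , z)) ts) →
      (∀ {t x} → t ∈ ts → x ∈ t → x ∈ vs) → ConsistsOf G vs ts
    consistsOf {vs} u x₀∈ cover within =
      unique∧same⇒↭ u (Unique.allFin⁺ n) (λ {x} _ → ∈-allFin x) (λ {x} _ → all x) ,
      λ x y x~y → cover (all x) x~y
      where
      liesOn⇒∈ : ∀ {x z t} → _LiesOn_ G (x , z) t → z ∈ t
      liesOn⇒∈ (inj₁ i) = proj₂ (infix⇒∈ i)
      liesOn⇒∈ (inj₂ i) = proj₁ (infix⇒∈ i)
      all : ∀ x → x ∈ vs
      all = connected x₀∈ λ x~y x∈ → case find (cover x∈ x~y) of λ where
        (t , t∈ , lies) → within t∈ (liesOn⇒∈ lies)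

    bouquet : ∀ {c} → Special c → (∀ {x} → Special x → x ≡ c) → OddCycleBouquet G
    bouquet {c} sp only = record
      { centre = c
      ; cycles = proj₁ Cs
      ; nonempty = subst (1 ≤_) (trans (sym (length-map _ (loops c)))
          (trans (cong length (sym (proj₁ (proj₂ Cs)))) (length-map _ (proj₁ Cs)))) nonempty
      ; whole = subst₂ (λ is ts → ConsistsOf G (c ∷ concat is) ts)
          (sym (proj₁ (proj₂ Cs))) (sym (proj₂ (proj₂ Cs)))
          (consistsOf (∉∧unique⇒unique-∷ (λ c∈ → loopInners-low c∈ sp) (loopInners-unique c))
            (here refl) cover within)
      }
      where
      Cs = loopCycles c
      loop : ∀ {z} → c ~ z → end c z ≡ c
      loop c~z = only (proj₁ (end-start (sp , c~z)))
      nonempty : 1 ≤ length (loops c)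
      nonempty with y , c~y ← neighbour c = ∈-length (proj₁ (proj₂ (loops-cover (sp , c~y) (loop c~y))))
      cover : ∀ {x z} → x ∈ c ∷ loopInners c → x ~ z → Any (_LiesOn_ G (x , z)) (map (route c) (loops c))
      cover (here refl) x~z = let y , y∈ , lies = loops-cover (sp , x~z) (loop x~z) in
        lose (∈-map⁺ (route c) y∈) lies
      cover (there x∈) x~z = let y , y∈ , x∈y = ∈-concatMap⇒ (trail c) (loops c) x∈ in
        lose (∈-map⁺ (route c) y∈) (trail-covered (proj₁ (∈-loops y∈)) x∈y x~z)
      within : ∀ {t x} → t ∈ map (route c) (loops c) → x ∈ t → x ∈ c ∷ loopInners c
      within t∈ x∈ with y , y∈ , refl ← ∈-map⁻ (route c) t∈ with x∈
      ... | here refl = here refl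
      ... | there x∈′ with ∈-∷ʳ⁻ (trail c y) x∈′
      ...   | inj₁ x∈y  = there (∈-concat⁺′ x∈y (∈-map⁺ (trail c) y∈))
      ...   | inj₂ refl = here (proj₁ (proj₂ (∈-loops y∈)))

    module Hubs (high : ∀ {w} → Special w → High w) (two : ∀ g → ∃[ h ] Special h × h ≢ g) where

      IsHub : Fin n → Fin n → Fin n → Set
      IsHub g o h = Start h o × end h o ≢ g × (∀ x → h ~ x → x ≢ o → end h x ≡ g)

      hubOf : ∀ {g} → Special g → ∃₂ λ h o → IsHub g o h
      hubOf {g} sp
        with any? (λ w → any? (λ v → start? w v ×-dec ¬? (end w v ≟ g) ×-dec
               all? (λ x → (x ∈? N w) →-dec ¬? (x ≟ v) →-dec (end w x ≟ g))))
      ... | yes (w , v , hub) = w , v , hub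
      ... | no none = let h , sph , h≢g = two g in
        contradiction (anchored-special (ind closed g (anchored-self sp) h) sph) h≢g
        where
        closed : Closed (Anchored g)
        closed {w} {v} w~v others with special? w
        ... | no ¬sp = let x , w~x , x≢v = other w~v in anchored-spread ¬sp w~x w~v (others x w~x x≢v)
        ... | yes spw = subst (λ e → Anchored e v) end≡g (end⇒anchored spw w~v)
          where
          end≡g : end w v ≡ g
          end≡g = decidable-stable (end w v ≟ g) λ end≢g → none (w , v , (spw , w~v) , end≢g ,
            λ x w~x x≢v → anchored⇒end (others x w~x x≢v) spw w~x)

      avoid₂ : ∀ {w} → Special w → ∀ u v → ∃[ x ] w ~ x × x ≢ u × x ≢ v
      avoid₂ sp u v with a , b , a≢b , (w~a , a≢u) , (w~b , b≢u) ← high sp u with a ≟ v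
      ... | no a≢v   = a , w~a , a≢u , a≢v
      ... | yes refl = b , w~b , b≢u , ≢-sym a≢b

      hub-injective : ∀ {g g′ o o′ h} → IsHub g o h → IsHub g′ o′ h → g ≡ g′
      hub-injective {o = o} {o′} ((sp , _) , _ , all) (_ , _ , all′)
        with x , h~x , x≢o , x≢o′ ← avoid₂ sp o o′ = trans (sym (all x h~x x≢o)) (all′ x h~x x≢o′)

      private
        -- Extends the passage to a hub by the identity on low vertices. This gives an injection of
        -- all of `Fin n`, so finiteness makes every special vertex a hub.
        HubOrSelf : Fin n → Fin n → Set
        HubOrSelf g h = (Special g → ∃[ o ] IsHub g o h) × (¬ Special g → h ≡ g)

        hubs : ∀ g → ∃[ h ] HubOrSelf g h
        hubs g with special? g
        ... | yes sp = let h , o , hub = hubOf sp in h , (λ _ → o , hub) , λ ¬sp → contradiction sp ¬sp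
        ... | no ¬sp = g , (λ sp → contradiction sp ¬sp) , λ _ → refl

        hub-special : ∀ {g h} → HubOrSelf g h → Special g → Special h
        hub-special (is-hub , _) sp = proj₁ (proj₁ (proj₂ (is-hub sp)))

        hubOrSelf-injective : ∀ {g g′ h} → HubOrSelf g h → HubOrSelf g′ h →
                              Dec (Special g) → Dec (Special g′) → g ≡ g′
        hubOrSelf-injective (f , _) (f′ , _) (yes sp) (yes sp′) =
          hub-injective (proj₂ (f sp)) (proj₂ (f′ sp′))
        hubOrSelf-injective d (_ , self′) (yes sp) (no ¬sp′) =
          contradiction (subst Special (self′ ¬sp′) (hub-special d sp)) ¬sp′
        hubOrSelf-injective (_ , self) d′ (no ¬sp) (yes sp′) =
          contradiction (subst Special (self ¬sp) (hub-special d′ sp′)) ¬sp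
        hubOrSelf-injective (_ , self) (_ , self′) (no ¬sp) (no ¬sp′) =
          trans (sym (self ¬sp)) (self′ ¬sp′)

        hubs-injective : ∀ {g g′} → proj₁ (hubs g) ≡ proj₁ (hubs g′) → g ≡ g′
        hubs-injective {g} {g′} eq = hubOrSelf-injective
          (subst (HubOrSelf g) eq (proj₂ (hubs g))) (proj₂ (hubs g′)) (special? g) (special? g′)

        mates : ∀ h → ∃[ g ] ∃[ o ] (Special h → IsHub g o h)
        mates h with special? h
        ... | no ¬sp = h , h , λ sp → contradiction sp ¬sp
        ... | yes sp with g , eq ← injective⇒surjective {f = proj₁ ∘ hubs} hubs-injective h =
          from (subst (HubOrSelf g) eq (proj₂ (hubs g))) (special? g)
          where
          from : HubOrSelf g h → Dec (Special g) → ∃[ g ] ∃[ o ] (Special h → IsHub g o h)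
          from (f , _)    (yes spg) = let o , hub = f spg in g , o , λ _ → hub
          from (_ , self) (no ¬spg) = contradiction (subst Special (self ¬spg) sp) ¬spg

      opaque
        mate out : Fin n → Fin n
        mate h = proj₁ (mates h)
        out  h = proj₁ (proj₂ (mates h))

        hub : ∀ {h} → Special h → IsHub (mate h) (out h) h
        hub {h} = proj₂ (proj₂ (mates h))

      across : Fin n → Fin n
      across h = end h (out h)

      module _ {h} (sp : Special h) where

        out-start : Start h (out h)
        out-start = proj₁ (hub sp)

        across≢mate : across h ≢ mate h
        across≢mate = proj₁ (proj₂ (hub sp))

        end-mate : ∀ {x} → h ~ x → x ≢ out h → end h x ≡ mate h
        end-mate {x} = proj₂ (proj₂ (hub sp)) x

        across-special : Special (across h)
        across-special = proj₁ (end-start out-start)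

        mate-special : Special (mate h)
        mate-special with x , h~x , x≢o , _ ← avoid₂ sp (out h) (out h) =
          subst Special (end-mate h~x x≢o) (proj₁ (end-start (sp , h~x)))

      mate-mate-through : ∀ {h x} → Special h → h ~ x → x ≢ out h → last h x ≢ out (mate h) →
                          mate (mate h) ≡ h
      mate-mate-through {h} {x} sp h~x x≢o l≢ =
        let st = subst (λ g → Start g (last h x)) (end-mate sp h~x x≢o) (end-start (sp , h~x)) in
        trans (sym (end-mate (proj₁ st) (proj₂ st) l≢))
          (trans (cong (λ g → end g (last h x)) (sym (end-mate sp h~x x≢o))) (end-end (sp , h~x)))

      mate-mate : ∀ {h} → Special h → mate (mate h) ≡ h
      mate-mate {h} sp
        with a , b , a≢b , (h~a , a≢o) , (h~b , b≢o) ← high sp (out h)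
        with last h a ≟ out (mate h) | last h b ≟ out (mate h)
      ... | no la≢  | _       = mate-mate-through sp h~a a≢o la≢
      -- Both threads would enter `mate h` through the same neighbour; read backwards they would
      -- leave `h` through the same one.
      ... | yes la≡ | yes lb≡ = contradiction
        (trans (sym (last-end (sp , h~a)))
          (trans (cong₂ last (trans (end-mate sp h~a a≢o) (sym (end-mate sp h~b b≢o)))
                             (trans la≡ (sym lb≡)))
                 (last-end (sp , h~b)))) a≢b
      ... | yes _   | no lb≢  = mate-mate-through sp h~b b≢o lb≢

      -- The exceptional thread of `h` is also that of the vertex it reaches. Otherwise it would
      -- lead from `across h` to its mate, so `h` would be the mate of `across h`, contrary to
      -- `across≢mate`.
      last-out : ∀ {h} → Special h → last h (out h) ≡ out (across h)
      last-out {h} sp = decidable-stable (last h (out h) ≟ out (across h)) λ l≢ →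
        let mate-across : mate (across h) ≡ h
            mate-across = trans (sym (end-mate (across-special sp) (proj₂ (end-start (out-start sp))) l≢))
                                (end-end (out-start sp))
        in across≢mate sp (trans (sym (mate-mate (across-special sp))) (cong mate mate-across))

      across-across : ∀ {h} → Special h → across (across h) ≡ h
      across-across {h} sp = trans (cong (end (across h)) (sym (last-out sp))) (end-end (out-start sp))

      -- If the exceptional thread were a loop, `last-out` would identify its first and last inner
      -- vertices.
      across≢self : ∀ {h} → Special h → across h ≢ h
      across≢self {h} sp eq =
        loop-first≢last (out-start sp) eq (trans (cong out (sym eq)) (sym (last-out sp)))

      -- If no special vertex were its own mate, mate and across would be fixed
      -- point free involutions, and the orbit of h under across ∘ mate would never
      -- reach mate h; but the vertices anchored in such an orbit are all vertices.
      private
        turnOn : Fin n → Fin n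
        turnOn h = across (mate h)

        iter : ℕ → Fin n → Fin n
        iter zero    h = h
        iter (suc i) h = turnOn (iter i h)

        iter-shift : ∀ i h → iter (suc i) h ≡ iter i (turnOn h)
        iter-shift zero    h = refl
        iter-shift (suc i) h = cong turnOn (iter-shift i h)

        turnOn-special : ∀ {h} → Special h → Special (turnOn h)
        turnOn-special sp = across-special (mate-special sp)

        iter-special : ∀ i {h} → Special h → Special (iter i h)
        iter-special zero    sp = sp
        iter-special (suc i) sp = turnOn-special (iter-special i sp)

        module _ (free : ∀ {u} → Special u → mate u ≢ u) where

          -- A reflection argument: because both maps are involutions, `iter (2 + i) h ≡ mate h` can
          -- be stripped of one `turnOn` at either end. The index drops by two, until `mate` or
          -- `across` has a fixed point.
          iter≢mate : ∀ i {h} → Special h → iter i h ≢ mate h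
          iter≢mate zero          sp eq = free sp (sym eq)
          iter≢mate (suc zero)    sp eq = across≢self (mate-special sp) eq
          iter≢mate (suc (suc i)) {h} sp eq = iter≢mate i (turnOn-special sp)
            (trans (sym (mate-mate spz)) (cong mate
              (trans (sym (across-across (mate-special spz))) (cong across eq′))))
            where
            spz : Special (iter i (turnOn h))
            spz = iter-special i (turnOn-special sp)
            eq′ : turnOn (iter i (turnOn h)) ≡ mate h
            eq′ = trans (cong turnOn (sym (iter-shift i h))) eq

          free-absurd : ∀ {h} → Special h → ⊥
          free-absurd {h} sp =
            let i , A = ind closed h (0 , anchored-self sp) (mate h)
            in iter≢mate i sp (sym (anchored-special A (mate-special sp)))
            where
            Reached : Fin n → Set
            Reached v = ∃[ i ] Anchored (iter i h) v
            closed : Closed Reached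
            closed {w} {v} w~v others with special? w
            ... | no ¬sp = let x , w~x , x≢v = other w~v ; i , A = others x w~x x≢v in
              i , anchored-spread ¬sp w~x w~v A
            ... | yes spw with v ≟ out w
            ...   | no v≢o with x , w~x , x≢v , x≢o ← avoid₂ spw v (out w) with i , A ← others x w~x x≢v =
              i , subst (λ e → Anchored e v)
                    (trans (end-mate spw w~v v≢o)
                      (trans (sym (end-mate spw w~x x≢o)) (anchored⇒end A spw w~x)))
                    (end⇒anchored spw w~v)
            -- Since `x` is not `out w`, it leads to `mate w`, which is thus the orbit element at
            -- `i`. The thread through `out w` leads to `across w`, that is `turnOn (mate w)`, the
            -- next orbit element.
            ...   | yes refl with x , w~x , x≢v , _ ← avoid₂ spw v v with i , A ← others x w~x x≢v =
              suc i , subst (λ e → Anchored e v)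
                        (trans (cong across (sym (mate-mate spw)))
                          (cong turnOn (trans (sym (end-mate spw w~x x≢v)) (anchored⇒end A spw w~x))))
                        (end⇒anchored spw w~v)

      selfMate : ∀ {h} → Special h → ∃[ u ] Special u × mate u ≡ u
      selfMate sp with any? (λ u → special? u ×-dec (mate u ≟ u))
      ... | yes found = found
      ... | no none = ⊥-elim (free-absurd (λ spu eq → none (_ , spu , eq)) sp)

    ∈-route : ∀ {h y w} → w ∈ route h y → w ≡ h ⊎ w ∈ trail h y ⊎ w ≡ end h y
    ∈-route (here w≡h) = inj₁ w≡h
    ∈-route {h} {y} (there w∈) = inj₂ (∈-∷ʳ⁻ (trail h y) w∈)

    end∈route : ∀ {h y} → end h y ∈ route h y
    end∈route {h} {y} = there (∈-++⁺ʳ (trail h y) (here refl))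

    route-unique : ∀ {h y} → Start h y → h ≢ end h y → Unique (route h y)
    route-unique st h≢end = ∉∧unique⇒unique-∷
      (λ h∈ → case ∈-∷ʳ⁻ (trail _ _) h∈ of λ where
        (inj₁ h∈t) → trail-low st h∈t (proj₁ st)
        (inj₂ h≡)  → h≢end h≡)
      (unique-∷ʳ (trail-unique st) (λ e∈ → trail-low st e∈ (proj₁ (end-start st))))

    loopInners-end : ∀ {c w} → w ∈ loopInners c → ∃[ y ] y ∈ loops c × Start c y × end c y ≡ c × w ∈ trail c y
    loopInners-end {c} w∈ = let y , y∈ , w∈y = ∈-concatMap⇒ (trail c) (loops c) w∈ ; st , loop , _ = ∈-loops y∈ in
      y , y∈ , st , loop , w∈y

    loops-within : ∀ {c t w} → t ∈ map (route c) (loops c) → w ∈ t → w ≡ c ⊎ w ∈ loopInners c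
    loops-within {c} t∈ w∈ with y , y∈ , refl ← ∈-map⁻ (route c) t∈ with ∈-route w∈
    ... | inj₁ w≡c         = inj₁ w≡c
    ... | inj₂ (inj₁ w∈y)  = inj₂ (∈-concat⁺′ w∈y (∈-map⁺ (trail c) y∈))
    ... | inj₂ (inj₂ w≡)   = inj₁ (trans w≡ (proj₁ (proj₂ (∈-loops y∈))))

    loops-covered : ∀ {c w z} → w ∈ loopInners c → w ~ z →
                    Any (_LiesOn_ G (w , z)) (map (route c) (loops c))
    loops-covered {c} w∈ w~z = let y , y∈ , st , _ , w∈y = loopInners-end w∈ in
      lose (∈-map⁺ (route c) y∈) (trail-covered st w∈y w~z)

    centre-covered : ∀ {c z} → Start c z → end c z ≡ c →
                     Any (_LiesOn_ G (c , z)) (map (route c) (loops c))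
    centre-covered {c} st loop = let y , y∈ , lies = loops-cover st loop in
      lose (∈-map⁺ (route c) y∈) lies

    -- Spelling out the dipole

    module Dipole (high : ∀ {w} → Special w → High w) (two : ∀ g → ∃[ h ] Special h × h ≢ g)
                  (degreeTwo : ∀ {x} → ¬ Special x → degree x ≡ 2) where
      open Hubs high two

      evenPath : ∀ {a y} → Start a y → a ≢ end a y → EvenPath G a (end a y)
      evenPath {a} {y} st a≢end = record
        { path = record
          { inner = trail a y ; linked = route-linked st ; simple = route-unique st a≢end }
        ; even = even⇒2∣ (subst (Even ∘ suc)
            (sym (trans (length-++ (trail a y)) (ℕ.+-comm _ 1))) (2+ trail-even st))
        ; degreeTwo = All.tabulate (λ x∈ → degreeTwo (trail-low st x∈))
        }

      -- No orientation is chosen, in contrast to `loops`: when `mate b ≢ b`, a thread to `mate b`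
      -- leaves `b` only once.
      links : Fin n → List (Fin n)
      links b = filter (λ y → start? b y ×-dec (end b y ≟ mate b)) (allFin n)

      ∈-links : ∀ {b y} → y ∈ links b → Start b y × end b y ≡ mate b
      ∈-links {b} y∈ =
        proj₂ (∈-filter⁻ (λ y → start? b y ×-dec (end b y ≟ mate b)) {xs = allFin n} y∈)

      links⁺ : ∀ {b y} → Start b y → end b y ≡ mate b → y ∈ links b
      links⁺ {b} {y} st eq = ∈-filter⁺ (λ y → start? b y ×-dec (end b y ≟ mate b)) (∈-allFin y) (st , eq)

      links-unique : ∀ b → Unique (links b)
      links-unique b = Unique.filter⁺ (λ y → start? b y ×-dec (end b y ≟ mate b)) (Unique.allFin⁺ n)

      linkInners : Fin n → List (Fin n)
      linkInners b = concat (map (trail b) (links b))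

      linkRoutes : Fin n → List (List (Fin n))
      linkRoutes b = map (route b) (links b)

      linkInners-end : ∀ {b w} → w ∈ linkInners b →
                       ∃[ y ] y ∈ links b × Start b y × end b y ≡ mate b × w ∈ trail b y
      linkInners-end {b} w∈ = let y , y∈ , w∈y = ∈-concatMap⇒ (trail b) (links b) w∈ ; st , eq = ∈-links y∈ in
        y , y∈ , st , eq , w∈y

      linkInners-low : ∀ {b w} → w ∈ linkInners b → ¬ Special w
      linkInners-low w∈ = let y , y∈ , st , _ , w∈y = linkInners-end w∈ in trail-low st w∈y

      linkInners-unique : ∀ {b} → mate b ≢ b → Unique (linkInners b)
      linkInners-unique {b} m≢b = unique-concatMap (trail b) (links-unique b)
        (λ y∈ → trail-unique (proj₁ (∈-links y∈)))
        λ y∈ y′∈ y≢y′ (x∈ , x∈′) → let st , _ = ∈-links y∈ ; st′ , eq′ = ∈-links y′∈ in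
          case trail-crossing st st′ x∈ x∈′ of λ where
            (inj₁ (_ , y≡y′)) → y≢y′ y≡y′
            (inj₂ (b≡ , _))   → m≢b (sym (trans b≡ eq′))

      links-within : ∀ {b t w} → t ∈ linkRoutes b → w ∈ t → w ≡ b ⊎ w ∈ linkInners b ⊎ w ≡ mate b
      links-within {b} t∈ w∈ with y , y∈ , refl ← ∈-map⁻ (route b) t∈ with ∈-route w∈
      ... | inj₁ w≡b         = inj₁ w≡b
      ... | inj₂ (inj₁ w∈y)  = inj₂ (inj₁ (∈-concat⁺′ w∈y (∈-map⁺ (trail b) y∈)))
      ... | inj₂ (inj₂ w≡)   = inj₂ (inj₂ (trans w≡ (proj₂ (∈-links y∈))))

      links-covered : ∀ {b w z} → w ∈ linkInners b → w ~ z → Any (_LiesOn_ G (w , z)) (linkRoutes b)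
      links-covered {b} w∈ w~z = let y , y∈ , st , _ , w∈y = linkInners-end w∈ in
        lose (∈-map⁺ (route b) y∈) (trail-covered st w∈y w~z)

      links-covered-start : ∀ {b z} → Special b → b ~ z → z ≢ out b → Any (_LiesOn_ G (b , z)) (linkRoutes b)
      links-covered-start {b} sp b~z z≢o =
        lose (∈-map⁺ (route b) (links⁺ (sp , b~z) (end-mate sp b~z z≢o))) (first-on-route (sp , b~z))

      links-covered-end : ∀ {b z} → Special b → mate b ~ z → z ≢ out (mate b) →
                          Any (_LiesOn_ G (mate b , z)) (linkRoutes b)
      links-covered-end {b} {z} sp c~z z≢o =
        lose (∈-map⁺ (route b) (links⁺ st end≡)) (subst (λ e → _LiesOn_ G e (route b y))
          (cong₂ _,_ end≡ (trans (cong (λ g → last g y) (sym c-end)) (last-end st₀))) (last-on-route st))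
        where
        y : Fin n
        y = last (mate b) z
        st₀ : Start (mate b) z
        st₀ = mate-special sp , c~z
        c-end : end (mate b) z ≡ b
        c-end = trans (end-mate (mate-special sp) c~z z≢o) (mate-mate sp)
        st : Start b y
        st = subst (λ g → Start g y) c-end (end-start st₀)
        end≡ : end b y ≡ mate b
        end≡ = trans (cong (λ g → end g y) (sym c-end)) (end-end st₀)

      multiPath : ∀ {b} → Special b → mate b ≢ b →
                  ∃[ M ] MultiPath.inners {G = G} {b} {mate b} M ≡ linkInners b × MultiPath.traces M ≡ linkRoutes b
      multiPath {b} sp m≢b = record
        { paths = proj₁ Ps
        ; multiple = subst (2 ≤_) (sym (lengths-agree inners≡)) multiple
        ; distinct = subst Unique (sym inners≡) (unique-map-on (trail b) (links-unique b)
            λ y∈ y′∈ → let st , eq = ∈-links y∈ ; st′ , eq′ = ∈-links y′∈ in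
              trail-injective st st′ (trans eq (sym eq′)))
        } , cong concat inners≡ , proj₂ (proj₂ Ps)
        where
        pathTo : ∀ {y c} → Start b y → end b y ≡ c → c ≢ b →
                 ∃[ P ] EvenPath.inner {G = G} {b} {c} P ≡ trail b y × EvenPath.trace P ≡ route b y
        pathTo st refl c≢b = evenPath st (≢-sym c≢b) , refl , refl
        Ps = gather EvenPath.inner EvenPath.trace (links b)
          (λ y∈ → let st , eq = ∈-links y∈ in pathTo st eq m≢b)
        inners≡ = proj₁ (proj₂ Ps)
        multiple : 2 ≤ length (links b)
        multiple with x , y , x≢y , (b~x , x≢o) , (b~y , y≢o) ← high sp (out b) =
          unique-⊆⇒length≤ ((x≢y ∷ []) ∷ ([] ∷ []))
            λ { (here refl) → links⁺ (sp , b~x) (end-mate sp b~x x≢o)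
              ; (there (here refl)) → links⁺ (sp , b~y) (end-mate sp b~y y≢o) }

      bouquetAt : ∀ {c} → Special c → mate c ≡ c →
                  ∃[ B ] Bouquet.inners {G = G} {c} B ≡ loopInners c × Bouquet.traces B ≡ map (route c) (loops c)
      bouquetAt {c} sp self = record
        { cycles = proj₁ Cs
        ; nonempty = subst (1 ≤_) (sym (lengths-agree inners≡)) nonempty
        ; degreeTwo = All.tabulate λ {C} C∈ → All.tabulate λ x∈ → degreeTwo (loopInners-low {c}
            (∈-concat⁺′ x∈ (subst (OddCycle.inner C ∈_) inners≡ (∈-map⁺ OddCycle.inner C∈))))
        } , cong concat inners≡ , proj₂ (proj₂ Cs)
        where
        Cs = loopCycles c
        inners≡ = proj₁ (proj₂ Cs)
        nonempty : 1 ≤ length (loops c)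
        nonempty with x , c~x , x≢o , _ ← avoid₂ sp (out c) (out c) =
          ∈-length (proj₁ (proj₂ (loops-cover (sp , c~x) (trans (end-mate sp c~x x≢o) self))))

      -- The part of a dipole from x onwards, all of it new with respect to the
      -- special vertices L met before x.
      record Tail (x : Fin n) (L : List (Fin n)) : Set where
        field
          v         : Fin n
          special   : Special v
          self      : mate v ≡ v
          link      : Alternating G x v
          vs        : List (Fin n)
          ts        : List (List (Fin n))
          vs≡       : vertices G link ++ loopInners v ≡ vs
          ts≡       : segments G link ++ map (route v) (loops v) ≡ ts
          unique    : Unique vs
          head∈     : x ∈ vs
          covers    : ∀ {w z} → w ∈ vs → w ≢ x → w ~ z → Any (_LiesOn_ G (w , z)) ts
          -- `covers` leaves out `x`, whose other edges belong to the part before `x`; only its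
          -- exceptional thread starts here.
          coversOut : Any (_LiesOn_ G (x , out x)) ts
          within    : ∀ {t w} → t ∈ ts → w ∈ t → w ∈ vs
          fresh     : ∀ {w} → w ∈ vs → Special w → w ≡ x ⊎ w ∉ x ∷ L
          -- Inner vertices are kept apart through the ends of their threads: by `crossing-ends`,
          -- threads that share an inner vertex share their ends, and here one end is new.
          freshEnds : ∀ {w} → w ∈ vs → ¬ Special w → ∃₂ λ h y →
                      Start h y × w ∈ trail h y × end h y ∉ x ∷ L × (h ≡ x ⊎ h ∉ x ∷ L)

      module _ {x L} (sp : Special x) (new : across x ∉ x ∷ L) where

        private
          b : Fin n
          b = across x
          spb : Special b
          spb = across-special sp
          st : Start x (out x)
          st = out-start sp
          x≢b : x ≢ b
          x≢b = ≢-sym (across≢self sp)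
          first : List (Fin n)
          first = route x (out x)
          back-on-first : _LiesOn_ G (b , out b) first
          back-on-first = subst (λ z → _LiesOn_ G (b , z) first) (last-out sp) (last-on-route st)

        lastSegment : mate b ≡ b → Tail x L
        lastSegment self = record
          { v = b ; special = spb ; self = self ; link = single (evenPath st x≢b)
          ; vs = vs′ ; ts = ts′ ; vs≡ = refl ; ts≡ = refl
          ; unique = Unique.++⁺ (route-unique st x≢b) (loopInners-unique b) disjoint
          ; head∈ = here refl
          ; covers = covers
          ; coversOut = here (first-on-route st)
          ; within = within
          ; fresh = fresh
          ; freshEnds = freshEnds }
          where
          vs′ : List (Fin n)
          vs′ = first ++ loopInners b
          ts′ : List (List (Fin n))
          ts′ = first ∷ map (route b) (loops b)
          disjoint : Disjoint first (loopInners b)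
          disjoint (w∈ , w∈′) with ∈-route w∈
          ... | inj₁ refl        = loopInners-low {b} w∈′ sp
          ... | inj₂ (inj₂ refl) = loopInners-low {b} w∈′ spb
          ... | inj₂ (inj₁ w∈t) with _ , _ , st′ , loop , w∈y ← loopInners-end w∈′
            with crossing-ends st st′ w∈t w∈y
          ...   | inj₁ (x≡b , _) = x≢b x≡b
          ...   | inj₂ (x≡ , _)  = x≢b (trans x≡ loop)
          covers : ∀ {w z} → w ∈ vs′ → w ≢ x → w ~ z → Any (_LiesOn_ G (w , z)) ts′
          covers {w} {z} w∈ w≢x w~z with ∈-++⁻ first w∈
          ... | inj₂ w∈l = there (loops-covered w∈l w~z)
          ... | inj₁ w∈r with ∈-route w∈r
          ...   | inj₁ w≡x        = contradiction w≡x w≢x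
          ...   | inj₂ (inj₁ w∈t) = here (trail-covered st w∈t w~z)
          ...   | inj₂ (inj₂ refl) with z ≟ out b
          ...     | yes refl = here back-on-first
          ...     | no z≢o   = there (centre-covered (spb , w~z) (trans (end-mate spb w~z z≢o) self))
          within : ∀ {t w} → t ∈ ts′ → w ∈ t → w ∈ vs′
          within (here refl) w∈ = ∈-++⁺ˡ w∈
          within (there t∈) w∈ with loops-within t∈ w∈
          ... | inj₁ refl = ∈-++⁺ˡ (end∈route {x} {out x})
          ... | inj₂ w∈l  = ∈-++⁺ʳ first w∈l
          fresh : ∀ {w} → w ∈ vs′ → Special w → w ≡ x ⊎ w ∉ x ∷ L
          fresh w∈ spw with ∈-++⁻ first w∈
          ... | inj₂ w∈l = contradiction spw (loopInners-low {b} w∈l)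
          ... | inj₁ w∈r with ∈-route w∈r
          ...   | inj₁ w≡x         = inj₁ w≡x
          ...   | inj₂ (inj₁ w∈t)  = contradiction spw (trail-low st w∈t)
          ...   | inj₂ (inj₂ refl) = inj₂ new
          freshEnds : ∀ {w} → w ∈ vs′ → ¬ Special w → ∃₂ λ h y →
                      Start h y × w ∈ trail h y × end h y ∉ x ∷ L × (h ≡ x ⊎ h ∉ x ∷ L)
          freshEnds w∈ ¬spw with ∈-++⁻ first w∈
          ... | inj₂ w∈l = let y , _ , st′ , loop , w∈y = loopInners-end w∈l in
            b , y , st′ , w∈y , subst (_∉ x ∷ L) (sym loop) new , inj₂ new
          ... | inj₁ w∈r with ∈-route w∈r
          ...   | inj₁ refl        = contradiction sp ¬spw
          ...   | inj₂ (inj₁ w∈t)  = x , out x , st , w∈t , new , inj₁ refl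
          ...   | inj₂ (inj₂ refl) = contradiction spb ¬spw

        furtherSegment : mate b ≢ b → mate b ∉ b ∷ x ∷ L → Tail (mate b) (b ∷ x ∷ L) → Tail x L
        furtherSegment m≢b c∉ tail = record
          { v = v ; special = special ; self = self ; link = evenPath st x≢b ▸ proj₁ M ▸ link
          ; vs = vs′ ; ts = ts′
          ; vs≡ = trans (++-assoc first (MultiPath.inners (proj₁ M) ++ vertices G link) (loopInners v))
                    (cong (first ++_) (trans (++-assoc (MultiPath.inners (proj₁ M)) (vertices G link) _)
                      (cong₂ _++_ (proj₁ (proj₂ M)) vs≡)))
          ; ts≡ = cong (first ∷_) (trans (++-assoc (MultiPath.traces (proj₁ M)) (segments G link) _)
                    (cong₂ _++_ (proj₂ (proj₂ M)) ts≡))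
          ; unique = Unique.++⁺ (route-unique st x≢b)
              (Unique.++⁺ (linkInners-unique m≢b) unique disjointL)
              λ (w∈ , w∈′) → case ∈-++⁻ (linkInners b) w∈′ of λ where
                (inj₁ w∈l) → disjointP w∈ w∈l
                (inj₂ w∈v) → disjointT w∈ w∈v
          ; head∈ = here refl
          ; covers = covers′
          ; coversOut = here (first-on-route st)
          ; within = within′
          ; fresh = fresh′
          ; freshEnds = freshEnds′ }
          where
          open Tail tail
          c : Fin n
          c = mate b
          M = multiPath spb m≢b
          vs′ : List (Fin n)
          vs′ = first ++ linkInners b ++ vs
          ts′ : List (List (Fin n))
          ts′ = first ∷ linkRoutes b ++ ts
          c∉xL : c ∉ x ∷ L
          c∉xL = c∉ ∘ there
          old : ∀ {w} → w ∈ vs → w ∈ b ∷ x ∷ L → ¬ Special w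
          old w∈ w∈L spw with fresh w∈ spw
          ... | inj₁ refl = c∉ w∈L
          ... | inj₂ w∉   = w∉ (there w∈L)
          old-end : ∀ {w h y} → w ∈ vs → Start h y → w ∈ trail h y → end h y ∈ c ∷ b ∷ x ∷ L →
                    h ∈ c ∷ b ∷ x ∷ L → ⊥
          old-end w∈ sth w∈t e∈ h∈
            with h′ , y′ , st′ , w∈t′ , e∉ , _ ← freshEnds w∈ (trail-low sth w∈t)
            with crossing-ends sth st′ w∈t w∈t′
          ... | inj₁ (_ , e≡) = e∉ (subst (_∈ _) e≡ e∈)
          ... | inj₂ (h≡ , _) = e∉ (subst (_∈ _) h≡ h∈)
          disjointP : ∀ {w} → w ∈ first → w ∈ linkInners b → ⊥
          disjointP w∈ w∈l with ∈-route w∈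
          ... | inj₁ refl        = linkInners-low {b} w∈l sp
          ... | inj₂ (inj₂ refl) = linkInners-low {b} w∈l spb
          ... | inj₂ (inj₁ w∈t) with _ , _ , st′ , e≡ , w∈y ← linkInners-end w∈l
            with crossing-ends st st′ w∈t w∈y
          ...   | inj₁ (x≡b , _) = x≢b x≡b
          ...   | inj₂ (x≡ , _)  = c∉xL (here (sym (trans x≡ e≡)))
          disjointT : ∀ {w} → w ∈ first → w ∈ vs → ⊥
          disjointT w∈ w∈v with ∈-route w∈
          ... | inj₁ refl        = old w∈v (there (here refl)) sp
          ... | inj₂ (inj₂ refl) = old w∈v (here refl) spb
          ... | inj₂ (inj₁ w∈t)  = old-end w∈v st w∈t (there (here refl)) (there (there (here refl)))
          disjointL : Disjoint (linkInners b) vs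
          disjointL (w∈l , w∈v) with _ , _ , st′ , e≡ , w∈y ← linkInners-end w∈l =
            old-end w∈v st′ w∈y (here e≡) (there (here refl))
          covers′ : ∀ {w z} → w ∈ vs′ → w ≢ x → w ~ z → Any (_LiesOn_ G (w , z)) ts′
          covers′ {w} {z} w∈ w≢x w~z with ∈-++⁻ first w∈
          ... | inj₁ w∈r with ∈-route w∈r
          ...   | inj₁ w≡x        = contradiction w≡x w≢x
          ...   | inj₂ (inj₁ w∈t) = here (trail-covered st w∈t w~z)
          ...   | inj₂ (inj₂ refl) with z ≟ out b
          ...     | yes refl = here back-on-first
          ...     | no z≢o   = there (Any-++⁺ˡ (links-covered-start spb w~z z≢o))
          covers′ {w} {z} w∈ w≢x w~z | inj₂ w∈′ with ∈-++⁻ (linkInners b) w∈′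
          ... | inj₁ w∈l = there (Any-++⁺ˡ (links-covered w∈l w~z))
          ... | inj₂ w∈v with w ≟ c
          ...   | no w≢c = there (Any-++⁺ʳ (linkRoutes b) (covers w∈v w≢c w~z))
          ...   | yes refl with z ≟ out c
          ...     | yes refl = there (Any-++⁺ʳ (linkRoutes b) coversOut)
          ...     | no z≢o   = there (Any-++⁺ˡ (links-covered-end spb w~z z≢o))
          within′ : ∀ {t w} → t ∈ ts′ → w ∈ t → w ∈ vs′
          within′ (here refl) w∈ = ∈-++⁺ˡ w∈
          within′ (there t∈) w∈ with ∈-++⁻ (linkRoutes b) t∈
          ... | inj₂ t∈ts = ∈-++⁺ʳ first (∈-++⁺ʳ (linkInners b) (within t∈ts w∈))
          ... | inj₁ t∈ls with links-within t∈ls w∈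
          ...   | inj₁ refl        = ∈-++⁺ˡ (end∈route {x} {out x})
          ...   | inj₂ (inj₁ w∈l)  = ∈-++⁺ʳ first (∈-++⁺ˡ w∈l)
          ...   | inj₂ (inj₂ refl) = ∈-++⁺ʳ first (∈-++⁺ʳ (linkInners b) head∈)
          fresh′ : ∀ {w} → w ∈ vs′ → Special w → w ≡ x ⊎ w ∉ x ∷ L
          fresh′ w∈ spw with ∈-++⁻ first w∈
          ... | inj₁ w∈r with ∈-route w∈r
          ...   | inj₁ w≡x         = inj₁ w≡x
          ...   | inj₂ (inj₁ w∈t)  = contradiction spw (trail-low st w∈t)
          ...   | inj₂ (inj₂ refl) = inj₂ new
          fresh′ w∈ spw | inj₂ w∈′ with ∈-++⁻ (linkInners b) w∈′
          ... | inj₁ w∈l = contradiction spw (linkInners-low {b} w∈l)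
          ... | inj₂ w∈v = inj₂ λ w∈xL → old w∈v (there w∈xL) spw
          freshEnds′ : ∀ {w} → w ∈ vs′ → ¬ Special w → ∃₂ λ h y →
                       Start h y × w ∈ trail h y × end h y ∉ x ∷ L × (h ≡ x ⊎ h ∉ x ∷ L)
          freshEnds′ w∈ ¬spw with ∈-++⁻ first w∈
          ... | inj₁ w∈r with ∈-route w∈r
          ...   | inj₁ refl        = contradiction sp ¬spw
          ...   | inj₂ (inj₁ w∈t)  = x , out x , st , w∈t , new , inj₁ refl
          ...   | inj₂ (inj₂ refl) = contradiction spb ¬spw
          freshEnds′ w∈ ¬spw | inj₂ w∈′ with ∈-++⁻ (linkInners b) w∈′
          ... | inj₁ w∈l = let y , _ , st′ , e≡ , w∈y = linkInners-end w∈l in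
            b , y , st′ , w∈y , subst (_∉ x ∷ L) (sym e≡) c∉xL , inj₂ new
          ... | inj₂ w∈v = let h , y , st′ , w∈y , e∉ , h-new = freshEnds w∈v ¬spw in
            h , y , st′ , w∈y , (λ e∈ → e∉ (there (there e∈))) , inj₂ (λ h∈ → case h-new of λ where
              (inj₁ h≡c) → c∉xL (subst (_∈ x ∷ L) h≡c h∈)
              (inj₂ h∉)  → h∉ (there (there h∈)))

      -- `L` is invariant under `across`, and `x ∷ L` under `mate`. As both are involutions,
      -- `across x` is new, and then its mate is itself or new again. So `L` grows without
      -- repetition and the recursion stops within `Fin n`.
      build : ∀ fuel {x L} → n < fuel + length (x ∷ L) → Unique (x ∷ L) → Special x →
              (∀ {w} → w ∈ x ∷ L → Special w × mate w ∈ x ∷ L) → (∀ {w} → w ∈ L → across w ∈ L) →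
              Tail x L
      build zero bound u _ _ _ = contradiction (unique⇒length≤n u) (ℕ.<⇒≱ bound)
      build (suc fuel) {x} {L} bound u sp mateClosed acrossClosed = go (mate b ≟ b)
        where
        b : Fin n
        b = across x
        spb : Special b
        spb = across-special sp
        new : b ∉ x ∷ L
        new (here eq)  = across≢self sp eq
        new (there b∈) = unique-∷⇒∉ u (subst (_∈ L) (across-across sp) (acrossClosed b∈))
        go : Dec (mate b ≡ b) → Tail x L
        go (yes self) = lastSegment sp new self
        go (no m≢b) = furtherSegment sp new m≢b c∉ (build fuel
          (ℕ.≤-trans bound (ℕ.≤-trans (ℕ.≤-reflexive (sym (ℕ.+-suc fuel _)))
            (ℕ.+-monoʳ-≤ fuel (ℕ.n≤1+n _))))
          (∉∧unique⇒unique-∷ c∉ (∉∧unique⇒unique-∷ new u))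
          (mate-special spb)
          (λ { (here refl) → mate-special spb , there (here (mate-mate spb))
             ; (there (here refl)) → spb , here refl
             ; (there (there w∈)) → let spw , m∈ = mateClosed w∈ in spw , there (there m∈) })
          λ { (here refl) → there (here (across-across sp))
            ; (there (here refl)) → here refl
            ; (there (there w∈)) → there (there (acrossClosed w∈)) })
          where
          c∉ : mate b ∉ b ∷ x ∷ L
          c∉ (here eq)  = m≢b eq
          c∉ (there c∈) = new (subst (_∈ x ∷ L) (mate-mate spb) (proj₂ (mateClosed c∈)))

      dipole : ∀ {h} → Special h → DoublyExtendedBouquetDipole G
      dipole sph with u , sp , selfᵘ ← selfMate sph = record
        { u = u ; v = v ; bouquetᵘ = proj₁ Bᵘ ; bouquetᵛ = proj₁ Bᵛ ; link = link
        ; whole = subst₂ (ConsistsOf G)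
            (sym (cong₂ _++_ (proj₁ (proj₂ Bᵘ)) (trans (cong (vertices G link ++_) (proj₁ (proj₂ Bᵛ))) vs≡)))
            (sym (cong₂ _++_ (proj₂ (proj₂ Bᵘ)) (trans (cong (segments G link ++_) (proj₂ (proj₂ Bᵛ))) ts≡)))
            (consistsOf (Unique.++⁺ (loopInners-unique u) unique disjoint) (∈-++⁺ʳ (loopInners u) head∈)
              covers′ within′)
        }
        where
        tail : Tail u []
        tail = build n (ℕ.≤-reflexive (sym (ℕ.+-comm n 1))) ([] ∷ []) sp
          (λ { (here refl) → sp , here selfᵘ }) λ ()
        open Tail tail
        Bᵘ = bouquetAt sp selfᵘ
        Bᵛ = bouquetAt special self
        disjoint : Disjoint (loopInners u) vs
        disjoint (w∈ , w∈v)
          with _ , _ , st , loop , w∈y ← loopInners-end w∈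
          with _ , _ , st′ , w∈y′ , e∉ , _ ← freshEnds w∈v (loopInners-low {u} w∈)
          with crossing-ends st st′ w∈y w∈y′
        ... | inj₁ (_ , e≡) = e∉ (here (trans (sym e≡) loop))
        ... | inj₂ (u≡ , _) = e∉ (here (sym u≡))
        loopTs : List (List (Fin n))
        loopTs = map (route u) (loops u)
        covers′ : ∀ {w z} → w ∈ loopInners u ++ vs → w ~ z → Any (_LiesOn_ G (w , z)) (loopTs ++ ts)
        covers′ {w} {z} w∈ w~z with ∈-++⁻ (loopInners u) w∈
        ... | inj₁ w∈l = Any-++⁺ˡ (loops-covered w∈l w~z)
        ... | inj₂ w∈v with w ≟ u
        ...   | no w≢u = Any-++⁺ʳ loopTs (covers w∈v w≢u w~z)
        ...   | yes refl with z ≟ out u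
        ...     | yes refl = Any-++⁺ʳ loopTs coversOut
        ...     | no z≢o   = Any-++⁺ˡ (centre-covered (sp , w~z) (trans (end-mate sp w~z z≢o) selfᵘ))
        within′ : ∀ {t w} → t ∈ loopTs ++ ts → w ∈ t → w ∈ loopInners u ++ vs
        within′ t∈ w∈ with ∈-++⁻ loopTs t∈
        ... | inj₂ t∈ts = ∈-++⁺ʳ (loopInners u) (within t∈ts w∈)
        ... | inj₁ t∈ls with loops-within t∈ls w∈
        ...   | inj₁ refl = ∈-++⁺ʳ (loopInners u) head∈
        ...   | inj₂ w∈l  = ∈-++⁺ˡ w∈l

-- Degrees in graphs of threshold one

distinctPoints : ∀ {n} → 2 ≤ n → ∃₂ λ (x y : Fin n) → x ≢ y
distinctPoints (s≤s (s≤s z≤n)) = zero , suc zero , λ ()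

module DegreeFacts {n : ℕ} (G : Graph n) where
  open Graph G
  open Forcing G

  distinct⇒≤degree : ∀ {x l} → Unique l → All (x ~_) l → length l ≤ degree x
  distinct⇒≤degree {x} ul x~l = ℕ.≤-trans
    (unique-⊆⇒length≤ ul (λ y∈ → ∈-elements⁺ (All.lookup x~l y∈)))
    (ℕ.≤-reflexive (length-elements (N x)))

  atMostTwo : ∀ {y a b c} → ¬ 3 ≤ degree y → y ~ a → y ~ b → y ~ c → a ≢ b → c ≡ a ⊎ c ≡ b
  atMostTwo {y} {a} {b} {c} low y~a y~b y~c a≢b with c ≟ a | c ≟ b
  ... | yes c≡a | _       = inj₁ c≡a
  ... | no _    | yes c≡b = inj₂ c≡b
  ... | no c≢a  | no c≢b  = contradiction
    (distinct⇒≤degree ((c≢a ∷ c≢b ∷ []) ∷ (a≢b ∷ []) ∷ ([] ∷ [])) (y~c ∷ y~a ∷ y~b ∷ [])) low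

  threeNbrs : ∀ {x} → 3 ≤ degree x → ∀ v → ∃₂ λ a b → a ≢ b × (x ~ a × a ≢ v) × (x ~ b × b ≢ v)
  threeNbrs {x} 3≤ v = choose (elements (N x)) (elements-unique (N x)) (∈-elements⁻ (N x))
    (ℕ.≤-trans 3≤ (ℕ.≤-reflexive (sym (length-elements (N x)))))
    where
    choose : ∀ l → Unique l → (∀ {y} → y ∈ l → x ~ y) → 3 ≤ length l →
             ∃₂ λ a b → a ≢ b × (x ~ a × a ≢ v) × (x ~ b × b ≢ v)
    choose (a ∷ b ∷ c ∷ _) ((a≢b ∷ a≢c ∷ _) ∷ (b≢c ∷ _) ∷ _) x~ _ with a ≟ v | b ≟ v
    ... | yes refl | _        = b , c , b≢c , (x~ (there (here refl)) , ≢-sym a≢b) ,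
                                (x~ (there (there (here refl))) , ≢-sym a≢c)
    ... | no a≢v   | yes refl = a , c , a≢c , (x~ (here refl) , a≢v) ,
                                (x~ (there (there (here refl))) , ≢-sym b≢c)
    ... | no a≢v   | no b≢v   = a , b , a≢b , (x~ (here refl) , a≢v) , (x~ (there (here refl)) , b≢v)
    choose (_ ∷ _ ∷ []) _ _ (s≤s (s≤s ()))
    choose (_ ∷ [])     _ _ (s≤s ())

  module Nondegenerate (2≤n : 2 ≤ n)
    (∅-closed : Closed (λ _ → ⊥)) (ind : ∀ {B} → Closed B → ∀ x → B x → ∀ v → B v) where

    other : ∀ {w v} → w ~ v → ∃[ x ] w ~ x × x ≢ v
    other {w} {v} w~v with any? (λ x → (x ∈? N w) ×-dec ¬? (x ≟ v))
    ... | yes found = found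
    ... | no none   = ⊥-elim (∅-closed w~v (λ x w~x x≢v → none (x , w~x , x≢v)))

    -- An isolated vertex would be a closed set by itself, because whoever forces from it must be
    -- adjacent to it. It would then be the only vertex, but there are two.
    neighbour : ∀ x → ∃[ y ] x ~ y
    neighbour x with any? (λ y → y ∈? N x)
    ... | yes found = found
    ... | no none   = let a , b , a≢b = distinctPoints 2≤n in
      contradiction (trans (all a) (sym (all b))) a≢b
      where
      closed : Closed (_≡ x)
      closed {w} w~v others with y , w~y , y≢v ← other w~v with refl ← others y w~y y≢v =
        contradiction (w , symmetric w~y) none
      all : ∀ v → v ≡ x
      all = ind closed x refl

    degreeTwo : ∀ {x} → ¬ 3 ≤ degree x → degree x ≡ 2
    degreeTwo {x} ¬3≤ with y , x~y ← neighbour x with z , x~z , z≢y ← other x~y =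
      ℕ.≤-antisym (s≤s⁻¹ (ℕ.≰⇒> ¬3≤))
        (distinct⇒≤degree ((z≢y ∷ []) ∷ ([] ∷ [])) (x~z ∷ x~y ∷ []))

thresholdOne⇒cyclic : ∀ {n} (G : Graph n) → 2 ≤ n → Threshold.ThresholdOne G →
                      DoublyExtendedBouquetDipole G ⊎ OddCycleBouquet G
thresholdOne⇒cyclic {n} G 2≤n (∅-closed , ind)
  with any? (λ h → any? (λ k → (3 ≤? degree h) ×-dec (3 ≤? degree k) ×-dec ¬? (h ≟ k)))
  where open Graph G
... | yes (h , k , 3≤h , 3≤k , h≢k) = inj₁ (C.Dipole.dipole threeNbrs two degreeTwo 3≤h)
  where
  open Graph G
  open DegreeFacts G
  open Nondegenerate 2≤n ∅-closed ind
  two : ∀ g → ∃[ x ] 3 ≤ degree x × x ≢ g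
  two g with h ≟ g
  ... | no h≢g   = h , 3≤h , h≢g
  ... | yes refl = k , 3≤k , ≢-sym h≢k
  module C = ThreadTheory.Classes G (λ x → 3 ≤ degree x) (λ x → 3 ≤? degree x) atMostTwo other ind neighbour
               (inj₁ ∘ threeNbrs)
... | no ¬two = inj₂ (bouquetAt (any? (λ x → 3 ≤? degree x)))
  where
  open Graph G
  open DegreeFacts G
  open Nondegenerate 2≤n ∅-closed ind
  bouquetFrom : ∀ c → (∀ {x} → x ≢ c → ¬ 3 ≤ degree x) → OddCycleBouquet G
  bouquetFrom c low = ThreadTheory.Classes.bouquet G (_≡ c) (_≟ c)
    (λ y≢c → atMostTwo (low y≢c)) other ind neighbour (λ { refl → inj₂ id }) refl id
  bouquetAt : Dec (∃[ x ] 3 ≤ degree x) → OddCycleBouquet G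
  bouquetAt (yes (c , 3≤c)) = bouquetFrom c λ x≢c 3≤x → ¬two (_ , c , 3≤x , 3≤c , x≢c)
  bouquetAt (no none)       = bouquetFrom (proj₁ (distinctPoints 2≤n)) λ _ 3≤x → none (_ , 3≤x)

-- Closed predicates on bouquets and dipoles

-- In `a ∷ l ∷ʳ b` the second vertex is `firstOf l b` and the last but one is `lastOf a l`; the
-- defaults cover a path that is a single edge.
firstOf : {A : Set} → List A → A → A
firstOf []      b = b
firstOf (x ∷ _) b = x

lastOf : {A : Set} → A → List A → A
lastOf a []      = a
lastOf a (x ∷ l) = lastOf x l

firstOf∈ : {A : Set} (l : List A) (b : A) → firstOf l b ∈ l ∷ʳ b
firstOf∈ []      b = here refl
firstOf∈ (x ∷ l) b = here refl

firstOf∈⊎≡ : {A : Set} (l : List A) (b : A) → firstOf l b ∈ l ⊎ firstOf l b ≡ b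
firstOf∈⊎≡ []      b = inj₂ refl
firstOf∈⊎≡ (x ∷ l) b = inj₁ (here refl)

lastOf∈ : {A : Set} (a : A) (l : List A) → lastOf a l ∈ a ∷ l
lastOf∈ a []      = here refl
lastOf∈ a (x ∷ l) = there (lastOf∈ x l)

module _ {A : Set} where

  infix-fst∈ : ∀ {w z b : A} (l : List A) → Infix _≡_ (w ∷ z ∷ []) (l ∷ʳ b) → w ∈ l
  infix-fst∈ []      (here (_ ∷ ()))
  infix-fst∈ []      (there (here ()))
  infix-fst∈ (x ∷ l) (here (eq ∷ _)) = here eq
  infix-fst∈ (x ∷ l) (there i)       = there (infix-fst∈ l i)

  infix-snd∈ : ∀ {w z a : A} {l : List A} → Infix _≡_ (w ∷ z ∷ []) (a ∷ l) → z ∈ l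
  infix-snd∈ (here (_ ∷ eq ∷ []))      = here eq
  infix-snd∈ {l = _ ∷ _} (there i)     = there (infix-snd∈ i)
  infix-snd∈ {l = []}    (there (here ()))

  infix-first : ∀ {a z b : A} (l : List A) → a ∉ l → Infix _≡_ (a ∷ z ∷ []) (a ∷ l ∷ʳ b) → z ≡ firstOf l b
  infix-first []      a∉ (here (_ ∷ eq ∷ [])) = eq
  infix-first (x ∷ l) a∉ (here (_ ∷ eq ∷ [])) = eq
  infix-first l       a∉ (there i)            = contradiction (infix-fst∈ l i) a∉

  infix-last : ∀ {z b : A} (a : A) (l : List A) → b ∉ l → Infix _≡_ (z ∷ b ∷ []) (a ∷ l ∷ʳ b) → z ≡ lastOf a l
  infix-last a []      b∉ (here (eq ∷ _))          = eq
  infix-last a []      b∉ (there (here (_ ∷ ())))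
  infix-last a []      b∉ (there (there (here ())))
  infix-last a (x ∷ l) b∉ (here (_ ∷ eq ∷ _))      = contradiction (here eq) b∉
  infix-last a (x ∷ l) b∉ (there i)                = infix-last x l (b∉ ∘ there) i

  infix-succ : ∀ {w z z′ b : A} (l : List A) → Unique l →
               Infix _≡_ (w ∷ z ∷ []) (l ∷ʳ b) → Infix _≡_ (w ∷ z′ ∷ []) (l ∷ʳ b) → z ≡ z′
  infix-succ []          _ (here (_ ∷ ()))
  infix-succ []          _ (there (here ()))
  infix-succ (x ∷ l)     u (here (refl ∷ _)) (there j) = contradiction (infix-fst∈ l j) (unique-∷⇒∉ u)
  infix-succ (x ∷ l)     u (there i) (here (refl ∷ _)) = contradiction (infix-fst∈ l i) (unique-∷⇒∉ u)
  infix-succ (x ∷ l)     u (there i) (there j)         = infix-succ l (AllPairs.tail u) i j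
  infix-succ (x ∷ [])    u (here (_ ∷ refl ∷ _)) (here (_ ∷ refl ∷ _)) = refl
  infix-succ (x ∷ _ ∷ _) u (here (_ ∷ refl ∷ _)) (here (_ ∷ refl ∷ _)) = refl

  infix-pred : ∀ {w z z′ a : A} {l : List A} → Unique l →
               Infix _≡_ (z ∷ w ∷ []) (a ∷ l) → Infix _≡_ (z′ ∷ w ∷ []) (a ∷ l) → z ≡ z′
  infix-pred u (here (eq ∷ _)) (here (eq′ ∷ _)) = trans eq (sym eq′)
  infix-pred u (here (_ ∷ refl ∷ [])) (there j) = contradiction (infix-snd∈ j) (unique-∷⇒∉ u)
  infix-pred u (there i) (here (_ ∷ refl ∷ [])) = contradiction (infix-snd∈ i) (unique-∷⇒∉ u)
  infix-pred {l = _ ∷ _} u (there i) (there j)  = infix-pred (AllPairs.tail u) i j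
  infix-pred {l = []} u (there (here ())) _

  unique-++⁻ : ∀ (xs : List A) {ys} → Unique (xs ++ ys) → Unique xs × Unique ys × Disjoint xs ys
  unique-++⁻ []       u       = [] , u , λ ()
  unique-++⁻ (x ∷ xs) (x∉ ∷ u) with uxs , uys , disj ← unique-++⁻ xs u =
    ∉∧unique⇒unique-∷ (λ x∈ → All.lookup x∉ (∈-++⁺ˡ x∈) refl) uxs , uys , λ where
      (here refl , x∈) → All.lookup x∉ (∈-++⁺ʳ xs x∈) refl
      (there y∈ , y∈′) → disj (y∈ , y∈′)

concatMap-injective : {A B : Set} (f : A → List B) {xs : List A} → Unique (concatMap f xs) →
                      ∀ {x y w} → x ∈ xs → y ∈ xs → w ∈ f x → w ∈ f y → x ≡ y
concatMap-injective f u (here refl) (here refl) _ _ = refl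
concatMap-injective f {x ∷ _} u (here refl) (there y∈) w∈ w∈′ = contradiction
  (w∈ , ∈-concat⁺′ w∈′ (∈-map⁺ f y∈)) (proj₂ (proj₂ (unique-++⁻ (f x) u)))
concatMap-injective f {x ∷ _} u (there x∈) (here refl) w∈ w∈′ = contradiction
  (w∈′ , ∈-concat⁺′ w∈ (∈-map⁺ f x∈)) (proj₂ (proj₂ (unique-++⁻ (f x) u)))
concatMap-injective f {x ∷ _} u (there x∈) (there y∈) w∈ w∈′ =
  concatMap-injective f (proj₁ (proj₂ (unique-++⁻ (f x) u))) x∈ y∈ w∈ w∈′

-- Propagation along even paths and odd cycles

module Chains {n : ℕ} (G : Graph n) where
  open Graph G
  open Forcing G

  AtMostTwo : Fin n → Set
  AtMostTwo w = ∀ {a b c} → w ~ a → w ~ b → w ~ c → a ≢ b → c ≡ a ⊎ c ≡ b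

  TwoNbrs : Fin n → Set
  TwoNbrs w = ∃₂ λ p q → p ≢ q × w ~ p × w ~ q

  -- `front` and `rear` are separate so that `a` and `b` may coincide: an odd cycle is a strand from
  -- its base point to itself.
  record Strand (a : Fin n) (l : List (Fin n)) (b : Fin n) : Set where
    constructor strand
    field
      linked : Linked _~_ (a ∷ l ∷ʳ b)
      front  : Unique (a ∷ l)
      rear   : Unique (l ∷ʳ b)
      even   : Even (length l)
  open Strand using (front; rear)

  link-head : ∀ {a b} l → Linked _~_ (a ∷ l ∷ʳ b) → a ~ firstOf l b
  link-head []      (a~b ∷ _) = a~b
  link-head (x ∷ l) (a~x ∷ _) = a~x

  link-tail : ∀ {a b} l → Linked _~_ (a ∷ l ∷ʳ b) → b ~ lastOf a l
  link-tail []      (a~b ∷ _) = symmetric a~b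
  link-tail (x ∷ l) (_ ∷ lk)  = link-tail l lk

  strand-tail : ∀ {a i j l b} → Strand a (i ∷ j ∷ l) b → Strand j l b
  strand-tail (strand (_ ∷ _ ∷ lk) f r (2+ e)) =
    strand lk (AllPairs.tail (AllPairs.tail f)) (AllPairs.tail (AllPairs.tail r)) e

  head-apart : ∀ {a i j l b} → Strand a (i ∷ j ∷ l) b → a ≢ j × i ≢ firstOf l b
  head-apart {l = l} {b} S = (λ { refl → unique-∷⇒∉ (front S) (there (here refl)) }) ,
    λ eq → unique-∷⇒∉ (rear S) (there (subst (_∈ l ∷ʳ b) (sym eq) (firstOf∈ l b)))

  inner-twoNbrs : ∀ {a b} l → Strand a l b → ∀ {x} → x ∈ l → TwoNbrs x
  inner-twoNbrs (i ∷ [])     (strand _ _ _ ())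
  inner-twoNbrs (i ∷ j ∷ l) S@(strand (a~i ∷ i~j ∷ lk) _ _ _) x∈ with head-apart S | x∈
  ... | a≢j , _ | here refl         = _ , _ , a≢j , symmetric a~i , i~j
  ... | _ , i≢f | there (here refl) = _ , _ , i≢f , symmetric i~j , link-head l lk
  ... | _       | there (there x∈′) = inner-twoNbrs l (strand-tail S) x∈′

  module _ {B : Fin n → Set} (closed : Closed B) where

    pass : ∀ {w a b} → AtMostTwo w → w ~ a → w ~ b → a ≢ b → B a → B b
    pass two w~a w~b a≢b Ba = closed w~b λ x w~x x≢b → case two w~a w~b w~x a≢b of λ where
      (inj₁ refl) → Ba
      (inj₂ refl) → contradiction refl x≢b

    -- The parity classes of a strand: `a` agrees with the last inner vertex and `b` with the first,
    -- crosswise because the number of inner vertices is even. All other inner vertices belong to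
    -- one of the two classes.
    record Chain (a : Fin n) (l : List (Fin n)) (b : Fin n) : Set where
      field
        a⇒last  : B a → B (lastOf a l)
        last⇒a  : B (lastOf a l) → B a
        b⇒first : B b → B (firstOf l b)
        first⇒b : B (firstOf l b) → B b
        spread  : B a → B b → ∀ {x} → x ∈ l → B x
        back    : ∀ {x} → x ∈ l → B x → B a ⊎ B b

    chain : ∀ {a b} l → Strand a l b → All AtMostTwo l → Chain a l b
    chain [] S _ = record
      { a⇒last = id ; last⇒a = id ; b⇒first = id ; first⇒b = id ; spread = λ _ _ () ; back = λ () }
    chain (i ∷ []) (strand _ _ _ ())
    chain {a} {b} (i ∷ j ∷ l) S@(strand (a~i ∷ i~j ∷ lk) _ _ _) (twoᵢ ∷ twoⱼ ∷ two) = record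
      { a⇒last = Rest.a⇒last ∘ a⇒j
      ; last⇒a = j⇒a ∘ Rest.last⇒a
      ; b⇒first = b⇒i
      ; first⇒b = i⇒b
      ; spread = λ Ba Bb → λ { (here refl) → b⇒i Bb ; (there (here refl)) → a⇒j Ba
                             ; (there (there x∈)) → Rest.spread (a⇒j Ba) Bb x∈ }
      ; back = λ { (here refl) Bx → inj₂ (i⇒b Bx) ; (there (here refl)) Bx → inj₁ (j⇒a Bx)
                 ; (there (there x∈)) Bx → [ inj₁ ∘ j⇒a , inj₂ ]′ (Rest.back x∈ Bx) }
      }
      where
      module Rest = Chain (chain l (strand-tail S) two)
      j~f : j ~ firstOf l b
      j~f = link-head l lk
      a⇒j : B a → B j
      a⇒j = pass twoᵢ (symmetric a~i) i~j (proj₁ (head-apart S))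
      j⇒a : B j → B a
      j⇒a = pass twoᵢ i~j (symmetric a~i) (≢-sym (proj₁ (head-apart S)))
      b⇒i : B b → B i
      b⇒i = pass twoⱼ j~f (symmetric i~j) (≢-sym (proj₂ (head-apart S))) ∘ Rest.b⇒first
      i⇒b : B i → B b
      i⇒b = Rest.first⇒b ∘ pass twoⱼ (symmetric i~j) j~f (proj₂ (head-apart S))

  cycle-strand : ∀ {c} (C : OddCycle G c) → Strand c (OddCycle.inner C) c
  cycle-strand {c} C = strand linked simple
    (unique-∷ʳ (AllPairs.tail simple) (unique-∷⇒∉ simple)) even-inner
    where
    open OddCycle C
    even-inner : Even (length inner)
    even-inner with even-or-odd (length inner)
    ... | inj₁ e = e
    ... | inj₂ o = contradiction (even⇒2∣ o) odd

  cycle-ends : ∀ {c} (C : OddCycle G c) →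
               firstOf (OddCycle.inner C) c ≢ lastOf c (OddCycle.inner C)
  cycle-ends C eq with OddCycle.inner C | OddCycle.long C | OddCycle.simple C
  ... | []        | s≤s ()       | _
  ... | _ ∷ []    | s≤s (s≤s ()) | _
  ... | i ∷ j ∷ l | _            | u =
    unique-∷⇒∉ (AllPairs.tail u) (subst (_∈ j ∷ l) (sym eq) (lastOf∈ j l))

  path-strand : ∀ {a b} (P : EvenPath G a b) → Strand a (EvenPath.inner P) b
  path-strand {a} {b} P = strand linked (proj₁ (unique-++⁻ (a ∷ inner) simple)) (AllPairs.tail simple)
    (halve (2∣⇒even _ (subst (2 ∣_)
      (cong suc (trans (length-++ inner) (ℕ.+-comm (length inner) 1))) (EvenPath.even P))))
    where
    open EvenPath P using (inner; linked; simple)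
    halve : ∀ {k} → Even (2 + k) → Even k
    halve (2+ e) = e

  degreeTwo⇒atMostTwo : ∀ {x} → degree x ≡ 2 → AtMostTwo x
  degreeTwo⇒atMostTwo deg≡2 = DegreeFacts.atMostTwo G
    (λ 3≤ → ℕ.<-irrefl refl (ℕ.≤-trans 3≤ (ℕ.≤-reflexive deg≡2)))

  allAtMostTwo : ∀ {l} → InnerDegreeTwo G l → All AtMostTwo l
  allAtMostTwo []         = []
  allAtMostTwo (deg ∷ ds) = degreeTwo⇒atMostTwo deg ∷ allAtMostTwo ds

-- Bouquets have threshold one

module Converse {n : ℕ} (G : Graph n) where
  open Graph G
  open Forcing G
  open Chains G

  Lies : Fin n → Fin n → List (List (Fin n)) → Set
  Lies w z ts = Any (_LiesOn_ G (w , z)) ts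

  liesOn⇒∈ : ∀ {w z t} → _LiesOn_ G (w , z) t → w ∈ t
  liesOn⇒∈ (inj₁ i) = proj₁ (infix⇒∈ i)
  liesOn⇒∈ (inj₂ i) = proj₂ (infix⇒∈ i)

  start-lies : ∀ {a z b} l → a ∉ l ∷ʳ b → _LiesOn_ G (a , z) (a ∷ l ∷ʳ b) → z ≡ firstOf l b
  start-lies l a∉ (inj₁ i) = infix-first l (λ a∈ → a∉ (∈-++⁺ˡ a∈)) i
  start-lies l a∉ (inj₂ i) = contradiction (infix-snd∈ i) a∉

  end-lies : ∀ {a z b} l → b ∉ a ∷ l → _LiesOn_ G (b , z) (a ∷ l ∷ʳ b) → z ≡ lastOf a l
  end-lies {a} l b∉ (inj₁ i) = contradiction (infix-fst∈ (a ∷ l) i) b∉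
  end-lies {a} l b∉ (inj₂ i) = infix-last a l (b∉ ∘ there) i

  centre-lies : ∀ {c z} l → c ∉ l → _LiesOn_ G (c , z) (c ∷ l ∷ʳ c) → z ≡ firstOf l c ⊎ z ≡ lastOf c l
  centre-lies l c∉ (inj₁ i) = inj₁ (infix-first l c∉ i)
  centre-lies {c} l c∉ (inj₂ i) = inj₂ (infix-last c l c∉ i)

  ∈-trace : ∀ {a b w : Fin n} l → w ∈ a ∷ l ∷ʳ b → w ≡ a ⊎ w ∈ l ⊎ w ≡ b
  ∈-trace l (here w≡a) = inj₁ w≡a
  ∈-trace l (there w∈) = inj₂ (∈-∷ʳ⁻ l w∈)

  OnlyInner : ∀ {c} → List (OddCycle G c) → Set
  OnlyInner Cs = ∀ {C} → C ∈ Cs → All AtMostTwo (OddCycle.inner C)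

  module Cycles {c} (Cs : List (OddCycle G c)) (nonempty : 1 ≤ length Cs) where

    inners : List (Fin n)
    inners = concatMap OddCycle.inner Cs

    traces : List (List (Fin n))
    traces = map OddCycle.trace Cs

    ∈-inners : ∀ {w} → w ∈ inners → ∃[ C ] C ∈ Cs × w ∈ OddCycle.inner C
    ∈-inners w∈ = let xs , w∈xs , xs∈ = ∈-concat⁻′ _ w∈ ; C , C∈ , eq = ∈-map⁻ OddCycle.inner xs∈ in
      C , C∈ , subst (_ ∈_) eq w∈xs

    inners⁺ : ∀ {C w} → C ∈ Cs → w ∈ OddCycle.inner C → w ∈ inners
    inners⁺ C∈ w∈ = ∈-concat⁺′ w∈ (∈-map⁺ OddCycle.inner C∈)

    lies⇒cycle : ∀ {w z} → Lies w z traces → ∃[ C ] C ∈ Cs × _LiesOn_ G (w , z) (OddCycle.trace C)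
    lies⇒cycle lies with t , t∈ , on ← find lies with C , C∈ , refl ← ∈-map⁻ OddCycle.trace t∈ =
      C , C∈ , on

    lies⇒within : ∀ {w z} → Lies w z traces → w ≡ c ⊎ w ∈ inners
    lies⇒within lies with C , C∈ , on ← lies⇒cycle lies with ∈-trace (OddCycle.inner C) (liesOn⇒∈ on)
    ... | inj₁ w≡c        = inj₁ w≡c
    ... | inj₂ (inj₁ w∈)  = inj₂ (inners⁺ C∈ w∈)
    ... | inj₂ (inj₂ w≡c) = inj₁ w≡c

    inners-twoNbrs : ∀ {w} → w ∈ inners → TwoNbrs w
    inners-twoNbrs w∈ = let C , _ , w∈C = ∈-inners w∈ in inner-twoNbrs _ (cycle-strand C) w∈C

    centre-twoNbrs : TwoNbrs c
    centre-twoNbrs = pick Cs nonempty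
      where
      pick : ∀ Cs → 1 ≤ length Cs → TwoNbrs c
      pick (C ∷ _) _ = firstOf (OddCycle.inner C) c , lastOf c (OddCycle.inner C) , cycle-ends C ,
        link-head (OddCycle.inner C) (OddCycle.linked C) , link-tail (OddCycle.inner C) (OddCycle.linked C)

    module _ (two : OnlyInner Cs) {B : Fin n → Set} (closed : Closed B) where

      cycleChain : ∀ {C} → C ∈ Cs → Chain closed c (OddCycle.inner C) c
      cycleChain {C} C∈ = chain closed (OddCycle.inner C) (cycle-strand C) (two C∈)

      spread : B c → ∀ {w} → w ∈ inners → B w
      spread Bc w∈ = let C , C∈ , w∈C = ∈-inners w∈ in Chain.spread (cycleChain C∈) Bc Bc w∈C

      back : ∀ {w} → w ∈ inners → B w → B c
      back w∈ Bw = let C , C∈ , w∈C = ∈-inners w∈ in [ id , id ]′ (Chain.back (cycleChain C∈) w∈C Bw)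

      fromCentre : ∀ {z} → Lies c z traces → B c → B z
      fromCentre lies Bc with C , C∈ , on ← lies⇒cycle lies
        with centre-lies (OddCycle.inner C) (unique-∷⇒∉ (OddCycle.simple C)) on
      ... | inj₁ refl = Chain.b⇒first (cycleChain C∈) Bc
      ... | inj₂ refl = Chain.a⇒last (cycleChain C∈) Bc

  twoNbrs⇒∅-closed : (∀ w → TwoNbrs w) → Closed (λ _ → ⊥)
  twoNbrs⇒∅-closed two {w} {v} _ others with p , q , p≢q , w~p , w~q ← two w with p ≟ v
  ... | no p≢v   = others p w~p p≢v
  ... | yes refl = others q w~q (≢-sym p≢q)

  module _ (O : OddCycleBouquet G) where
    open OddCycleBouquet O
    open Cycles cycles nonempty

    private
      unique : Unique (centre ∷ inners)
      unique = unique-resp-↭ (↭-sym (proj₁ whole)) (Unique.allFin⁺ n)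

      member : ∀ w → w ∈ centre ∷ inners
      member w = ∈-resp-↭ (↭-sym (proj₁ whole)) (∈-allFin w)

      onOwnCycle : ∀ {C w z} → C ∈ cycles → w ∈ OddCycle.inner C → w ~ z → _LiesOn_ G (w , z) (OddCycle.trace C)
      onOwnCycle {C} {w} {z} C∈ w∈ w~z with C′ , C′∈ , on ← lies⇒cycle (proj₂ whole w z w~z)
        with ∈-trace (OddCycle.inner C′) (liesOn⇒∈ on)
      ... | inj₁ refl         = contradiction (inners⁺ C∈ w∈) (unique-∷⇒∉ unique)
      ... | inj₂ (inj₂ refl)  = contradiction (inners⁺ C∈ w∈) (unique-∷⇒∉ unique)
      ... | inj₂ (inj₁ w∈′)
        with refl ← concatMap-injective OddCycle.inner (AllPairs.tail unique) C∈ C′∈ w∈ w∈′ = on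

      -- Derived from `whole`: all edges at an inner vertex lie on its own cycle, where it occurs
      -- once and so has one successor and one predecessor.
      inner-atMostTwo : OnlyInner cycles
      inner-atMostTwo {C} C∈ = All.tabulate λ w∈ w~a w~b w~d a≢b →
        choose a≢b (onOwnCycle C∈ w∈ w~a) (onOwnCycle C∈ w∈ w~b) (onOwnCycle C∈ w∈ w~d)
        where
        open OddCycle C using (inner; simple)
        succ : ∀ {w a b} → Infix _≡_ (w ∷ a ∷ []) (OddCycle.trace C) →
               Infix _≡_ (w ∷ b ∷ []) (OddCycle.trace C) → a ≡ b
        succ = infix-succ (centre ∷ inner) simple
        pred : ∀ {w a b} → Infix _≡_ (a ∷ w ∷ []) (OddCycle.trace C) →
               Infix _≡_ (b ∷ w ∷ []) (OddCycle.trace C) → a ≡ b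
        pred = infix-pred (unique-∷ʳ (AllPairs.tail simple) (unique-∷⇒∉ simple))
        choose : ∀ {w a b d} → a ≢ b → _LiesOn_ G (w , a) (OddCycle.trace C) →
                 _LiesOn_ G (w , b) (OddCycle.trace C) → _LiesOn_ G (w , d) (OddCycle.trace C) →
                 d ≡ a ⊎ d ≡ b
        choose a≢b (inj₁ i) (inj₁ j) _        = contradiction (succ i j) a≢b
        choose a≢b (inj₂ i) (inj₂ j) _        = contradiction (pred i j) a≢b
        choose a≢b (inj₁ i) (inj₂ j) (inj₁ k) = inj₁ (succ k i)
        choose a≢b (inj₁ i) (inj₂ j) (inj₂ k) = inj₂ (pred k j)
        choose a≢b (inj₂ i) (inj₁ j) (inj₁ k) = inj₂ (succ k j)
        choose a≢b (inj₂ i) (inj₁ j) (inj₂ k) = inj₁ (pred k i)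

    bouquet⇒thresholdOne : Threshold.ThresholdOne G
    bouquet⇒thresholdOne = twoNbrs⇒∅-closed twoNbrs , spreads
      where
      twoNbrs : ∀ w → TwoNbrs w
      twoNbrs w with member w
      ... | here refl = centre-twoNbrs
      ... | there w∈  = inners-twoNbrs w∈
      spreads : ∀ {B} → Closed B → ∀ x → B x → ∀ v → B v
      spreads {B} closed x Bx v = from-member (member v)
        where
        Bc : x ∈ centre ∷ inners → B centre
        Bc (here refl) = Bx
        Bc (there x∈)  = back inner-atMostTwo closed x∈ Bx
        from-member : v ∈ centre ∷ inners → B v
        from-member (here refl) = Bc (member x)
        from-member (there v∈)  = spread inner-atMostTwo closed (Bc (member x)) v∈

-- Dipoles have threshold one

module DipoleConverse {n : ℕ} (G : Graph n) where
  open Graph G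
  open Forcing G
  open Chains G
  open Converse G

  module EvenPaths {a b} (P : EvenPath G a b) where
    open EvenPath P using (inner; trace; simple; linked) public

    a∉ : a ∉ inner ∷ʳ b
    a∉ = unique-∷⇒∉ simple

    b∉ : b ∉ a ∷ inner
    b∉ b∈ = proj₂ (proj₂ (unique-++⁻ (a ∷ inner) simple)) (b∈ , here refl)

    a∈trace : a ∈ trace
    a∈trace = here refl

    b∈trace : b ∈ trace
    b∈trace = there (∈-++⁺ʳ inner (here refl))

    last∈trace : lastOf a inner ∈ trace
    last∈trace = ∈-++⁺ˡ {xs = a ∷ inner} (lastOf∈ a inner)

    pathChain : ∀ {B} (closed : Closed B) → Chain closed a inner b
    pathChain closed = chain closed inner (path-strand P) (allAtMostTwo (EvenPath.degreeTwo P))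

    trace-spread : ∀ {B} → Closed B → B a → B b → ∀ {w} → w ∈ trace → B w
    trace-spread closed Ba Bb w∈ with ∈-trace inner w∈
    ... | inj₁ refl        = Ba
    ... | inj₂ (inj₁ w∈i)  = Chain.spread (pathChain closed) Ba Bb w∈i
    ... | inj₂ (inj₂ refl) = Bb

    trace-back : ∀ {B} → Closed B → ∀ {w} → w ∈ trace → B w → B a ⊎ B b
    trace-back closed w∈ Bw with ∈-trace inner w∈
    ... | inj₁ refl        = inj₁ Bw
    ... | inj₂ (inj₁ w∈i)  = Chain.back (pathChain closed) w∈i Bw
    ... | inj₂ (inj₂ refl) = inj₂ Bw

  module Multi {b c} (M : MultiPath G b c) where
    open MultiPath M using (paths; multiple; inners; traces)

    ∈-inners : ∀ {w} → w ∈ inners → ∃[ P ] P ∈ paths × w ∈ EvenPath.inner P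
    ∈-inners w∈ = let xs , w∈xs , xs∈ = ∈-concat⁻′ _ w∈ ; P , P∈ , eq = ∈-map⁻ EvenPath.inner xs∈ in
      P , P∈ , subst (_ ∈_) eq w∈xs

    inners⁺ : ∀ {P w} → P ∈ paths → w ∈ EvenPath.inner P → w ∈ inners
    inners⁺ P∈ w∈ = ∈-concat⁺′ w∈ (∈-map⁺ EvenPath.inner P∈)

    lies⇒path : ∀ {w z} → Lies w z traces → ∃[ P ] P ∈ paths × _LiesOn_ G (w , z) (EvenPath.trace P)
    lies⇒path lies with t , t∈ , on ← find lies with P , P∈ , refl ← ∈-map⁻ EvenPath.trace t∈ =
      P , P∈ , on

    lies⇒within : ∀ {w z} → Lies w z traces → w ≡ b ⊎ w ∈ inners ⊎ w ≡ c
    lies⇒within lies with P , P∈ , on ← lies⇒path lies with ∈-trace (EvenPath.inner P) (liesOn⇒∈ on)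
    ... | inj₁ w≡b        = inj₁ w≡b
    ... | inj₂ (inj₁ w∈)  = inj₂ (inj₁ (inners⁺ P∈ w∈))
    ... | inj₂ (inj₂ w≡c) = inj₂ (inj₂ w≡c)

    inners-twoNbrs : ∀ {w} → w ∈ inners → TwoNbrs w
    inners-twoNbrs w∈ = let P , _ , w∈P = ∈-inners w∈ in inner-twoNbrs _ (path-strand P) w∈P

    somePath : ∃[ P ] P ∈ paths
    somePath = pick paths multiple
      where
      pick : ∀ Ps → 2 ≤ length Ps → ∃[ P ] P ∈ Ps
      pick (P ∷ _) _ = P , here refl

    start-nbr : ∃[ z ] b ~ z × (z ∈ inners ⊎ z ≡ c)
    start-nbr with P , P∈ ← somePath =
      firstOf (EvenPath.inner P) c , link-head (EvenPath.inner P) (EvenPath.linked P) ,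
      (case firstOf∈⊎≡ (EvenPath.inner P) c of λ where
        (inj₁ z∈)  → inj₁ (inners⁺ P∈ z∈)
        (inj₂ z≡c) → inj₂ z≡c)

    end-nbr : ∃[ z ] c ~ z × (z ∈ inners ⊎ z ≡ b)
    end-nbr with P , P∈ ← somePath =
      lastOf b (EvenPath.inner P) , link-tail (EvenPath.inner P) (EvenPath.linked P) ,
      (case lastOf∈ b (EvenPath.inner P) of λ where
        (here z≡b) → inj₂ z≡b
        (there z∈) → inj₁ (inners⁺ P∈ z∈))

    module _ {B : Fin n → Set} (closed : Closed B) where

      spread : B b → B c → ∀ {w} → w ∈ inners → B w
      spread Bb Bc w∈ = let P , _ , w∈P = ∈-inners w∈ in
        Chain.spread (EvenPaths.pathChain P closed) Bb Bc w∈P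

      back : ∀ {w} → w ∈ inners → B w → B b ⊎ B c
      back w∈ Bw = let P , _ , w∈P = ∈-inners w∈ in Chain.back (EvenPaths.pathChain P closed) w∈P Bw

      fromStart : ∀ {z} → Lies b z traces → B c → B z
      fromStart lies Bc with P , _ , on ← lies⇒path lies
        with refl ← start-lies (EvenPath.inner P) (EvenPaths.a∉ P) on =
        Chain.b⇒first (EvenPaths.pathChain P closed) Bc

      fromEnd : ∀ {z} → Lies c z traces → B b → B z
      fromEnd lies Bb with P , _ , on ← lies⇒path lies
        with refl ← end-lies (EvenPath.inner P) (EvenPaths.b∉ P) on =
        Chain.a⇒last (EvenPaths.pathChain P closed) Bb

  bouquet-atMostTwo : ∀ {c} (K : Bouquet G c) → OnlyInner (Bouquet.cycles K)
  bouquet-atMostTwo K C∈ = allAtMostTwo (All.lookup (Bouquet.degreeTwo K) C∈)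

  head∈vertices : ∀ {x v} (link : Alternating G x v) → x ∈ vertices G link
  head∈vertices (single P)     = here refl
  head∈vertices (P ▸ M ▸ rest) = here refl

  module _ {v} (K : Bouquet G v) {B : Fin n → Set} (closed : Closed B) where

    private
      module K = Cycles (Bouquet.cycles K) (Bouquet.nonempty K)

    -- The part of the dipole from x onwards: the first path of the link leaves
    -- x through f and ends at y.
    record Tail (x : Fin n) (vs : List (Fin n)) (ts : List (List (Fin n))) : Set where
      field
        y f     : Fin n
        x~f     : x ~ f
        f∈      : f ∈ vs
        f⇒y     : B f → B y
        only    : ∀ {z} → Lies x z ts → z ≡ f
        within  : ∀ {w z} → Lies w z ts → w ∈ vs
        -- The round trip inside the tail, out to `v` and back. The step from `x` to `y` also uses
        -- edges before `x`, so the tail contributes only `f⇒y`.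
        y⇒x     : B y → B x
        spread  : B x → B y → ∀ {w} → w ∈ vs → B w
        back    : ∀ {w} → w ∈ vs → B w → B x
        twoNbrs : ∀ {w} → w ∈ vs → w ≢ x → TwoNbrs w

    EdgesOn : Fin n → List (Fin n) → List (List (Fin n)) → Set
    EdgesOn x vs ts = ∀ {w z} → w ∈ vs → w ≢ x → w ~ z → Lies w z ts

    lastTail : ∀ {x} (P : EvenPath G x v) →
               let vs = EvenPath.trace P ++ K.inners ; ts = EvenPath.trace P ∷ K.traces in
               Unique vs → EdgesOn x vs ts → Tail x vs ts
    lastTail {x} P u edges = record
      { y = v ; f = firstOf inner v
      ; x~f = link-head inner linked
      ; f∈ = ∈-++⁺ˡ (there (firstOf∈ inner v))
      ; f⇒y = C.first⇒b
      ; only = only ; within = within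
      ; y⇒x = v⇒x
      ; spread = λ Bx Bv w∈ → case ∈-++⁻ trace w∈ of λ where
          (inj₁ w∈t) → trace-spread closed Bx Bv w∈t
          (inj₂ w∈k) → K.spread (bouquet-atMostTwo K) closed Bv w∈k
      ; back = λ w∈ Bw → case ∈-++⁻ trace w∈ of λ where
          (inj₁ w∈t) → [ id , v⇒x ]′ (trace-back closed w∈t Bw)
          (inj₂ w∈k) → v⇒x (K.back (bouquet-atMostTwo K) closed w∈k Bw)
      ; twoNbrs = twoNbrs }
      where
      open EvenPaths P
      module C = Chain (pathChain closed)
      vs′ : List (Fin n)
      vs′ = trace ++ K.inners
      ts′ : List (List (Fin n))
      ts′ = trace ∷ K.traces
      disjoint : Disjoint trace K.inners
      disjoint = proj₂ (proj₂ (unique-++⁻ trace u))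
      only : ∀ {z} → Lies x z ts′ → z ≡ firstOf inner v
      only (here on)    = start-lies inner a∉ on
      only (there lies) with K.lies⇒within lies
      ... | inj₁ refl = contradiction (∈-++⁺ʳ inner (here refl)) a∉
      ... | inj₂ x∈   = contradiction (a∈trace , x∈) disjoint
      within : ∀ {w z} → Lies w z ts′ → w ∈ vs′
      within (here on) = ∈-++⁺ˡ (liesOn⇒∈ on)
      within (there lies) with K.lies⇒within lies
      ... | inj₁ refl = ∈-++⁺ˡ b∈trace
      ... | inj₂ w∈   = ∈-++⁺ʳ trace w∈
      v≢x : v ≢ x
      v≢x refl = a∉ (∈-++⁺ʳ inner (here refl))
      -- The turning point: a blue `v` colours its neighbours on its own cycles, so it forces its
      -- neighbour on `P`, which agrees with `x`.
      v⇒x : B v → B x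
      v⇒x Bv = C.last⇒a (closed (link-tail inner linked) λ z v~z z≢last →
        case edges (∈-++⁺ˡ b∈trace) v≢x v~z of λ where
          (here on)    → contradiction (end-lies inner b∉ on) z≢last
          (there lies) → K.fromCentre (bouquet-atMostTwo K) closed lies Bv)
      twoNbrs : ∀ {w} → w ∈ vs′ → w ≢ x → TwoNbrs w
      twoNbrs w∈ w≢x with ∈-++⁻ trace w∈
      ... | inj₂ w∈k = K.inners-twoNbrs w∈k
      ... | inj₁ w∈t with ∈-trace inner w∈t
      ...   | inj₁ w≡x         = contradiction w≡x w≢x
      ...   | inj₂ (inj₁ w∈i)  = inner-twoNbrs inner (path-strand P) w∈i
      ...   | inj₂ (inj₂ refl) = K.centre-twoNbrs

    module _ {x b c} (P : EvenPath G x b) (M : MultiPath G b c)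
             {vsR : List (Fin n)} {tsR : List (List (Fin n))} where

      private
        module M = Multi M
        open EvenPaths P
        vs′ : List (Fin n)
        vs′ = trace ++ MultiPath.inners M ++ vsR
        ts′ : List (List (Fin n))
        ts′ = trace ∷ MultiPath.traces M ++ tsR

      edges-rest : c ∈ vsR → Unique vs′ → EdgesOn x vs′ ts′ → EdgesOn c vsR tsR
      edges-rest c∈ u edges {w} {z} w∈ w≢c w~z
        with edges (∈-++⁺ʳ trace (∈-++⁺ʳ (MultiPath.inners M) w∈))
                   (λ { refl → disjoint (a∈trace , ∈-++⁺ʳ (MultiPath.inners M) w∈) }) w~z
        where disjoint = proj₂ (proj₂ (unique-++⁻ trace u))
      ... | here on = contradiction
        (liesOn⇒∈ on , ∈-++⁺ʳ (MultiPath.inners M) w∈) (proj₂ (proj₂ (unique-++⁻ trace u)))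
      ... | there lies with Any-++⁻ (MultiPath.traces M) lies
      ...   | inj₂ liesR = liesR
      ...   | inj₁ liesM with M.lies⇒within liesM
      ...     | inj₁ refl       = contradiction
        (b∈trace , ∈-++⁺ʳ (MultiPath.inners M) w∈) (proj₂ (proj₂ (unique-++⁻ trace u)))
      ...     | inj₂ (inj₂ w≡c) = contradiction w≡c w≢c
      ...     | inj₂ (inj₁ w∈M) = contradiction (w∈M , w∈) (proj₂ (proj₂
        (unique-++⁻ (MultiPath.inners M) (proj₁ (proj₂ (unique-++⁻ trace u))))))

      furtherTail : c ∈ vsR → Unique vs′ → EdgesOn x vs′ ts′ → Tail c vsR tsR → Tail x vs′ ts′
      furtherTail c∈ u edges R = record
        { y = b ; f = firstOf inner b
        ; x~f = link-head inner linked
        ; f∈ = ∈-++⁺ˡ (there (firstOf∈ inner b))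
        ; f⇒y = C.first⇒b
        ; only = only ; within = within
        ; y⇒x = c⇒x ∘ R.y⇒x ∘ b⇒y
        ; spread = λ Bx Bb w∈ → let By = b⇒y Bb ; Bc = R.y⇒x By in case ∈-++⁻ trace w∈ of λ where
            (inj₁ w∈t) → trace-spread closed Bx Bb w∈t
            (inj₂ w∈′) → [ M.spread closed Bb Bc , R.spread Bc By ]′ (∈-++⁻ inners w∈′)
        ; back = λ w∈ Bw → case ∈-++⁻ trace w∈ of λ where
            (inj₁ w∈t) → [ id , b⇒x ]′ (trace-back closed w∈t Bw)
            (inj₂ w∈′) → case ∈-++⁻ inners w∈′ of λ where
              (inj₁ w∈m) → [ b⇒x , c⇒x ]′ (M.back closed w∈m Bw)
              (inj₂ w∈r) → c⇒x (R.back w∈r Bw)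
        ; twoNbrs = twoNbrs }
        where
        module C = Chain (pathChain closed)
        module R = Tail R
        inners : List (Fin n)
        inners = MultiPath.inners M
        disjoint : Disjoint trace (inners ++ vsR)
        disjoint = proj₂ (proj₂ (unique-++⁻ trace u))
        disjointR : Disjoint inners vsR
        disjointR = proj₂ (proj₂ (unique-++⁻ inners (proj₁ (proj₂ (unique-++⁻ trace u)))))
        c∈′ : c ∈ inners ++ vsR
        c∈′ = ∈-++⁺ʳ inners c∈
        c∉trace : c ∉ trace
        c∉trace c∈t = disjoint (c∈t , c∈′)
        x∉rest : x ∉ inners ++ vsR
        x∉rest x∈ = disjoint (a∈trace , x∈)
        b∉rest : b ∉ inners ++ vsR
        b∉rest b∈ = disjoint (b∈trace , b∈)
        b≢x : b ≢ x
        b≢x refl = a∉ (∈-++⁺ʳ inner (here refl))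
        only : ∀ {z} → Lies x z ts′ → z ≡ firstOf inner b
        only (here on)    = start-lies inner a∉ on
        only (there lies) with Any-++⁻ (MultiPath.traces M) lies
        ... | inj₂ liesR = contradiction (∈-++⁺ʳ inners (R.within liesR)) x∉rest
        ... | inj₁ liesM with M.lies⇒within liesM
        ...   | inj₁ x≡b         = contradiction (sym x≡b) b≢x
        ...   | inj₂ (inj₁ x∈M)  = contradiction (∈-++⁺ˡ x∈M) x∉rest
        ...   | inj₂ (inj₂ refl) = contradiction c∈′ x∉rest
        within : ∀ {w z} → Lies w z ts′ → w ∈ vs′
        within (here on) = ∈-++⁺ˡ (liesOn⇒∈ on)
        within (there lies) with Any-++⁻ (MultiPath.traces M) lies
        ... | inj₂ liesR = ∈-++⁺ʳ trace (∈-++⁺ʳ inners (R.within liesR))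
        ... | inj₁ liesM with M.lies⇒within liesM
        ...   | inj₁ refl        = ∈-++⁺ˡ b∈trace
        ...   | inj₂ (inj₁ w∈M)  = ∈-++⁺ʳ trace (∈-++⁺ˡ w∈M)
        ...   | inj₂ (inj₂ refl) = ∈-++⁺ʳ trace c∈′
        -- The neighbours of `b` on the multiple paths agree with `c`, so `b` forces its neighbour
        -- on `P`, and this one agrees with `x`.
        c⇒x : B c → B x
        c⇒x Bc = C.last⇒a (closed (link-tail inner linked) others)
          where
          others : ∀ z → b ~ z → z ≢ lastOf x inner → B z
          others z b~z z≢last with edges (∈-++⁺ˡ b∈trace) b≢x b~z
          ... | here on    = contradiction (end-lies inner b∉ on) z≢last
          ... | there lies with Any-++⁻ (MultiPath.traces M) lies
          ...   | inj₁ liesM = M.fromStart closed liesM Bc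
          ...   | inj₂ liesR = contradiction (∈-++⁺ʳ inners (R.within liesR)) b∉rest
        -- The neighbours of `c` on the multiple paths agree with `b`, so `c` forces the first
        -- vertex of the next single path, which agrees with the far end.
        b⇒y : B b → B R.y
        b⇒y Bb = R.f⇒y (closed R.x~f others)
          where
          others : ∀ z → c ~ z → z ≢ R.f → B z
          others z c~z z≢f with edges (∈-++⁺ʳ trace c∈′) (λ { refl → x∉rest c∈′ }) c~z
          ... | here on    = contradiction (liesOn⇒∈ on) c∉trace
          ... | there lies with Any-++⁻ (MultiPath.traces M) lies
          ...   | inj₁ liesM = M.fromEnd closed liesM Bb
          ...   | inj₂ liesR = contradiction (R.only liesR) z≢f
        b⇒x : B b → B x
        b⇒x = c⇒x ∘ R.y⇒x ∘ b⇒y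
        twoNbrs : ∀ {w} → w ∈ vs′ → w ≢ x → TwoNbrs w
        twoNbrs {w} w∈ w≢x with ∈-++⁻ trace w∈
        ... | inj₁ w∈t with ∈-trace inner w∈t
        ...   | inj₁ w≡x         = contradiction w≡x w≢x
        ...   | inj₂ (inj₁ w∈i)  = inner-twoNbrs inner (path-strand P) w∈i
        ...   | inj₂ (inj₂ refl) with z , b~z , z∈ ← M.start-nbr =
          lastOf x inner , z ,
          (λ { refl → disjoint (last∈trace , [ ∈-++⁺ˡ , (λ { refl → c∈′ }) ]′ z∈) }) ,
          link-tail inner linked , b~z
        twoNbrs {w} w∈ w≢x | inj₂ w∈′ with ∈-++⁻ inners w∈′
        ... | inj₁ w∈m = M.inners-twoNbrs w∈m
        ... | inj₂ w∈r with w ≟ c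
        ...   | no w≢c   = R.twoNbrs w∈r w≢c
        ...   | yes refl with z , c~z , z∈ ← M.end-nbr =
          R.f , z ,
          (λ { refl → [ (λ z∈m → disjointR (z∈m , R.f∈))
                      , (λ { refl → b∉rest (∈-++⁺ʳ inners R.f∈) }) ]′ z∈ }) ,
          R.x~f , c~z

    -- The two lists enter through equations, so that the appends can be reassociated by matching on
    -- `refl`.
    tail : ∀ {x} (link : Alternating G x v) {vs ts} → vertices G link ++ K.inners ≡ vs →
           segments G link ++ K.traces ≡ ts → Unique vs → EdgesOn x vs ts → Tail x vs ts
    tail (single P) refl refl u edges = lastTail P u edges
    tail (P ▸ M ▸ rest) {vs} {ts} eqᵛ eqᵗ u edges
      with refl ← trans (sym (trans (++-assoc (EvenPath.trace P) _ K.inners)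
                    (cong (EvenPath.trace P ++_) (++-assoc (MultiPath.inners M) (vertices G rest) K.inners)))) eqᵛ
         | refl ← trans (sym (cong (EvenPath.trace P ∷_)
                    (++-assoc (MultiPath.traces M) (segments G rest) K.traces))) eqᵗ =
      furtherTail P M c∈ u edges (tail rest refl refl
        (proj₁ (proj₂ (unique-++⁻ (MultiPath.inners M) (proj₁ (proj₂ (unique-++⁻ (EvenPath.trace P) u))))))
        (edges-rest P M c∈ u edges))
      where
      c∈ = ∈-++⁺ˡ (head∈vertices rest)

  module _ (D : DoublyExtendedBouquetDipole G) where
    open DoublyExtendedBouquetDipole D

    private
      module U = Cycles (Bouquet.cycles bouquetᵘ) (Bouquet.nonempty bouquetᵘ)
      module V = Cycles (Bouquet.cycles bouquetᵛ) (Bouquet.nonempty bouquetᵛ)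
      vs : List (Fin n)
      vs = vertices G link ++ V.inners
      ts : List (List (Fin n))
      ts = segments G link ++ V.traces
      unique : Unique (U.inners ++ vs)
      unique = unique-resp-↭ (↭-sym (proj₁ whole)) (Unique.allFin⁺ n)
      disjoint : Disjoint U.inners vs
      disjoint = proj₂ (proj₂ (unique-++⁻ U.inners unique))
      member : ∀ w → w ∈ U.inners ⊎ w ∈ vs
      member w = ∈-++⁻ U.inners (∈-resp-↭ (↭-sym (proj₁ whole)) (∈-allFin w))
      u∈ : u ∈ vs
      u∈ = ∈-++⁺ˡ (head∈vertices link)
      edges : ∀ {w z} → w ~ z → Lies w z U.traces ⊎ Lies w z ts
      edges {w} {z} w~z = Any-++⁻ U.traces (proj₂ whole w z w~z)
      edges-tail : ∀ {w z} → w ∈ vs → w ≢ u → w ~ z → Lies w z ts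
      edges-tail w∈ w≢u w~z with edges w~z
      ... | inj₂ lies = lies
      ... | inj₁ lies with U.lies⇒within lies
      ...   | inj₁ w≡u = contradiction w≡u w≢u
      ...   | inj₂ w∈U = contradiction (w∈U , w∈) disjoint
      tailOf : ∀ {B} (closed : Closed B) → Tail bouquetᵛ closed u vs ts
      tailOf closed = tail bouquetᵛ closed link refl refl
        (proj₁ (proj₂ (unique-++⁻ U.inners unique))) edges-tail

    dipole⇒thresholdOne : Threshold.ThresholdOne G
    dipole⇒thresholdOne = twoNbrs⇒∅-closed twoNbrs , spreads
      where
      twoNbrs : ∀ w → TwoNbrs w
      twoNbrs w with member w | w ≟ u
      ... | inj₁ w∈U | _        = U.inners-twoNbrs w∈U
      ... | inj₂ _   | yes refl = U.centre-twoNbrs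
      -- `twoNbrs` does not mention the predicate, so a trivially true one is supplied.
      ... | inj₂ w∈  | no w≢u   = Tail.twoNbrs (tailOf {λ v → v ≡ v} (λ _ _ → refl)) w∈ w≢u
      spreads : ∀ {B} → Closed B → ∀ x → B x → ∀ w → B w
      spreads {B} closed x Bx w = [ U.spread (bouquet-atMostTwo bouquetᵘ) closed Bu , T.spread Bu By ]′ (member w)
        where
        module T = Tail (tailOf closed)
        Bu : B u
        Bu = [ (λ x∈U → U.back (bouquet-atMostTwo bouquetᵘ) closed x∈U Bx) , (λ x∈ → T.back x∈ Bx) ]′ (member x)
        -- A blue `u` colours all its neighbours on its cycles, so it forces the first vertex of the
        -- link; this starts the round trip.
        others : ∀ z → u ~ z → z ≢ T.f → B z
        others z u~z z≢f with edges u~z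
        ... | inj₁ lies = U.fromCentre (bouquet-atMostTwo bouquetᵘ) closed lies Bu
        ... | inj₂ lies = contradiction (T.only lies) z≢f
        By : B T.y
        By = T.f⇒y (closed T.x~f others)

-- Each family makes forcing a matter of cardinality

module Uniformity {n : ℕ} (G : Graph n) where
  open Graph G
  open Forcing G

  -- Without edges every predicate is closed, so only the full set forces.
  edgeless⇒uniform : IsEdgeless G → Uniform
  edgeless⇒uniform edgeless {Z} {F} ∣Z∣≡∣F∣ fZ =
    subst (SkewForcing G) (sym (∣p∣≡n⇒p≡⊤ (trans (sym ∣Z∣≡∣F∣) ∣Z∣≡n))) ε
    where
    full : ∀ v → v ∈ˢ Z
    full = forcing-ind fZ (λ w~v _ → contradiction w~v (edgeless _ _)) id
    ∣Z∣≡n : ∣ Z ∣ ≡ n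
    ∣Z∣≡n = trans (cong ∣_∣ (⊆-antisym ⊆⊤ (λ {x} _ → full x))) (∣⊤∣≡n n)

  thresholdOne⇒uniform : .{{NonZero n}} → Threshold.ThresholdOne G → Uniform
  thresholdOne⇒uniform (∅-closed , ind) {Z} {F} ∣Z∣≡∣F∣ fZ with nonempty? F
  ... | yes (x , x∈F) = closed⇒forcing (λ closed F⊆B → ind closed x (F⊆B x∈F))
  ... | no F-empty = ⊥-elim (forcing-ind fZ ∅-closed (λ x∈Z → ℕ.<-irrefl
    (sym (trans (length-elements Z) (trans ∣Z∣≡∣F∣ (trans (cong ∣_∣ (Empty-unique F-empty)) (∣⊥∣≡0 n)))))
    (∈-length (∈-elements⁺ x∈Z))) someVertex)
    where
    someVertex : Fin n
    someVertex = fromℕ< (ℕ.n≢0⇒n>0 (≢-nonZero⁻¹ n))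

  emptyForces⇒uniform : Orderable.EmptyForces G → Uniform
  emptyForces⇒uniform emptyForces _ _ = closed⇒forcing (λ closed _ → emptyForces closed)

  module _ (complete : IsComplete G) where

    -- Every vertex is adjacent to at least two of three white vertices, so nothing can ever be
    -- forced among them.
    threeWhites⇒¬forcing : ∀ {Z a b c} → a ≢ b → a ≢ c → b ≢ c → a ∉ˢ Z → b ∉ˢ Z → c ∉ˢ Z →
                           ¬ SkewForcing G Z
    threeWhites⇒¬forcing {Z} {a} {b} {c} a≢b a≢c b≢c a∉ b∉ c∉ fZ =
      a∉ (forcing-ind fZ closed id a)
      where
      closed : Closed (_∈ˢ Z)
      closed {w} {v} w~v others with a ≟ v | a ≟ w | b ≟ v | b ≟ w
      ... | no a≢v   | no a≢w   | _        | _        =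
        contradiction (others a (complete w a (≢-sym a≢w)) a≢v) a∉
      ... | _        | _        | no b≢v   | no b≢w   =
        contradiction (others b (complete w b (≢-sym b≢w)) b≢v) b∉
      ... | yes refl | _        | yes refl | _        = contradiction refl a≢b
      ... | _        | yes refl | _        | yes refl = contradiction refl a≢b
      ... | yes refl | _        | _        | yes refl =
        contradiction (others c (complete w c b≢c) (≢-sym a≢c)) c∉
      ... | _        | yes refl | yes refl | _        =
        contradiction (others c (complete w c a≢c) (≢-sym b≢c)) c∉

    white : ∀ {T w v} → Closed (_∈ˢ T) → v ∉ˢ T → w ≢ v → ∃[ x ] x ≢ w × x ≢ v × x ∉ˢ T
    white {T} {w} {v} closed v∉T w≢v
      with any? (λ x → ¬? (x ≟ w) ×-dec ¬? (x ≟ v) ×-dec ¬? (x ∈? T))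
    ... | yes found = found
    ... | no none = contradiction (closed (complete w v w≢v) λ x w~x x≢v →
      decidable-stable (x ∈? T) λ x∉ → none (x , (λ { refl → irreflexive w~x }) , x≢v , x∉)) v∉T

    -- For order at least 2, a set forces exactly when at most two vertices are white: a stuck set
    -- misses three vertices, so `F` does, and then so does `Z`, which has the same size.
    complete⇒uniform : Uniform
    complete⇒uniform {Z} {F} ∣Z∣≡∣F∣ fZ = decidable-stable (skewForcing? G F) refute
      where
      refute : ¬ SkewForcing G F → ⊥
      refute ¬fF with T , F⊆T , closed , v , v∉T ← ¬forcing⇒stalled ¬fF
        with any? (λ w → ¬? (w ≟ v))
      -- There is no vertex besides `v`: in order 1 the complete graph is edgeless.
      ... | no none = ¬fF (edgeless⇒uniform (λ a b a~b → irreflexive (subst (_~ b)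
        (trans (only a) (sym (only b))) a~b)) ∣Z∣≡∣F∣ fZ)
        where
        only : ∀ w → w ≡ v
        only w = decidable-stable (w ≟ v) (λ w≢v → none (w , w≢v))
      ... | yes (w , w≢v)
        -- The first call needs some vertex other than `v` as observer; in the second `v` observes
        -- `x`, so `y` differs from both.
        with x , _ , x≢v , x∉T ← white closed v∉T w≢v
        with y , y≢v , y≢x , y∉T ← white closed x∉T (≢-sym x≢v) =
        three (elements (∁ Z)) (elements-unique (∁ Z)) (λ z∈ → x∈∁p⇒x∉p (∈-elements⁻ (∁ Z) z∈))
          (ℕ.≤-trans
            (unique-⊆⇒length≤ {xs = v ∷ x ∷ y ∷ []}
              ((≢-sym x≢v ∷ ≢-sym y≢v ∷ []) ∷ (≢-sym y≢x ∷ []) ∷ ([] ∷ []))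
              λ { (here refl) → ∁F⁺ v∉T ; (there (here refl)) → ∁F⁺ x∉T
                ; (there (there (here refl))) → ∁F⁺ y∉T })
            (ℕ.≤-reflexive (trans (length-elements (∁ F)) (trans (∣∁p∣≡n∸∣p∣ F)
              (trans (cong (n ∸_) (sym ∣Z∣≡∣F∣)) (trans (sym (∣∁p∣≡n∸∣p∣ Z)) (sym (length-elements (∁ Z)))))))))
        where
        ∁F⁺ : ∀ {z} → z ∉ˢ T → z ∈ elements (∁ F)
        ∁F⁺ z∉T = ∈-elements⁺ (x∉p⇒x∈∁p (z∉T ∘ F⊆T))
        three : ∀ l → Unique l → (∀ {z} → z ∈ l → z ∉ˢ Z) → 3 ≤ length l → ⊥
        three (a ∷ b ∷ c ∷ _) ((a≢b ∷ a≢c ∷ _) ∷ (b≢c ∷ _) ∷ _) white _ =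
          threeWhites⇒¬forcing a≢b a≢c b≢c (white (here refl)) (white (there (here refl)))
            (white (there (there (here refl)))) fZ
        three (_ ∷ _ ∷ []) _ _ (s≤s (s≤s ()))
        three (_ ∷ [])     _ _ (s≤s ())

theorem9 : (n : ℕ) .{{_ : NonZero n}} (G : Graph n) →
    λ⁻ G ≡ 0 ⇔
    (IsComplete G
    ⊎ IsEdgeless G
    ⊎ DoublyExtendedBouquetDipole G
    ⊎ OddCycleBouquet G
    ⊎ TwoSetPerfectlyOrderable G)
theorem9 n G = mk⇔ classify converse
  where
  open Forcing G
  open Uniformity G
  classify : λ⁻ G ≡ 0 → _
  classify λ⁻≡0 with Threshold.trichotomy G (λ⁻≡0⇒uniform λ⁻≡0)
  ... | inj₁ emptyForces           = inj₂ (inj₂ (inj₂ (inj₂ (Orderable.emptyForces⇒orderable G emptyForces))))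
  ... | inj₂ (inj₁ edgeless)       = inj₂ (inj₁ edgeless)
  ... | inj₂ (inj₂ (inj₁ complete)) = inj₁ complete
  ... | inj₂ (inj₂ (inj₂ (2≤n , thresholdOne))) with thresholdOne⇒cyclic G 2≤n thresholdOne
  ...   | inj₁ dipole  = inj₂ (inj₂ (inj₁ dipole))
  ...   | inj₂ bouquet = inj₂ (inj₂ (inj₂ (inj₁ bouquet)))
  converse : _ → λ⁻ G ≡ 0
  converse (inj₁ complete) = uniform⇒λ⁻≡0 (complete⇒uniform complete)
  converse (inj₂ (inj₁ edgeless)) = uniform⇒λ⁻≡0 (edgeless⇒uniform edgeless)
  converse (inj₂ (inj₂ (inj₁ dipole))) =
    uniform⇒λ⁻≡0 (thresholdOne⇒uniform (DipoleConverse.dipole⇒thresholdOne G dipole))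
  converse (inj₂ (inj₂ (inj₂ (inj₁ bouquet)))) =
    uniform⇒λ⁻≡0 (thresholdOne⇒uniform (Converse.bouquet⇒thresholdOne G bouquet))
  converse (inj₂ (inj₂ (inj₂ (inj₂ orderable)))) =
    uniform⇒λ⁻≡0 (emptyForces⇒uniform (Orderable.orderable⇒emptyForces G orderable))
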